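{- Suppose $0<\beta\ll\alpha\ll 1$ and $n$ is sufficiently large; that is, there is $\alpha_0>0$ such that for every $0<\alpha\le\alpha_0$ there is $\beta_0>0$ such that for every $0<\beta\le\beta_0$ there is $n_0$ such that for all $n\ge n_0$ the following holds. Let $G$ be a $3$-connected graph on $n$ vertices with $\delta(G)\ge (2n+3)/5$. If there is a partition $V(G)=V_1\cup V_2$ with $|V_1|>(3/5-\alpha)n$, $d(V_1,V_2)\ge 1-3\alpha$, and $\deg(v_1,V_2)\ge (2n+3)/5-2\beta n$ for every $v_1\in V_1$, then $G$ contains a spanning generalized Halin graph.
   Context: All graphs are finite and simple. $\deg(v,S)$ is the number of neighbors of $v$ in $S$; $d(V_1,V_2)=e(V_1,V_2)/(|V_1||V_2|)$ where $e(V_1,V_2)$ is the number of edges with one end in $V_1$ and the other in $V_2$. For a tree $T$, $L(T)$ is its set of leaves; a HIST of $G$ is a spanning tree with no vertex of degree $2$; a spanning generalized Halin graph of $G$ is a spanning subgraph $T\cup C$ of $G$ with $T$ a HIST of $G$ and $C$ a cycle of $G$ with $V(C)=L(T)$. -}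

module Defs where

open import Data.Nat using (ℕ; zero; suc; _≤_; _<_)
import Data.Nat as ℕ
open import Data.Integer using (+_)
open import Data.Rational using (ℚ; _/_; _÷_)
import Data.Rational as ℚ
open import Data.Fin using (Fin)
open import Data.Bool using (Bool; true; false; if_then_else_; not)
open import Data.List using (List; []; _∷_; length; map; allFin; _++_; take)
open import Data.Nat.ListAction using (sum)
open import Data.List.Membership.Propositional using (_∈_)
open import Data.List.Relation.Unary.Unique.Propositional using (Unique)
open import Data.Product using (Σ; _×_; ∃; ∃-syntax)
open import Data.Unit using (⊤)
open import Function.Bundles using (_⇔_)
open import Relation.Binary.PropositionalEquality using (_≡_)

record Graph (n : ℕ) : Set where
  field
    adj    : Fin n → Fin n → Bool
    sym    : ∀ u v → adj u v ≡ adj v u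
    irrefl : ∀ v → adj v v ≡ false
open Graph public

VSet : ℕ → Set
VSet n = Fin n → Bool

card : ∀ {n} → VSet n → ℕ
card {n} S = sum (map (λ u → if S u then 1 else 0) (allFin n))

compl : ∀ {n} → VSet n → VSet n
compl S v = not (S v)

degIn : ∀ {n} → Graph n → Fin n → VSet n → ℕ
degIn G v S = card (λ u → if adj G v u then S u else false)

deg : ∀ {n} → Graph n → Fin n → ℕ
deg G v = degIn G v (λ _ → true)

-- e(V₁,V₂) for disjoint V₁, V₂: number of edges with one end in each
eBetween : ∀ {n} → Graph n → VSet n → VSet n → ℕ
eBetween {n} G S T = sum (map (λ v → if S v then degIn G v T else 0) (allFin n))

ℕtoℚ : ℕ → ℚ
ℕtoℚ k = (+ k) / 1

-- d(V₁,V₂) = e(V₁,V₂)/(|V₁||V₂|); (convention: 0 if a part is empty)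
density : ∀ {n} → Graph n → VSet n → VSet n → ℚ
density G S T with card S ℕ.* card T
... | zero  = ℚ.0ℚ
... | suc m = (+ eBetween G S T) / suc m

data Walk {n : ℕ} (A : Fin n → Fin n → Bool) (ok : VSet n) : Fin n → Fin n → Set where
  here : ∀ {u} → ok u ≡ true → Walk A ok u u
  step : ∀ {u w v} → ok u ≡ true → A u w ≡ true → Walk A ok w v → Walk A ok u v

ThreeConnected : ∀ {n} → Graph n → Set
ThreeConnected {n} G =
  3 < n ×
  (∀ (X : VSet n) → card X < 3 →
     ∀ u v → X u ≡ false → X v ≡ false → Walk (adj G) (compl X) u v)

Sub : ∀ {n} → Graph n → Graph n → Set
Sub H G = ∀ u v → adj H u v ≡ true → adj G u v ≡ true

Chain : ∀ {n} → (Fin n → Fin n → Bool) → List (Fin n) → Set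
Chain A []           = ⊤
Chain A (x ∷ [])     = ⊤
Chain A (x ∷ y ∷ xs) = (A x y ≡ true) × Chain A (y ∷ xs)

IsCycle : ∀ {n} → (Fin n → Fin n → Bool) → List (Fin n) → Set
IsCycle A cs = (3 ≤ length cs) × Unique cs × Chain A (cs ++ take 1 cs)

Connected : ∀ {n} → Graph n → Set
Connected {n} H = ∀ (u v : Fin n) → Walk (adj H) (λ _ → true) u v

Acyclic : ∀ {n} → Graph n → Set
Acyclic H = ∀ cs → IsCycle (adj H) cs → Data.Empty.⊥
  where import Data.Empty

SpanningTree : ∀ {n} → Graph n → Graph n → Set
SpanningTree G T = Sub T G × Connected T × Acyclic T

IsLeaf : ∀ {n} → Graph n → Fin n → Set
IsLeaf T v = deg T v ≡ 1

HIST : ∀ {n} → Graph n → Graph n → Set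
HIST G T = SpanningTree G T × (∀ v → deg T v ≡ 2 → Data.Empty.⊥)
  where import Data.Empty

HasSpanningGenHalin : ∀ {n} → Graph n → Set
HasSpanningGenHalin {n} G =
  Σ (Graph n) λ T → Σ (List (Fin n)) λ C →
    HIST G T × IsCycle (adj G) C × (∀ v → (v ∈ C) ⇔ IsLeaf T v)

{-# OPTIONS --safe #-}
module Submission where

-- Write A for the larger and B for the smaller side of the partition. Up to O(αn) exceptions every vertex of one side
-- sees almost all of the other side. One looks for a cycle alternating between A and B, and for a tree whose root z
-- lies in B, whose remaining inner vertices are mostly children of z in A, and whose inner vertices in A carry two or
-- three leaves from B. The slots of the cycle and of the tree are filled by perfect matchings in almost complete
-- bipartite graphs, found by exchanging partners.
--
-- Counting degrees on the side A, such a tree with m inner vertices in B and j edges inside A can be balanced with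
-- the cycle as soon as 2n + 2m + 1 ≤ 5|B| + j; for m = 1 and j = 0 this reads (2n + 3)/5 ≤ |B|. A vertex with few
-- neighbours in A is put into A, and one of B with only moderately many keeps its place by means of three private
-- neighbours in A, two for the cycle and one for the tree. If B is too small, the minimum degree forces edges inside A:
-- a vertex with many neighbours in A is moved to B, again with three private neighbours, and once no such vertex is
-- left the edges inside A contain a matching that makes up the deficit. If B is large enough, a vertex of A misses at
-- most about |B| - (2n + 3)/5 vertices of B more than it has neighbours in A; this decides how many inner vertices of B
-- are needed to reach all of A: logarithmically many in general, and at most two when B is barely large enough.

-- The balance inequality comes from dealing out the ordinary vertices of B twice: each fills one
-- gap of the cycle and is one leaf of the tree. For m = 1 and j = 0 the cycle then holds about |B|
-- vertices of A, and the inner vertices of A, with two or three leaves each, number between |B|/3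
-- and |B|/2. Hence |A| may grow to about 3|B|/2, that is, |B| may drop to about 2n/5; this is just
-- the bound that the minimum degree gives when A is independent, with nothing to spare. In fifths
-- of a vertex, moving a vertex from A to B gains 5; an edge inside A gains 1, because one end lies
-- on the cycle and serves the other as one of its two leaves; a further inner vertex in B costs 2.
-- So k missing vertices of B are made up by k moves or by 5k disjoint edges. The obstacle is that z
-- need not see all of A, while every helper in B has to be paid for. The deficit k is therefore
-- measured against a size of B that can afford L helpers, L being the binary length of n. Below
-- that size, and with nothing left to move, vertices of A have so few neighbours in A that either
-- the edges suffice or one or two inner vertices of B see everything.

module LinearArithmetic where

  -- Reflective linear arithmetic over the natural numbers.

  open import Data.Nat using (ℕ; zero; suc; _≤_; _<_; z≤n; _∸_; _≤ᵇ_; _≡ᵇ_; _<ᵇ_; _≤?_; _%_; _/_)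
  open import Data.Nat.Properties
  import Data.Nat as ℕ
  open import Data.Bool using (Bool; true; false; if_then_else_; not; T; _∧_; _∨_)
  open import Data.List using (List; []; _∷_; _++_; map; concatMap; length; foldr; filterᵇ; replicate)
  open import Data.Product using (_×_; _,_; proj₁; proj₂)
  open import Data.Unit using (⊤; tt)
  open import Data.Empty using (⊥; ⊥-elim)
  open import Relation.Nullary using (yes; no)
  open import Relation.Binary.PropositionalEquality using (_≡_; refl; sym; trans; cong; cong₂; subst; subst₂)
  open import Data.Nat.Solver using (module +-*-Solver)

  infixl 6 _:+_
  infixr 7 _:*_
  infix 4 _:≤_ _:<_ _:≡_
  infixr 2 _:⇒_

  data Expr : Set where
    var  : ℕ → Expr
    con  : ℕ → Expr
    _:+_ : Expr → Expr → Expr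
    _:*_ : ℕ → Expr → Expr

  data Rel : Set where
    _:≤_ _:<_ _:≡_ : Expr → Expr → Rel

  data Problem : Set where
    goal  : Rel → Problem
    _:⇒_  : Rel → Problem → Problem

  Env : Set
  Env = List ℕ

  lookup : Env → ℕ → ℕ
  lookup []       _       = 0
  lookup (x ∷ _)  zero    = x
  lookup (_ ∷ xs) (suc i) = lookup xs i

  ⟦_⟧ : Expr → Env → ℕ
  ⟦ var i ⟧ ρ  = lookup ρ i
  ⟦ con k ⟧ ρ  = k
  ⟦ a :+ b ⟧ ρ = ⟦ a ⟧ ρ ℕ.+ ⟦ b ⟧ ρ
  ⟦ k :* a ⟧ ρ = k ℕ.* ⟦ a ⟧ ρ

  ⟦_⟧ᴿ : Rel → Env → Set
  ⟦ a :≤ b ⟧ᴿ ρ = ⟦ a ⟧ ρ ≤ ⟦ b ⟧ ρ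
  ⟦ a :< b ⟧ᴿ ρ = ⟦ a ⟧ ρ < ⟦ b ⟧ ρ
  ⟦ a :≡ b ⟧ᴿ ρ = ⟦ a ⟧ ρ ≡ ⟦ b ⟧ ρ

  ⟦_⟧ᴾ : Problem → Env → Set
  ⟦ goal r ⟧ᴾ ρ = ⟦ r ⟧ᴿ ρ
  ⟦ r :⇒ p ⟧ᴾ ρ = ⟦ r ⟧ᴿ ρ → ⟦ p ⟧ᴾ ρ

  -- A linear form is its list of coefficients, the constant term first.
  Form : Set
  Form = List ℕ

  eval : Form → Env → ℕ
  eval []       _       = 0
  eval (_ ∷ _)  []      = 0
  eval (c ∷ cs) (x ∷ ρ) = c ℕ.* x ℕ.+ eval cs ρ

  _⊞_ : Form → Form → Form
  []       ⊞ ds       = ds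
  cs       ⊞ []       = cs
  (c ∷ cs) ⊞ (d ∷ ds) = (c ℕ.+ d) ∷ (cs ⊞ ds)

  scale : ℕ → Form → Form
  scale k = map (k ℕ.*_)

  unit : ℕ → Form
  unit zero    = 1 ∷ []
  unit (suc i) = 0 ∷ unit i

  form : Expr → Form
  form (var i)  = 0 ∷ unit i
  form (con k)  = k ∷ []
  form (a :+ b) = form a ⊞ form b
  form (k :* a) = scale k (form a)

  eval-⊞ : ∀ cs ds ρ → eval (cs ⊞ ds) ρ ≡ eval cs ρ ℕ.+ eval ds ρ
  eval-⊞ []       ds       ρ       = refl
  eval-⊞ (c ∷ cs) []       ρ       = sym (+-identityʳ _)
  eval-⊞ (c ∷ cs) (d ∷ ds) []      = refl
  eval-⊞ (c ∷ cs) (d ∷ ds) (x ∷ ρ) rewrite eval-⊞ cs ds ρ =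
    solve 5 (λ c d x p q → (c :+ᴿ d) :*ᴿ x :+ᴿ (p :+ᴿ q) := c :*ᴿ x :+ᴿ p :+ᴿ (d :*ᴿ x :+ᴿ q)) refl
      c d x (eval cs ρ) (eval ds ρ)
    where open +-*-Solver using (solve; _:=_) renaming (_:+_ to _:+ᴿ_; _:*_ to _:*ᴿ_)

  eval-scale : ∀ k cs ρ → eval (scale k cs) ρ ≡ k ℕ.* eval cs ρ
  eval-scale k []       ρ       = sym (*-zeroʳ k)
  eval-scale k (c ∷ cs) []      = sym (*-zeroʳ k)
  eval-scale k (c ∷ cs) (x ∷ ρ) rewrite eval-scale k cs ρ =
    solve 4 (λ k c x p → k :*ᴿ c :*ᴿ x :+ᴿ k :*ᴿ p := k :*ᴿ (c :*ᴿ x :+ᴿ p)) refl k c x (eval cs ρ)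
    where open +-*-Solver using (solve; _:=_) renaming (_:+_ to _:+ᴿ_; _:*_ to _:*ᴿ_)

  eval-unit : ∀ i ρ → eval (unit i) ρ ≡ lookup ρ i
  eval-unit zero    []      = refl
  eval-unit zero    (x ∷ ρ) = trans (+-identityʳ _) (+-identityʳ x)
  eval-unit (suc i) []      = refl
  eval-unit (suc i) (x ∷ ρ) = eval-unit i ρ

  -- The environment is prefixed by a variable of value 1, so that the constant term is a
  -- coefficient like any other.
  eval-form : ∀ a ρ → eval (form a) (1 ∷ ρ) ≡ ⟦ a ⟧ ρ
  eval-form (var i)  ρ = eval-unit i ρ
  eval-form (con k)  ρ = trans (+-identityʳ _) (*-identityʳ k)
  eval-form (a :+ b) ρ = trans (eval-⊞ (form a) (form b) (1 ∷ ρ)) (cong₂ ℕ._+_ (eval-form a ρ) (eval-form b ρ))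
  eval-form (k :* a) ρ = trans (eval-scale k (form a) (1 ∷ ρ)) (cong (k ℕ.*_) (eval-form a ρ))

  _⊑_ : Form → Form → Bool
  []       ⊑ _        = true
  (c ∷ cs) ⊑ []       = (c ≡ᵇ 0) ∧ (cs ⊑ [])
  (c ∷ cs) ⊑ (d ∷ ds) = (c ≤ᵇ d) ∧ (cs ⊑ ds)

  T-∧ : ∀ {a b} → T (a ∧ b) → T a × T b
  T-∧ {true} t = tt , t

  -- Comparing coefficients suffices since variables are natural numbers; this is how their
  -- nonnegativity enters a certificate.
  ⊑-sound : ∀ cs ds ρ → T (cs ⊑ ds) → eval cs ρ ≤ eval ds ρ
  ⊑-sound []       ds       ρ       _ = z≤n
  ⊑-sound (c ∷ cs) []       []      _ = z≤n
  ⊑-sound (c ∷ cs) []       (x ∷ ρ) t with T-∧ {c ≡ᵇ 0} t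
  ... | c≡0 , t′ rewrite ≡ᵇ⇒≡ c 0 c≡0 = ⊑-sound cs [] ρ t′
  ⊑-sound (c ∷ cs) (d ∷ ds) []      _ = z≤n
  ⊑-sound (c ∷ cs) (d ∷ ds) (x ∷ ρ) t with T-∧ {c ≤ᵇ d} t
  ... | c≤d , t′ = +-mono-≤ (*-monoˡ-≤ x (≤ᵇ⇒≤ c d c≤d)) (⊑-sound cs ds ρ t′)

  Ineq : Set
  Ineq = Form × Form

  Valid : Env → List Ineq → Set
  Valid ρ []             = ⊤
  Valid ρ ((l , r) ∷ is) = eval l ρ ≤ eval r ρ × Valid ρ is

  combine : List ℕ → List Ineq → Ineq
  combine (k ∷ ks) ((l , r) ∷ is) with combine ks is
  ... | l′ , r′ = (scale k l ⊞ l′) , (scale k r ⊞ r′)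
  combine _ _ = [] , []

  combine-sound : ∀ ks is ρ → Valid ρ is → eval (proj₁ (combine ks is)) ρ ≤ eval (proj₂ (combine ks is)) ρ
  combine-sound []       []             ρ _ = z≤n
  combine-sound []       (_ ∷ _)        ρ _ = z≤n
  combine-sound (_ ∷ _)  []             ρ _ = z≤n
  combine-sound (k ∷ ks) ((l , r) ∷ is) ρ (h , hs)
    rewrite eval-⊞ (scale k l) (proj₁ (combine ks is)) ρ | eval-⊞ (scale k r) (proj₂ (combine ks is)) ρ
          | eval-scale k l ρ | eval-scale k r ρ
    = +-mono-≤ (*-monoʳ-≤ k h) (combine-sound ks is ρ hs)

  -- A Farkas certificate: the multipliers combine the inequalities to l ≤ r, although l exceeds r
  -- in the constant term and is nowhere smaller in the other coefficients.
  refutes : List ℕ → List Ineq → Bool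
  refutes ks is with combine ks is
  ... | l , r = ((1 ∷ []) ⊞ r) ⊑ l

  refutes-sound : ∀ ks is ρ → T (refutes ks is) → Valid (1 ∷ ρ) is → ⊥
  refutes-sound ks is ρ t v = <-irrefl refl (≤-trans (subst (_≤ eval l ρ′) (eval-⊞ (1 ∷ []) r ρ′) (⊑-sound ((1 ∷ []) ⊞ r) l ρ′ t)) (combine-sound ks is ρ′ v))
    where
    ρ′ = 1 ∷ ρ
    l = proj₁ (combine ks is)
    r = proj₂ (combine ks is)

  -- Fourier–Motzkin elimination, used only to find the multipliers that `refutes` checks.
  -- A coefficient is a difference (p , q) with p or q zero; a row records Σ coefficient · variable ≥ 0
  -- together with the multipliers producing it; variables are known to be ≥ 0.
  private
    Coeff : Set
    Coeff = ℕ × ℕ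

    Row : Set
    Row = List Coeff × List ℕ

    diff : ℕ → ℕ → Coeff
    diff p q = p ∸ q , q ∸ p

    _−_ : Form → Form → List Coeff
    []       − []       = []
    []       − (d ∷ ds) = diff 0 d ∷ ([] − ds)
    (c ∷ cs) − []       = diff c 0 ∷ (cs − [])
    (c ∷ cs) − (d ∷ ds) = diff c d ∷ (cs − ds)

    add : List Coeff → List Coeff → List Coeff
    add []             ds             = ds
    add cs             []             = cs
    add ((p , q) ∷ cs) ((r , s) ∷ ds) = diff (p ℕ.+ r) (q ℕ.+ s) ∷ add cs ds

    mul : ℕ → List Coeff → List Coeff
    mul k = map (λ c → k ℕ.* proj₁ c , k ℕ.* proj₂ c)

    at : ℕ → List Coeff → Coeff
    at _       []       = 0 , 0
    at zero    (c ∷ _)  = c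
    at (suc i) (_ ∷ cs) = at i cs

    drop0 : ℕ → List Coeff → List Coeff
    drop0 _       []       = []
    drop0 zero    (_ ∷ cs) = (0 , 0) ∷ cs
    drop0 (suc i) (c ∷ cs) = c ∷ drop0 i cs

    divide : ℕ → ℕ → ℕ
    divide a zero    = 0
    divide a (suc b) = a / suc b

    gcd′ : ℕ → ℕ → ℕ → ℕ
    gcd′ zero       a b       = 1
    gcd′ (suc fuel) a zero    = a
    gcd′ (suc fuel) a (suc b) = gcd′ fuel (suc b) (a % suc b)

    combineRows : ℕ → Row → Row → Row
    combineRows i (p , ks) (m , ls) =
      add (mul y p) (mul x m) , (map (y ℕ.*_) ks ⊞ map (x ℕ.*_) ls)
      where
      a = proj₁ (at i p)
      b = proj₂ (at i m)
      g = gcd′ 200 a b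
      x = divide a g
      y = divide b g

    positive negative : Coeff → Bool
    positive (p , _) = 0 <ᵇ p
    negative (_ , q) = 0 <ᵇ q

    contradictory : Row → Bool
    contradictory ([] , _)     = false
    contradictory (c ∷ cs , _) = negative c ∧ foldr (λ c b → not (positive c) ∧ b) true cs

    -- A row without negative coefficients follows from nonnegativity, and by the criterion of
    -- Chernikov and Kohler a row descending from too many inequalities is redundant. Discarding too
    -- much could only make the search fail.
    useful : ℕ → Row → Bool
    useful i (cs , ks) = foldr (λ c b → negative c ∨ b) false cs ∧ (length (filterᵇ (0 <ᵇ_) ks) ≤ᵇ suc i)

    findᵇ : ∀ {A : Set} → (A → Bool) → List A → List A
    findᵇ f []       = []
    findᵇ f (x ∷ xs) = if f x then x ∷ [] else findᵇ f xs

    cost : List Row → ℕ → ℕ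
    cost rs i = length (filterᵇ (λ r → positive (at i (proj₁ r))) rs) ℕ.* length (filterᵇ (λ r → negative (at i (proj₁ r))) rs)

    cheapest : List Row → ℕ → ℕ → List ℕ → ℕ × List ℕ
    cheapest rs i c []       = i , []
    cheapest rs i c (j ∷ js) = if cost rs j <ᵇ c
      then (let r = cheapest rs j (cost rs j) js in proj₁ r , i ∷ proj₂ r)
      else (let r = cheapest rs i c js in proj₁ r , j ∷ proj₂ r)

    eliminate : ℕ → ℕ → List Row → List Row
    eliminate done i rs = filterᵇ (useful done)
      (filterᵇ (λ r → not (negative (at i (proj₁ r))) ∧ not (positive (at i (proj₁ r)))) rs
       -- Adding a multiple of x ≥ 0 erases a negative coefficient. No multiplier is recorded for
       -- it, since `_⊑_` tolerates the surplus.
       ++ map (λ r → drop0 i (proj₁ r) , proj₂ r) ns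
       ++ concatMap (λ p → map (combineRows i p) ns) ps)
      where
      ps = filterᵇ (λ r → positive (at i (proj₁ r))) rs
      ns = filterᵇ (λ r → negative (at i (proj₁ r))) rs

    run : ℕ → ℕ → List ℕ → List Row → List ℕ
    run zero       _    _        _  = []
    run (suc fuel) done vars     rs with findᵇ contradictory rs
    ... | (_ , ks) ∷ _ = ks
    ... | []           with vars
    ...   | []     = []
    ...   | v ∷ vs = let c = cheapest rs v (cost rs v) vs
                     in run fuel (suc done) (proj₂ c) (eliminate (suc done) (proj₁ c) rs)

    rows : ℕ → ℕ → List Ineq → List Row
    rows i k []             = []
    rows i k ((l , r) ∷ is) = ((r − l) , unit′ i k) ∷ rows (suc i) k is
      where
      unit′ : ℕ → ℕ → List ℕ
      unit′ _       zero    = []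
      unit′ zero    (suc k) = 1 ∷ replicate k 0
      unit′ (suc i) (suc k) = 0 ∷ unit′ i k

    upto : ℕ → ℕ → List ℕ
    upto i zero    = []
    upto i (suc k) = i ∷ upto (suc i) k

  search : ℕ → List Ineq → List ℕ
  search k is = run 100 0 (upto 1 k) (rows 0 (length is) is)

  hyp : Rel → List Ineq
  hyp (a :≤ b) = (form a , form b) ∷ []
  hyp (a :< b) = ((1 ∷ []) ⊞ form a , form b) ∷ []
  hyp (a :≡ b) = (form a , form b) ∷ (form b , form a) ∷ []

  holds-≤ : ∀ a b ρ → ⟦ a ⟧ ρ ≤ ⟦ b ⟧ ρ → eval (form a) (1 ∷ ρ) ≤ eval (form b) (1 ∷ ρ)
  holds-≤ a b ρ = subst₂ _≤_ (sym (eval-form a ρ)) (sym (eval-form b ρ))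

  holds-< : ∀ a b ρ → ⟦ a ⟧ ρ < ⟦ b ⟧ ρ → eval ((1 ∷ []) ⊞ form a) (1 ∷ ρ) ≤ eval (form b) (1 ∷ ρ)
  holds-< a b ρ h rewrite eval-⊞ (1 ∷ []) (form a) (1 ∷ ρ) | eval-form a ρ | eval-form b ρ = h

  valid-hyp : ∀ r ρ is → ⟦ r ⟧ᴿ ρ → Valid (1 ∷ ρ) is → Valid (1 ∷ ρ) (hyp r ++ is)
  valid-hyp (a :≤ b) ρ is h v = holds-≤ a b ρ h , v
  valid-hyp (a :< b) ρ is h v = holds-< a b ρ h , v
  valid-hyp (a :≡ b) ρ is h v = holds-≤ a b ρ (≤-reflexive h) , holds-≤ b a ρ (≤-reflexive (sym h)) , v

  decides : ℕ → List Ineq → Expr → Expr → Bool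
  decides k is a b = refutes (search k is′) is′
    where is′ = ((1 ∷ []) ⊞ form b , form a) ∷ is

  decides-sound : ∀ k is a b ρ → T (decides k is a b) → Valid (1 ∷ ρ) is → ⟦ a ⟧ ρ ≤ ⟦ b ⟧ ρ
  decides-sound k is a b ρ t v with ⟦ a ⟧ ρ ≤? ⟦ b ⟧ ρ
  ... | yes a≤b = a≤b
  ... | no  a≰b = ⊥-elim (refutes-sound (search k is′) is′ ρ t (holds-< b a ρ (≰⇒> a≰b) , v))
    where is′ = ((1 ∷ []) ⊞ form b , form a) ∷ is

  solvable : ℕ → List Ineq → Problem → Bool
  solvable k is (goal (a :≤ b)) = decides k is a b
  solvable k is (goal (a :< b)) = decides k is (con 1 :+ a) b
  solvable k is (goal (a :≡ b)) = decides k is a b ∧ decides k is b a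
  solvable k is (r :⇒ p)        = solvable k (hyp r ++ is) p

  solvable-sound : ∀ k is p ρ → T (solvable k is p) → Valid (1 ∷ ρ) is → ⟦ p ⟧ᴾ ρ
  solvable-sound k is (goal (a :≤ b)) ρ t v = decides-sound k is a b ρ t v
  solvable-sound k is (goal (a :< b)) ρ t v = decides-sound k is (con 1 :+ a) b ρ t v
  solvable-sound k is (goal (a :≡ b)) ρ t v with T-∧ {decides k is a b} t
  ... | t₁ , t₂ = ≤-antisym (decides-sound k is a b ρ t₁ v) (decides-sound k is b a ρ t₂ v)
  solvable-sound k is (r :⇒ p)        ρ t v = λ h → solvable-sound k (hyp r ++ is) p ρ t (valid-hyp r ρ is h v)

  Fun : ℕ → Set
  Fun zero    = Problem
  Fun (suc k) = Expr → Fun k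

  close : ∀ k → ℕ → Fun k → Problem
  close zero    i p = p
  close (suc k) i f = close k (suc i) (f (var i))

  ∀⟦_⟧ : ℕ → Problem → Env → Set
  ∀⟦ zero ⟧  p ρ = ⟦ p ⟧ᴾ ρ
  ∀⟦ suc k ⟧ p ρ = ∀ x → ∀⟦ k ⟧ p (ρ ++ x ∷ [])

  generalise : ∀ k p → (∀ ρ → ⟦ p ⟧ᴾ ρ) → ∀ ρ → ∀⟦ k ⟧ p ρ
  generalise zero    p h ρ   = h ρ
  generalise (suc k) p h ρ x = generalise k p h (ρ ++ x ∷ [])

  abstract
    -- Problems are functions on expressions, so that bound variables name the unknowns. The hidden
    -- argument is solved by evaluating `solvable`, which runs the search and checks the certificate
    -- found.
    linarith : ∀ k (f : Fun k) {_ : T (solvable k [] (close k 0 f))} → ∀⟦ k ⟧ (close k 0 f) []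
    linarith k f {t} = generalise k (close k 0 f) (λ ρ → solvable-sound k [] (close k 0 f) ρ t tt) []

module Development where

  open import Defs hiding (sym)
  open import Data.Nat using (ℕ; zero; suc; _+_; _*_; _∸_; _^_; _≤_; _<_; z≤n; s≤s; z<s; _≤?_; _<?_; _≤ᵇ_; _<ᵇ_; _/_; _%_; >-nonZero)
  open import Data.Nat.Properties
  open import Data.Nat.ListAction using (sum)
  open import Data.Bool using (Bool; true; false; if_then_else_; not; _∧_; _∨_; T)
  open import Data.Fin using (Fin)
  import Data.Fin.Properties as Fin
  open import Data.Nat.Tactic.RingSolver using (solve-∀)
  open import Data.Nat.DivMod using (m≡m%n+[m/n]*n; m%n<n)
  open import Data.List using (List; []; _∷_; _++_; map; concat; length; filterᵇ; allFin; take; drop; tabulate)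
  open import Data.List.Properties using (∷-injective; ∷-injectiveˡ; ∷-injectiveʳ; length-++; length-map; length-tabulate; map-++; ++-assoc; take++drop≡id; length-take)
  open import Data.List.Membership.Propositional using (_∈_; _∉_)
  open import Data.List.Membership.Propositional.Properties using (∈-++⁺ˡ; ∈-++⁺ʳ; ∈-++⁻; ∈-map⁺; ∈-map⁻; ∈-allFin)
  open import Data.List.Relation.Unary.Any using (here; there)
  open import Data.List.Relation.Unary.All as All using (All; []; _∷_)
  import Data.List.Relation.Unary.All.Properties as All
  open import Data.List.Relation.Unary.AllPairs using ([]; _∷_)
  open import Data.List.Relation.Unary.Unique.Propositional using (Unique)
  open import Data.List.Relation.Unary.Unique.Propositional.Properties using (allFin⁺)
  open import Data.List.Relation.Binary.Permutation.Propositional using (_↭_; ↭-refl; ↭-sym; ↭-trans; prep; swap)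
  open import Data.List.Relation.Binary.Permutation.Propositional.Properties using (↭-map-inv; ↭-length; map⁺; shift; ∈-resp-↭; ++⁺ˡ; ++⁺ʳ; ++-comm)
  open import Data.Product using (∃; _×_; _,_; proj₁; proj₂)
  open import Data.Sum using (_⊎_; inj₁; inj₂)
  open import Data.Unit using (tt)
  open import Data.Empty using (⊥; ⊥-elim)
  open import Function using (_∘_; id; case_of_)
  open import Function.Bundles using (mk⇔)
  open import Relation.Nullary using (Dec; yes; no; does)
  open import Relation.Binary.PropositionalEquality using (_≡_; _≢_; refl; sym; trans; cong; cong₂; subst; subst₂)
  open LinearArithmetic using (linarith; con; _:+_; _:*_; _:≤_; _:<_; _:≡_; _:⇒_; goal)

  -- Counting in lists

  private
    variable
      A B : Set

  ∧-true : ∀ {a b} → a ∧ b ≡ true → a ≡ true × b ≡ true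
  ∧-true {true} {true} _ = refl , refl

  not-∧ : ∀ a b → not (a ∧ b) ≡ true → not a ∨ not b ≡ true
  not-∧ true  _ h = h
  not-∧ false _ _ = refl

  indicator≤1 : ∀ b → (if b then 1 else 0) ≤ 1
  indicator≤1 true  = ≤-refl
  indicator≤1 false = z≤n

  -- `card S` is `# S (allFin n)`.
  # : (A → Bool) → List A → ℕ
  # f xs = sum (map (λ u → if f u then 1 else 0) xs)

  #-++ : ∀ (f : A → Bool) xs ys → # f (xs ++ ys) ≡ # f xs + # f ys
  #-++ f []       ys = refl
  #-++ f (x ∷ xs) ys rewrite #-++ f xs ys = sym (+-assoc (if f x then 1 else 0) (# f xs) (# f ys))

  #-map : ∀ (f : B → Bool) (g : A → B) xs → # f (map g xs) ≡ # (f ∘ g) xs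
  #-map f g []       = refl
  #-map f g (x ∷ xs) = cong ((if f (g x) then 1 else 0) +_) (#-map f g xs)

  #-not : ∀ (f : A → Bool) xs → # f xs + # (not ∘ f) xs ≡ length xs
  #-not f []       = refl
  #-not f (x ∷ xs) with f x
  ... | true  = cong suc (#-not f xs)
  ... | false = trans (+-suc _ _) (cong suc (#-not f xs))

  #-true : ∀ (xs : List A) → # (λ _ → true) xs ≡ length xs
  #-true []       = refl
  #-true (_ ∷ xs) = cong suc (#-true xs)

  #-mono : ∀ (f g : A → Bool) xs → (∀ x → x ∈ xs → f x ≡ true → g x ≡ true) → # f xs ≤ # g xs
  #-mono f g []       h = z≤n
  #-mono f g (x ∷ xs) h with f x | g x | h x (here refl)
  ... | true  | true  | _ = s≤s (#-mono f g xs λ y m → h y (there m))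
  ... | true  | false | k = case k refl of λ ()
  ... | false | true  | _ = ≤-trans (#-mono f g xs λ y m → h y (there m)) (n≤1+n _)
  ... | false | false | _ = #-mono f g xs λ y m → h y (there m)

  #-cong : ∀ (f g : A → Bool) xs → (∀ x → f x ≡ g x) → # f xs ≡ # g xs
  #-cong f g []       h = refl
  #-cong f g (x ∷ xs) h = cong₂ (λ b m → (if b then 1 else 0) + m) (h x) (#-cong f g xs h)

  #-≤-length : ∀ (f : A → Bool) xs → # f xs ≤ length xs
  #-≤-length f xs = ≤-trans (m≤m+n (# f xs) _) (≤-reflexive (#-not f xs))

  #-∨ : ∀ (f g : A → Bool) xs → # (λ x → f x ∨ g x) xs ≤ # f xs + # g xs
  #-∨ f g []       = z≤n
  #-∨ f g (x ∷ xs) with f x | g x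
  ... | true  | true  = s≤s (≤-trans (#-∨ f g xs) (+-monoʳ-≤ (# f xs) (n≤1+n _)))
  ... | true  | false = s≤s (#-∨ f g xs)
  ... | false | true  = ≤-trans (s≤s (#-∨ f g xs)) (≤-reflexive (sym (+-suc (# f xs) (# g xs))))
  ... | false | false = #-∨ f g xs

  #-filter : ∀ (f g : A → Bool) xs → # f (filterᵇ g xs) ≡ # (λ x → if f x then g x else false) xs
  #-filter f g []       = refl
  #-filter f g (x ∷ xs) with g x
  ... | true  with f x
  ...   | true  = cong suc (#-filter f g xs)
  ...   | false = #-filter f g xs
  #-filter f g (x ∷ xs) | false with f x
  ...   | true  = #-filter f g xs
  ...   | false = #-filter f g xs

  #-split : ∀ (f g : A → Bool) xs → # f (filterᵇ g xs) + # f (filterᵇ (not ∘ g) xs) ≡ # f xs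
  #-split f g []       = refl
  #-split f g (x ∷ xs) with g x
  ... | true  = trans (+-assoc (if f x then 1 else 0) _ _) (cong ((if f x then 1 else 0) +_) (#-split f g xs))
  ... | false = trans (+-left-comm (# f (filterᵇ g xs)) (if f x then 1 else 0) _) (cong ((if f x then 1 else 0) +_) (#-split f g xs))
    where
    +-left-comm : ∀ a b c → a + (b + c) ≡ b + (a + c)
    +-left-comm a b c = linarith 3 (λ a b c → goal (a :+ (b :+ c) :≡ b :+ (a :+ c))) a b c

  ∈-filterᵇ⁻ : ∀ (g : A → Bool) {x} xs → x ∈ filterᵇ g xs → x ∈ xs × g x ≡ true
  ∈-filterᵇ⁻ g (y ∷ xs) m with g y in eq
  ∈-filterᵇ⁻ g (y ∷ xs) (here refl) | true  = here refl , eq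
  ∈-filterᵇ⁻ g (y ∷ xs) (there m)   | true  = there (proj₁ (∈-filterᵇ⁻ g xs m)) , proj₂ (∈-filterᵇ⁻ g xs m)
  ∈-filterᵇ⁻ g (y ∷ xs) m           | false = there (proj₁ (∈-filterᵇ⁻ g xs m)) , proj₂ (∈-filterᵇ⁻ g xs m)

  #-∈ : ∀ (f : A → Bool) {x} xs → x ∈ xs → f x ≡ true → 0 < # f xs
  #-∈ f (x ∷ xs) (here refl) fx rewrite fx = z<s
  #-∈ f (x ∷ xs) (there m)   fx = ≤-trans (#-∈ f xs m fx) (m≤n+m _ (if f x then 1 else 0))

  infix 4 _≈_
  -- Equality of multisets in counting form. Partitions of the vertex set can then be regrouped by
  -- linear arithmetic on counts instead of explicit permutations.
  record _≈_ {A : Set} (xs ys : List A) : Set where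
    constructor equinumerous
    field count : ∀ f → # f xs ≡ # f ys
  open _≈_ public

  #-↭ : ∀ {xs ys : List A} → xs ↭ ys → ∀ f → # f xs ≡ # f ys
  #-↭ _↭_.refl         f = refl
  #-↭ (prep x p)       f = cong ((if f x then 1 else 0) +_) (#-↭ p f)
  #-↭ {xs = _ ∷ _ ∷ xs} {ys = _ ∷ _ ∷ ys} (swap x y p) f rewrite #-↭ p f =
    linarith 3 (λ a b c → goal (a :+ (b :+ c) :≡ b :+ (a :+ c))) (if f x then 1 else 0) (if f y then 1 else 0) (# f ys)
  #-↭ (_↭_.trans p q)  f = trans (#-↭ p f) (#-↭ q f)

  pull : ∀ (f : A → Bool) xs → (∃ λ x → ∃ λ ys → xs ↭ x ∷ ys × f x ≡ true) ⊎ (∀ x → x ∈ xs → f x ≡ false)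
  pull f []       = inj₂ λ _ ()
  pull f (x ∷ xs) with f x in eq
  ... | true  = inj₁ (x , xs , ↭-refl , eq)
  ... | false with pull f xs
  ...   | inj₁ (y , ys , p , fy) = inj₁ (y , x ∷ ys , ↭-trans (prep x p) (swap x y ↭-refl) , fy)
  ...   | inj₂ none = inj₂ λ where
          _ (here refl) → eq
          y (there m)   → none y m

  #-none : ∀ (f : A → Bool) xs → (∀ x → x ∈ xs → f x ≡ false) → # f xs ≡ 0
  #-none f []       h = refl
  #-none f (x ∷ xs) h rewrite h x (here refl) = #-none f xs λ y m → h y (there m)

  #-pull : ∀ (f : A → Bool) xs → 0 < # f xs → ∃ λ x → ∃ λ ys → xs ↭ x ∷ ys × f x ≡ true
  #-pull f xs pos with pull f xs
  ... | inj₁ found = found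
  ... | inj₂ none  = ⊥-elim (<-irrefl (sym (#-none f xs none)) pos)

  #-witness : ∀ (f : A → Bool) xs → 0 < # f xs → ∃ λ x → x ∈ xs × f x ≡ true
  #-witness f xs pos with #-pull f xs pos
  ... | x , _ , p , fx = x , ∈-resp-↭ (↭-sym p) (here refl) , fx

  ∈-pull : ∀ {x : A} xs → x ∈ xs → ∃ λ ys → xs ↭ x ∷ ys
  ∈-pull (x ∷ xs) (here refl) = xs , ↭-refl
  ∈-pull (y ∷ xs) (there m) with ∈-pull xs m
  ... | ys , p = y ∷ ys , ↭-trans (prep y p) (swap y _ ↭-refl)

  Σ# : (A → ℕ) → List A → ℕ
  Σ# f xs = sum (map f xs)

  Σ#-++ : ∀ (f : A → ℕ) xs ys → Σ# f (xs ++ ys) ≡ Σ# f xs + Σ# f ys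
  Σ#-++ f []       ys = refl
  Σ#-++ f (x ∷ xs) ys rewrite Σ#-++ f xs ys = sym (+-assoc (f x) _ _)

  Σ#-swap : ∀ (R : A → B → Bool) xs ys → Σ# (λ x → # (R x) ys) xs ≡ Σ# (λ y → # (λ x → R x y) xs) ys
  Σ#-swap R []       []       = refl
  Σ#-swap R []       (y ∷ ys) = Σ#-swap R [] ys
  Σ#-swap R (x ∷ xs) ys       = trans (cong (# (R x) ys +_) (Σ#-swap R xs ys)) (go ys)
    where
    go : ∀ ys → # (R x) ys + Σ# (λ y → # (λ x → R x y) xs) ys ≡ Σ# (λ y → # (λ x → R x y) (x ∷ xs)) ys
    go []       = refl
    go (y ∷ ys) = trans
      (linarith 4 (λ a b c d → goal (a :+ b :+ (c :+ d) :≡ a :+ c :+ (b :+ d))) (if R x y then 1 else 0) (# (R x) ys) (# (λ x → R x y) xs) _)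
      (cong ((if R x y then 1 else 0) + # (λ x → R x y) xs +_) (go ys))

  Σ#-upper : ∀ k c (f : A → ℕ) xs → (∀ x → x ∈ xs → k * f x ≤ c) → k * Σ# f xs ≤ length xs * c
  Σ#-upper k c f []       h = ≤-reflexive (*-zeroʳ k)
  Σ#-upper k c f (x ∷ xs) h rewrite *-distribˡ-+ k (f x) (Σ# f xs) =
    +-mono-≤ (h x (here refl)) (Σ#-upper k c f xs λ y m → h y (there m))

  Σ#-lower : ∀ k c (f : A → ℕ) xs → (∀ x → x ∈ xs → c ≤ k * f x) → length xs * c ≤ k * Σ# f xs
  Σ#-lower k c f []       h = z≤n
  Σ#-lower k c f (x ∷ xs) h rewrite *-distribˡ-+ k (f x) (Σ# f xs) =
    +-mono-≤ (h x (here refl)) (Σ#-lower k c f xs λ y m → h y (there m))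

  module _ {n : ℕ} where

    infix 4 _==_
    _==_ : Fin n → Fin n → Bool
    u == v = does (u Fin.≟ v)

    ==-refl : ∀ v → (v == v) ≡ true
    ==-refl v with v Fin.≟ v
    ... | yes _ = refl
    ... | no ¬p = ⊥-elim (¬p refl)

    ==⇒≡ : ∀ u v → (u == v) ≡ true → u ≡ v
    ==⇒≡ u v e with u Fin.≟ v
    ==⇒≡ u v e  | yes p = p
    ==⇒≡ u v () | no _

    ≢⇒==-false : ∀ {u v} → u ≢ v → (u == v) ≡ false
    ≢⇒==-false {u} {v} h with u Fin.≟ v
    ... | yes p = ⊥-elim (h p)
    ... | no _  = refl

    ∈⇒#== : ∀ {v} xs → v ∈ xs → 0 < # (v ==_) xs
    ∈⇒#== {v} xs m = #-∈ (v ==_) xs m (==-refl v)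

    #==⇒∈ : ∀ {v} xs → 0 < # (v ==_) xs → v ∈ xs
    #==⇒∈ {v} xs pos with #-witness (v ==_) xs pos
    ... | x , m , e = subst (_∈ xs) (sym (==⇒≡ v x e)) m

    ≈-∈ : ∀ {xs ys : List (Fin n)} → xs ≈ ys → ∀ {v} → v ∈ xs → v ∈ ys
    ≈-∈ {xs} {ys} e {v} m = #==⇒∈ ys (subst (0 <_) (count e (v ==_)) (∈⇒#== xs m))

    Simple : List (Fin n) → Set
    Simple xs = ∀ v → # (v ==_) xs ≤ 1

    unique⇒simple : ∀ {xs} → Unique xs → Simple xs
    unique⇒simple {[]}     _        v = z≤n
    unique⇒simple {x ∷ xs} (h ∷ u) v with v Fin.≟ x
    ... | no _     = unique⇒simple u v
    ... | yes refl = s≤s (≤-reflexive (#-none (v ==_) xs λ y m → ≢⇒==-false (All.lookup h m)))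

    simple-tail : ∀ {x xs} → Simple (x ∷ xs) → Simple xs
    simple-tail {x} s v = ≤-trans (m≤n+m _ (if v == x then 1 else 0)) (s v)

    simple-head : ∀ {x y xs} → Simple (x ∷ xs) → y ∈ xs → x ≢ y
    simple-head {x} {xs = xs} s m refl with s x
    ... | q rewrite ==-refl x = <-irrefl refl (≤-trans (s≤s (∈⇒#== xs m)) q)

    simple⇒unique : ∀ {xs} → Simple xs → Unique xs
    simple⇒unique {[]}     s = []
    simple⇒unique {x ∷ xs} s = All.tabulate (simple-head {xs = xs} s) ∷ simple⇒unique (simple-tail {xs = xs} s)

    Complete : List (Fin n) → Set
    Complete xs = allFin n ≈ xs

    module _ {xs} (complete : Complete xs) where

      complete-∈ : ∀ v → v ∈ xs
      complete-∈ v = ≈-∈ complete (∈-allFin v)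

      complete-simple : Simple xs
      complete-simple v = ≤-trans (≤-reflexive (sym (count complete (v ==_)))) (unique⇒simple (allFin⁺ n) v)

  Σ#-mono : ∀ {A : Set} (f g : A → ℕ) xs → (∀ x → x ∈ xs → f x ≤ g x) → Σ# f xs ≤ Σ# g xs
  Σ#-mono f g []       h = z≤n
  Σ#-mono f g (x ∷ xs) h = +-mono-≤ (h x (here refl)) (Σ#-mono f g xs λ y m → h y (there m))

  Σ#-+ : ∀ {A : Set} (f g : A → ℕ) xs → Σ# (λ x → f x + g x) xs ≡ Σ# f xs + Σ# g xs
  Σ#-+ f g []       = refl
  Σ#-+ f g (x ∷ xs) rewrite Σ#-+ f g xs =
    linarith 4 (λ a b c d → goal (a :+ b :+ (c :+ d) :≡ a :+ c :+ (b :+ d))) (f x) (g x) (Σ# f xs) (Σ# g xs)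

  -- Perfect matchings in dense relations

  module PerfectMatching {P X : Set} (R : P → X → Bool) (ps : List P) (xs : List X)
    (dense : ∀ p x → p ∈ ps → x ∈ xs → # (λ y → not (R p y)) xs + # (λ q → not (R q x)) ps < length ps) where

    Pairs : Set
    Pairs = List (P × X)

    Compatible : P × X → Set
    Compatible (p , x) = R p x ≡ true

    Arranges : Pairs → Set
    Arranges zs = map proj₁ zs ↭ ps × map proj₂ zs ↭ xs

    arranges-↭ : ∀ {ys zs} → zs ↭ ys → Arranges ys → Arranges zs
    arranges-↭ p (h₁ , h₂) = ↭-trans (map⁺ proj₁ p) h₁ , ↭-trans (map⁺ proj₂ p) h₂

    exchangeable : P × X → P × X → Bool
    exchangeable (p , x) (q , y) = R p y ∧ R q x

    arranges-exchange : ∀ {p x q y zs} → Arranges ((p , x) ∷ (q , y) ∷ zs) → Arranges ((p , y) ∷ (q , x) ∷ zs)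
    arranges-exchange (h₁ , h₂) = h₁ , ↭-trans (swap _ _ ↭-refl) h₂

    -- If (p , x) cannot be exchanged with any pair (q , y), itself included, then always p misses y
    -- or q misses x. Both kinds together are too few by density. The count runs over positions, so
    -- `ps` may contain repetitions.
    stuck-impossible : ∀ {p x} zs → Arranges zs → (p , x) ∈ zs → (∀ e → e ∈ zs → exchangeable (p , x) e ≡ false) → ⊥
    stuck-impossible {p} {x} zs (h₁ , h₂) m none = <-irrefl refl (begin-strict
      length ps                                                        ≡⟨ ↭-length h₁ ⟨
      length (map proj₁ zs)                                            ≡⟨ length-map proj₁ zs ⟩
      length zs                                                        ≡⟨ #-not f zs ⟨
      # f zs + # (not ∘ f) zs                                          ≡⟨ cong (_+ # (not ∘ f) zs) (#-none f zs none) ⟩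
      # (not ∘ f) zs                                                   ≤⟨ #-mono _ _ zs (λ e _ → not-∧ (R p (proj₂ e)) _) ⟩
      # (λ e → not (R p (proj₂ e)) ∨ not (R (proj₁ e) x)) zs            ≤⟨ #-∨ _ _ zs ⟩
      # (λ e → not (R p (proj₂ e))) zs + # (λ e → not (R (proj₁ e) x)) zs ≡⟨ cong₂ _+_ (#-map _ proj₂ zs) (#-map _ proj₁ zs) ⟨
      # (λ y → not (R p y)) (map proj₂ zs) + # (λ q → not (R q x)) (map proj₁ zs) ≡⟨ cong₂ _+_ (#-↭ h₂ _) (#-↭ h₁ _) ⟩
      # (λ y → not (R p y)) xs + # (λ q → not (R q x)) ps                <⟨ dense p x (∈-resp-↭ h₁ (∈-map⁺ proj₁ m)) (∈-resp-↭ h₂ (∈-map⁺ proj₂ m)) ⟩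
      length ps                                                        ∎)
      where
      open ≤-Reasoning
      f = exchangeable (p , x)

    -- An incompatible pair (p , x) is repaired by exchanging partners with some (q , y)
    -- such that (p , y) and (q , x) are both compatible; density guarantees that one exists.
    repair : ∀ fuel good bad → length bad ≤ fuel → All Compatible good → Arranges (good ++ bad) →
             ∃ λ zs → All Compatible zs × Arranges zs
    repair _ good [] _ ok arr = good ++ [] , All.++⁺ ok [] , arr
    repair (suc fuel) good ((p , x) ∷ bad) (s≤s le) ok arr with R p x in eq
    ... | true  = repair fuel ((p , x) ∷ good) bad le (eq ∷ ok) (arranges-↭ (↭-sym (shift _ good bad)) arr)
    ... | false with pull (exchangeable (p , x)) good
    ...   | inj₁ ((q , y) , good′ , π , ex) with ∧-true ex
    ...     | py , qx with All-resp π ok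
      where
      All-resp : ∀ {as bs} → as ↭ bs → All Compatible as → All Compatible bs
      All-resp σ h = All.tabulate λ m → All.lookup h (∈-resp-↭ (↭-sym σ) m)
    ...       | _ ∷ ok′ = repair fuel ((p , y) ∷ (q , x) ∷ good′) bad le (py ∷ qx ∷ ok′)
                  (arranges-exchange (arranges-↭ (↭-sym (↭-trans (shift _ good bad) (prep _ (++⁺ʳ bad π)))) arr))
    repair (suc fuel) good ((p , x) ∷ bad) (s≤s le) ok arr | false | inj₂ none with pull (exchangeable (p , x)) bad
    ...   | inj₁ ((q , y) , bad′ , π , ex) with ∧-true ex
    ...     | py , qx = repair fuel ((p , y) ∷ (q , x) ∷ good) bad′
                (≤-trans (n≤1+n _) (≤-trans (≤-reflexive (sym (↭-length π))) le)) (py ∷ qx ∷ ok)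
                (arranges-exchange (arranges-↭ (↭-sym (↭-trans (shift _ good bad) (prep _ (↭-trans (++⁺ˡ good π) (shift _ good bad′))))) arr))
    repair (suc fuel) good ((p , x) ∷ bad) (s≤s le) ok arr | false | inj₂ none | inj₂ none′ =
      ⊥-elim (stuck-impossible (good ++ (p , x) ∷ bad) arr (∈-++⁺ʳ good (here refl)) everywhere)
      where
      everywhere : ∀ e → e ∈ good ++ (p , x) ∷ bad → exchangeable (p , x) e ≡ false
      everywhere e m with ∈-++⁻ good m
      ... | inj₁ m′          = none e m′
      ... | inj₂ (here refl) = cong₂ _∧_ eq eq
      ... | inj₂ (there m′)  = none′ e m′

    align : ∀ (ps : List P) (xs : List X) → length ps ≡ length xs → ∃ λ zs → map proj₁ zs ≡ ps × map proj₂ zs ≡ xs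
    align []       []       _ = [] , refl , refl
    align (p ∷ ps) (x ∷ xs) e with align ps xs (suc-injective e)
    ... | zs , e₁ , e₂ = (p , x) ∷ zs , cong (p ∷_) e₁ , cong (x ∷_) e₂

    abstract
      -- The first components return in the order of `ps`, not only up to permutation, because the
      -- gaps of the cycle and the blocks of tree demands are read off by position.
      perfectMatching : length ps ≡ length xs → ∃ λ zs → map proj₁ zs ≡ ps × map proj₂ zs ↭ xs × All Compatible zs
      perfectMatching e with align ps xs e
      ... | zs₀ , e₁ , e₂ with repair (length zs₀) [] zs₀ ≤-refl [] (subst (_↭ ps) (sym e₁) ↭-refl , subst (_↭ xs) (sym e₂) ↭-refl)
      ... | zs , ok , h₁ , h₂ with ↭-map-inv proj₁ h₁
      ... | zs′ , e₃ , π = zs′ , sym e₃ , ↭-trans (map⁺ proj₂ (↭-sym π)) h₂ , All.tabulate λ m → All.lookup ok (∈-resp-↭ (↭-sym π) m)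

  open PerfectMatching public using (perfectMatching)

  -- Trees given by parents

  #-distinct : ∀ {n} (f : Fin n → Bool) xs ys → Unique xs → (∀ x → x ∈ xs → x ∈ ys × f x ≡ true) → length xs ≤ # f ys
  #-distinct f []       ys _       _ = z≤n
  #-distinct f (x ∷ xs) ys (x∉ ∷ u) h with h x (here refl)
  ... | x∈ys , fx with ∈-pull ys x∈ys
  ... | ys′ , π rewrite #-↭ π f | fx = s≤s (#-distinct f xs ys′ u λ y m → remaining y m (h y (there m)))
    where
    remaining : ∀ y → y ∈ xs → y ∈ ys × f y ≡ true → y ∈ ys′ × f y ≡ true
    remaining y m (y∈ys , fy) with ∈-resp-↭ π y∈ys
    ... | here refl = ⊥-elim (All.lookup x∉ m refl)
    ... | there m′  = m′ , fy

  module _ {n : ℕ} (A : Fin n → Fin n → Bool) where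

    Neighbours : List (Fin n) → Fin n → Set
    Neighbours W c = ∃ λ a → ∃ λ b → A a c ≡ true × A c b ≡ true × a ≢ b × a ∈ W × b ∈ W

    neighbours-⊆ : ∀ {W W′ c} → (∀ {v} → v ∈ W → v ∈ W′) → Neighbours W c → Neighbours W′ c
    neighbours-⊆ i (a , b , x , y , z , m , m′) = a , b , x , y , z , i m , i m′

    interior-neighbours : ∀ x ys e {c} → Chain A (x ∷ ys ++ e ∷ []) → Unique (x ∷ ys ++ e ∷ []) → c ∈ ys →
                          Neighbours (x ∷ ys ++ e ∷ []) c
    interior-neighbours x (y ∷ [])      e (a , b , _) ((_ ∷ x≢e ∷ []) ∷ _) (here refl) =
      x , e , a , b , x≢e , here refl , there (there (here refl))
    interior-neighbours x (y ∷ z ∷ ys)  e (a , b , _) ((_ ∷ x≢z ∷ _) ∷ _) (here refl) =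
      x , z , a , b , x≢z , here refl , there (there (here refl))
    interior-neighbours x (y ∷ ys)      e (_ , ch)    (_ ∷ u)             (there m) =
      neighbours-⊆ there (interior-neighbours y ys e ch u m)

    last-neighbour : ∀ y ys e → Chain A (y ∷ ys ++ e ∷ []) → ∃ λ a → A a e ≡ true × a ∈ y ∷ ys
    last-neighbour y []       e (a , _)  = y , a , here refl
    last-neighbour y (z ∷ ys) e (_ , ch) with last-neighbour z ys e ch
    ... | a , h , m = a , h , there m

    -- The first two vertices are treated by hand; every other one is interior to the path from c₁
    -- round to c₀ that arises by rotating the cycle.
    cycle-neighbours : ∀ cs → IsCycle A cs → ∀ {c} → c ∈ cs → Neighbours cs c
    cycle-neighbours (_ ∷ []) (s≤s () , _)
    cycle-neighbours (_ ∷ _ ∷ []) (s≤s (s≤s ()) , _)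
    cycle-neighbours (c₀ ∷ c₁ ∷ c₂ ∷ cs) (_ , (_ ∷ (c₁∉ ∷ _)) , (a₀ , a₁ , ch)) (here refl)
      with last-neighbour c₂ cs c₀ ch
    ... | a , h , m = a , c₁ , h , a₀ , (λ e → All.lookup c₁∉ m (sym e)) , there (there m) , there (here refl)
    cycle-neighbours (c₀ ∷ c₁ ∷ c₂ ∷ cs) (_ , ((_ ∷ c₀≢c₂ ∷ _) ∷ _) , (a₀ , a₁ , ch)) (there (here refl)) =
      c₀ , c₂ , a₀ , a₁ , c₀≢c₂ , here refl , there (there (here refl))
    cycle-neighbours (c₀ ∷ c₁ ∷ c₂ ∷ cs) (_ , u , (a₀ , ch)) (there (there m)) =
      neighbours-⊆ (λ {v} → back {v}) (interior-neighbours c₁ (c₂ ∷ cs) c₀ ch rotated m)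
      where
      rotation : c₀ ∷ c₁ ∷ c₂ ∷ cs ↭ c₁ ∷ c₂ ∷ cs ++ c₀ ∷ []
      rotation = ++-comm (c₀ ∷ []) (c₁ ∷ c₂ ∷ cs)
      back : ∀ {v} → v ∈ c₁ ∷ c₂ ∷ cs ++ c₀ ∷ [] → v ∈ c₀ ∷ c₁ ∷ c₂ ∷ cs
      back = ∈-resp-↭ (↭-sym rotation)
      rotated : Unique (c₁ ∷ c₂ ∷ cs ++ c₀ ∷ [])
      rotated = simple⇒unique λ v → ≤-trans (≤-reflexive (sym (#-↭ rotation (v ==_)))) (unique⇒simple u v)

  argmax : ∀ {A : Set} (f : A → ℕ) x xs → ∃ λ c → c ∈ x ∷ xs × (∀ y → y ∈ x ∷ xs → f y ≤ f c)
  argmax f x [] = x , here refl , λ { _ (here refl) → ≤-refl }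
  argmax f x (y ∷ xs) with argmax f y xs
  ... | c , m , h with ≤-total (f x) (f c)
  ...   | inj₁ x≤c = c , there m , λ { _ (here refl) → x≤c ; z (there k) → h z k }
  ...   | inj₂ c≤x = x , here refl , λ { _ (here refl) → ≤-refl ; z (there k) → ≤-trans (h z k) c≤x }

  module _ {n : ℕ} {A : Fin n → Fin n → Bool} (A-sym : ∀ u v → A u v ≡ A v u) where

    walk-++ : ∀ {ok u v w} → Walk A ok u v → Walk A ok v w → Walk A ok u w
    walk-++ (here _)     q = q
    walk-++ (step o a p) q = step o a (walk-++ p q)

    walk-start : ∀ {ok u v} → Walk A ok u v → ok u ≡ true
    walk-start (here o)     = o
    walk-start (step o _ _) = o

    walk-reverse : ∀ {ok u v} → Walk A ok u v → Walk A ok v u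
    walk-reverse (here o)     = here o
    walk-reverse (step {u} {w} o a p) = walk-++ (walk-reverse p) (step (walk-start p) (trans (A-sym w u) a) (here o))

  -- The condition u ≢ r is there because the root is recorded as its own parent but must not count
  -- as its own child.
  record Children {n : ℕ} (p : Fin n → Fin n) (r v : Fin n) (k : ℕ) : Set where
    field
      children : List (Fin n)
      distinct : Unique children
      are      : ∀ u → u ∈ children → p u ≡ v × u ≢ r
      number   : k ≤ length children

  module ParentTree {n : ℕ} (G : Graph n) (p : Fin n → Fin n) (rank : Fin n → ℕ) (r : Fin n)
    (p-root : p r ≡ r) (p-adj : ∀ v → v ≢ r → adj G v (p v) ≡ true) (p-rank : ∀ v → v ≢ r → rank (p v) < rank v) where

    p-fixed : ∀ {v} → p v ≡ v → v ≡ r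
    p-fixed {v} e with v Fin.≟ r
    ... | yes v≡r = v≡r
    ... | no  v≢r = ⊥-elim (<-irrefl (cong rank e) (p-rank v v≢r))

    p-rank′ : ∀ {u v} → p u ≡ v → u ≢ v → rank v < rank u
    p-rank′ {u} refl u≢v = p-rank u λ { refl → u≢v (sym p-root) }

    tree-adj : Fin n → Fin n → Bool
    tree-adj u v = ((p u == v) ∨ (p v == u)) ∧ not (u == v)

    tree-adj⁻ : ∀ u v → tree-adj u v ≡ true → u ≢ v × (p u ≡ v ⊎ p v ≡ u)
    tree-adj⁻ u v h with p u Fin.≟ v | p v Fin.≟ u | u Fin.≟ v
    tree-adj⁻ u v h  | yes e | _     | no d  = d , inj₁ e
    tree-adj⁻ u v h  | no _  | yes e | no d  = d , inj₂ e
    tree-adj⁻ u v () | yes _ | _     | yes _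
    tree-adj⁻ u v () | no _  | yes _ | yes _
    tree-adj⁻ u v () | no _  | no _  | _

    tree-adj⁺ : ∀ u v → u ≢ v → p u ≡ v ⊎ p v ≡ u → tree-adj u v ≡ true
    tree-adj⁺ u v d h with p u Fin.≟ v | p v Fin.≟ u | u Fin.≟ v
    ... | _     | _     | yes e = ⊥-elim (d e)
    ... | yes _ | _     | no _  = refl
    ... | no _  | yes _ | no _  = refl
    ... | no e  | no e′ | no _  with h
    ...   | inj₁ k = ⊥-elim (e k)
    ...   | inj₂ k = ⊥-elim (e′ k)

    tree-sym : ∀ u v → tree-adj u v ≡ tree-adj v u
    tree-sym u v with tree-adj u v in e | tree-adj v u in e′
    ... | true  | true  = refl
    ... | false | false = refl
    ... | true  | false with tree-adj⁻ u v e
    ...   | d , h = trans (sym (tree-adj⁺ v u (d ∘ sym) (case h of λ { (inj₁ x) → inj₂ x ; (inj₂ x) → inj₁ x }))) e′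
    tree-sym u v | false | true with tree-adj⁻ v u e′
    ...   | d , h = trans (sym e) (tree-adj⁺ u v (d ∘ sym) (case h of λ { (inj₁ x) → inj₂ x ; (inj₂ x) → inj₁ x }))

    tree-irrefl : ∀ v → tree-adj v v ≡ false
    tree-irrefl v with tree-adj v v in e
    ... | false = refl
    ... | true  = ⊥-elim (proj₁ (tree-adj⁻ v v e) refl)

    tree : Graph n
    tree = record { adj = tree-adj ; sym = tree-sym ; irrefl = tree-irrefl }

    tree-sub : Sub tree G
    tree-sub u v h with tree-adj⁻ u v h
    ... | d , inj₁ refl = p-adj u λ { refl → d (sym p-root) }
    ... | d , inj₂ refl = trans (Graph.sym G (p v) v) (p-adj v λ { refl → d p-root })

    walk-to-root : ∀ k v → rank v ≤ k → Walk tree-adj (λ _ → true) v r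
    walk-to-root k v le with v Fin.≟ r
    ... | yes refl = here refl
    walk-to-root zero    v le | no v≢r = ⊥-elim (<⇒≱ (p-rank v v≢r) (≤-trans le z≤n))
    walk-to-root (suc k) v le | no v≢r =
      step refl (tree-adj⁺ v (p v) (λ e → v≢r (p-fixed (sym e))) (inj₁ refl))
        (walk-to-root k (p v) (≤-pred (≤-trans (p-rank v v≢r) le)))

    tree-connected : Connected tree
    tree-connected u v = walk-++ tree-sym (walk-to-root _ u ≤-refl) (walk-reverse tree-sym (walk-to-root _ v ≤-refl))

    -- Both neighbours, along a cycle, of a vertex of maximal rank would be its parent.
    tree-acyclic : Acyclic tree
    tree-acyclic [] (() , _)
    tree-acyclic (x ∷ xs) cyc with argmax rank x xs
    ... | c , c∈ , max with cycle-neighbours tree-adj (x ∷ xs) cyc c∈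
    ... | a , b , ac , cb , a≢b , a∈ , b∈ = a≢b (trans (sym (parent a a∈ (trans (tree-sym c a) ac))) (parent b b∈ cb))
      where
      parent : ∀ y → y ∈ x ∷ xs → tree-adj c y ≡ true → p c ≡ y
      parent y y∈ h with tree-adj⁻ c y h
      ... | _ , inj₁ e = e
      ... | d , inj₂ e = ⊥-elim (<⇒≱ (p-rank′ e (d ∘ sym)) (max y y∈))

    deg-# : ∀ v → deg tree v ≡ # (tree-adj v) (allFin n)
    deg-# v = #-cong _ _ (allFin n) λ u → if-true (tree-adj v u)
      where
      if-true : ∀ b → (if b then true else false) ≡ b
      if-true true  = refl
      if-true false = refl

    child-adj : ∀ {u v} → p u ≡ v → u ≢ r → tree-adj v u ≡ true
    child-adj {u} {v} e d = tree-adj⁺ v u (λ { refl → d (p-fixed e) }) (inj₂ e)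

    deg-root : ∀ {k} → Children p r r k → k ≤ deg tree r
    deg-root c rewrite deg-# r = ≤-trans number (#-distinct _ children (allFin n) distinct
      λ u m → ∈-allFin u , child-adj (proj₁ (are u m)) (proj₂ (are u m)))
      where open Children c

    deg-nonroot : ∀ {v k} → v ≢ r → Children p r v k → suc k ≤ deg tree v
    deg-nonroot {v} v≢r c rewrite deg-# v = ≤-trans (s≤s number)
      (#-distinct _ (p v ∷ children) (allFin n) (All.tabulate (λ m e → not-child (subst (_∈ children) (sym e) m)) ∷ distinct) λ
        { u (here refl) → ∈-allFin u , tree-adj⁺ v u (λ e → v≢r (p-fixed (sym e))) (inj₁ refl)
        ; u (there m)   → ∈-allFin u , child-adj (proj₁ (are u m)) (proj₂ (are u m)) })
      where
      open Children c
      not-child : p v ∉ children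
      not-child m with are (p v) m
      ... | e , pv≢r = <-asym (p-rank v v≢r) (p-rank′ e λ e′ → v≢r (p-fixed e′))

    deg-leaf : ∀ {v} → v ≢ r → (∀ u → p u ≢ v) → deg tree v ≡ 1
    deg-leaf {v} v≢r childless rewrite deg-# v = ≤-antisym
      (≤-trans (#-mono _ (p v ==_) (allFin n) λ u _ h → only u h) (unique⇒simple (allFin⁺ n) (p v)))
      (#-∈ _ (allFin n) (∈-allFin (p v)) (tree-adj⁺ v (p v) (λ e → v≢r (p-fixed (sym e))) (inj₁ refl)))
      where
      only : ∀ u → tree-adj v u ≡ true → (p v == u) ≡ true
      only u h with tree-adj⁻ v u h
      ... | _ , inj₁ refl = ==-refl u
      ... | _ , inj₂ e    = ⊥-elim (childless u e)

    module _ (C : List (Fin n)) (cycle : IsCycle (adj G) C)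
      (leaves   : ∀ v → v ∈ C → v ≢ r × (∀ u → p u ≢ v))
      (root     : Children p r r 3)
      (branches : ∀ v → v ∉ C → v ≢ r → Children p r v 2) where

      open import Data.List.Membership.DecPropositional (Fin._≟_ {n}) using (_∈?_)

      -- One dichotomy yields both requirements on the tree: degree 2 never occurs, and degree 1
      -- occurs exactly on `C`.
      degree : ∀ v → (v ∈ C × deg tree v ≡ 1) ⊎ (v ∉ C × 3 ≤ deg tree v)
      degree v with v ∈? C
      ... | yes v∈C = inj₁ (v∈C , deg-leaf (proj₁ (leaves v v∈C)) (proj₂ (leaves v v∈C)))
      ... | no  v∉C with v Fin.≟ r
      ...   | yes refl = inj₂ (v∉C , deg-root root)
      ...   | no  v≢r  = inj₂ (v∉C , deg-nonroot v≢r (branches v v∉C v≢r))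

      generalized-Halin : HasSpanningGenHalin G
      generalized-Halin = tree , C , ((tree-sub , tree-connected , tree-acyclic) , no-degree-2) , cycle , λ v → mk⇔ (to v) (from v)
        where
        no-degree-2 : ∀ v → deg tree v ≡ 2 → ⊥
        no-degree-2 v e with degree v
        ... | inj₁ (_ , d) = case trans (sym d) e of λ ()
        ... | inj₂ (_ , d) = <-irrefl (sym e) d
        to : ∀ v → v ∈ C → IsLeaf tree v
        to v m with degree v
        ... | inj₁ (_ , d) = d
        ... | inj₂ (h , _) = ⊥-elim (h m)
        from : ∀ v → IsLeaf tree v → v ∈ C
        from v e with degree v
        ... | inj₁ (m , _) = m
        ... | inj₂ (_ , d) = case ≤-trans d (≤-reflexive e) of λ { (s≤s ()) }

  -- Concatenations, directories and closed walks

  record Claw (n : ℕ) : Set where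
    constructor claw
    field
      center leaf₁ leaf₂ leaf₃ : Fin n
  open Claw public

  module _ {A : Set} where

    nth : List (List A) → ℕ → List A
    nth []         _       = []
    nth (xs ∷ xss) zero    = xs
    nth (xs ∷ xss) (suc i) = nth xss i

    ∈-nth : ∀ xss i {x} → x ∈ nth xss i → x ∈ concat xss
    ∈-nth (xs ∷ xss) zero    m = ∈-++⁺ˡ m
    ∈-nth (xs ∷ xss) (suc i) m = ∈-++⁺ʳ xs (∈-nth xss i m)

    #-concat : ∀ (f : A → Bool) xss → # f (concat xss) ≡ Σ# (# f) xss
    #-concat f []         = refl
    #-concat f (xs ∷ xss) = trans (#-++ f xs (concat xss)) (cong (# f xs +_) (#-concat f xss))

    #-take : ∀ (f : A → Bool) k xs → # f (take k xs) ≤ # f xs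
    #-take f zero    xs       = z≤n
    #-take f (suc k) []       = z≤n
    #-take f (suc k) (x ∷ xs) = +-monoʳ-≤ (if f x then 1 else 0) (#-take f k xs)

    length-filterᵇ : ∀ (f : A → Bool) xs → length (filterᵇ f xs) ≡ # f xs
    length-filterᵇ f []       = refl
    length-filterᵇ f (x ∷ xs) with f x
    ... | true  = cong suc (length-filterᵇ f xs)
    ... | false = length-filterᵇ f xs

    ∈-filterᵇ⁺ : ∀ (f : A → Bool) {x} xs → x ∈ xs → f x ≡ true → x ∈ filterᵇ f xs
    ∈-filterᵇ⁺ f (y ∷ xs) m fx with f y in eq
    ∈-filterᵇ⁺ f (y ∷ xs) (here refl) fx | true  = here refl
    ∈-filterᵇ⁺ f (y ∷ xs) (there m)   fx | true  = there (∈-filterᵇ⁺ f xs m fx)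
    ∈-filterᵇ⁺ f (y ∷ xs) (here refl) fx | false = case trans (sym fx) eq of λ ()
    ∈-filterᵇ⁺ f (y ∷ xs) (there m)   fx | false = ∈-filterᵇ⁺ f xs m fx

    map-++⁻ : ∀ {B : Set} (f : B → A) zs xs {ys} → map f zs ≡ xs ++ ys →
              ∃ λ zs₁ → ∃ λ zs₂ → zs ≡ zs₁ ++ zs₂ × map f zs₁ ≡ xs × map f zs₂ ≡ ys
    map-++⁻ f zs       []       e = [] , zs , refl , refl , e
    map-++⁻ f (z ∷ zs) (x ∷ xs) e with map-++⁻ f zs xs (∷-injectiveʳ e)
    ... | zs₁ , zs₂ , e₁ , e₂ , e₃ = z ∷ zs₁ , zs₂ , cong (z ∷_) e₁ , cong₂ _∷_ (∷-injectiveˡ e) e₂ , e₃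

    -- Used for the block `F`, which occurs twice in a row among the demands: the matched pairs of
    -- the first copy and those of the second copy sit at different positions.
    split-repeated : ∀ {B : Set} (g : B → A) zs o y a xs {ys} → map g zs ≡ o ++ y ++ a ++ xs ++ xs ++ ys →
      ∃ λ zs₁ → ∃ λ zs₂ → ∃ λ zs₃ → zs ≡ zs₁ ++ zs₂ ++ zs₃ × xs ≡ map g zs₂ × (∀ {x} → x ∈ xs → x ∈ map g zs₃)
    split-repeated g zs o y a xs e with map-++⁻ g zs o e
    ... | z₁ , r₁ , e₁ , _ , f₁ with map-++⁻ g r₁ y f₁
    ... | z₂ , r₂ , e₂ , _ , f₂ with map-++⁻ g r₂ a f₂
    ... | z₃ , r₃ , e₃ , _ , f₃ with map-++⁻ g r₃ xs f₃
    ... | z₄ , z₅ , e₄ , f₄ , f₅ = z₁ ++ z₂ ++ z₃ , z₄ , z₅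
      , trans e₁ (trans (cong (z₁ ++_) (trans e₂ (trans (cong (z₂ ++_) (trans e₃ (cong (z₃ ++_) e₄))) (sym (++-assoc z₂ z₃ (z₄ ++ z₅))))))
          (sym (++-assoc z₁ (z₂ ++ z₃) (z₄ ++ z₅))))
      , sym f₄ , λ m → subst (_ ∈_) (sym f₅) (∈-++⁺ˡ m)

  module _ {n : ℕ} where

    #-not∈ : ∀ {v : Fin n} xs → v ∉ xs → # (v ==_) xs ≡ 0
    #-not∈ {v} xs h = #-none (v ==_) xs λ y m → ≢⇒==-false {u = v} {v = y} λ { refl → h m }

    simple-concat-later : ∀ xs xss {x y : Fin n} i → Simple (concat (xs ∷ xss)) → x ∈ xs → y ∈ nth xss i → x ≢ y
    simple-concat-later xs xss {x} i s m m′ refl = <-irrefl refl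
      (≤-trans (+-mono-≤ (∈⇒#== xs m) (∈⇒#== (concat xss) (∈-nth xss i m′)))
        (≤-trans (≤-reflexive (sym (#-++ (x ==_) xs (concat xss)))) (s x)))

    apart : ∀ xss {x y : Fin n} i j {_ : T (i <ᵇ j)} → Simple (concat xss) → x ∈ nth xss i → y ∈ nth xss j → x ≢ y
    apart (xs ∷ xss) zero    (suc j)      s m m′ = simple-concat-later xs xss j s m m′
    apart (xs ∷ xss) (suc i) (suc j) {lt} s m m′ =
      apart xss i j {lt} (λ v → ≤-trans (m≤n+m _ (# (v ==_) xs)) (≤-trans (≤-reflexive (sym (#-++ (v ==_) xs (concat xss)))) (s v))) m m′

    first : (Fin n → Bool) → Fin n → List (Fin n) → Fin n
    first f d []       = d
    first f d (x ∷ xs) = if f x then x else first f d xs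

    first-head : ∀ f {d} x xs → f x ≡ true → first f d (x ∷ xs) ≡ x
    first-head f x xs fx rewrite fx = refl

    first-∈ : ∀ f {d} xs {y} → y ∈ xs → f y ≡ true → first f d xs ∈ xs × f (first f d xs) ≡ true
    first-∈ f (x ∷ xs) m fy with f x in eq
    ... | true = here refl , eq
    first-∈ f (x ∷ xs) (here refl) fy | false = case trans (sym fy) eq of λ ()
    first-∈ f (x ∷ xs) (there m)   fy | false with first-∈ f xs m fy
    ... | k , e = there k , e

    record Entry : Set where
      constructor entry
      field
        key    : Fin n
        rank   : ℕ
        parent : Fin n
    open Entry public

    -- Parents and ranks are given by a table in which each vertex is the key of exactly one entry.
    -- This replaces a case distinction on the role of a vertex, which is only known through
    -- membership in lists.
    module Directory (es : List Entry) (complete : Complete (map key es)) where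

      keys-injective : ∀ es {e e′} → Simple (map key es) → e ∈ es → e′ ∈ es → key e ≡ key e′ → e ≡ e′
      keys-injective (_ ∷ es) s (here refl) (here refl) k = refl
      keys-injective (_ ∷ es) s (here refl) (there m)   k = ⊥-elim (simple-head {xs = map key es} s (∈-map⁺ key m) k)
      keys-injective (_ ∷ es) s (there m)   (here refl) k = ⊥-elim (simple-head {xs = map key es} s (∈-map⁺ key m) (sym k))
      keys-injective (_ ∷ es) s (there m)   (there m′)  k = keys-injective es (simple-tail {xs = map key es} s) m m′ k

      private
        find-entry : ∀ v → ∃ λ e → e ∈ es × v ≡ key e
        find-entry v = ∈-map⁻ key (complete-∈ complete v)

        entryOf-key : ∀ {e} → e ∈ es → proj₁ (find-entry (key e)) ≡ e
        entryOf-key {e} m with find-entry (key e)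
        ... | e′ , m′ , k = keys-injective es (complete-simple complete) m′ m (sym k)

      abstract
        parentIn : Fin n → Fin n
        parentIn v = parent (proj₁ (find-entry v))

        rankIn : Fin n → ℕ
        rankIn v = rank (proj₁ (find-entry v))

        parentIn-key : ∀ {e} → e ∈ es → parentIn (key e) ≡ parent e
        parentIn-key m = cong parent (entryOf-key m)

        rankIn-key : ∀ {e} → e ∈ es → rankIn (key e) ≡ rank e
        rankIn-key m = cong rank (entryOf-key m)

      lookup-entry : ∀ v → ∃ λ e → e ∈ es × v ≡ key e × parentIn v ≡ parent e × rankIn v ≡ rank e
      lookup-entry v with find-entry v
      ... | e , m , refl = e , m , refl , parentIn-key m , rankIn-key m

  module _ {n : ℕ} (G : Graph n) where

    -- The path is stored through its effect on chains: it prolongs any chain starting at `right`.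
    -- In the segments used below, `more` ends with `right`, or is empty when the segment is a
    -- single vertex.
    record Segment : Set where
      constructor segment
      field
        left  : Fin n
        more  : List (Fin n)
        right : Fin n
        path  : ∀ rest → Chain (adj G) (right ∷ rest) → Chain (adj G) (left ∷ more ++ rest)
    open Segment public

    vertices : Segment → List (Fin n)
    vertices s = left s ∷ more s

    -- A gap is the segment before it together with the first vertex after it. Taking the start of
    -- the first segment for `v` closes the walk.
    slots : List Segment → Fin n → List (Segment × Fin n)
    slots []            _ = []
    slots (s ∷ [])      v = (s , v) ∷ []
    slots (s ∷ s′ ∷ ss) v = (s , left s′) ∷ slots (s′ ∷ ss) v

    fits : Segment × Fin n → Fin n → Bool
    fits (s , v) d = adj G (right s) d ∧ adj G v d

    slots-segments : ∀ ss v → map proj₁ (slots ss v) ≡ ss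
    slots-segments []            v = refl
    slots-segments (s ∷ [])      v = refl
    slots-segments (s ∷ s′ ∷ ss) v = cong (s ∷_) (slots-segments (s′ ∷ ss) v)

    slots-ends : ∀ s ss v → map proj₂ (slots (s ∷ ss) v) ≡ map left ss ++ v ∷ []
    slots-ends s []        v = refl
    slots-ends s (s′ ∷ ss) v = cong (left s′ ∷_) (slots-ends s′ ss v)

    weave : List ((Segment × Fin n) × Fin n) → List (Fin n)
    weave []                   = []
    weave (((s , _) , d) ∷ zs) = vertices s ++ d ∷ weave zs

    weave-extend : ∀ d s ss v zs → adj G d (left s) ≡ true → map proj₁ zs ≡ slots (s ∷ ss) v →
                   Chain (adj G) (weave zs ++ v ∷ []) → Chain (adj G) (d ∷ weave zs ++ v ∷ [])
    weave-extend d s []       v (((_ , _) , _) ∷ _) a e    ch with refl ← ∷-injectiveˡ e = a , ch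
    weave-extend d s (s′ ∷ ss) v (((_ , _) , _) ∷ _) a e    ch with refl ← ∷-injectiveˡ e = a , ch

    weave-chain : ∀ s ss v zs → map proj₁ zs ≡ slots (s ∷ ss) v → All (λ z → fits (proj₁ z) (proj₂ z) ≡ true) zs →
                  Chain (adj G) (weave zs ++ v ∷ [])
    weave-chain s [] v (((_ , _) , d) ∷ []) refl (h ∷ []) with adj G (right s) d in e₁ | adj G v d in e₂
    ... | true | true rewrite ++-assoc (more s) (d ∷ []) (v ∷ []) =
      path s (d ∷ v ∷ []) (e₁ , trans (Graph.sym G d v) e₂ , tt)
    weave-chain s (s′ ∷ ss) v (((_ , _) , d) ∷ zs) e (h ∷ hs) with ∷-injective e
    ... | refl , e′ with adj G (right s) d in e₁ | adj G (left s′) d in e₂ | weave-chain s′ ss v zs e′ hs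
    ...   | true | true | ch rewrite ++-assoc (more s) (d ∷ weave zs) (v ∷ []) =
      path s (d ∷ weave zs ++ v ∷ []) (e₁ , weave-extend d s′ ss v zs (trans (Graph.sym G d _) e₂) e′ ch)

    #-weave : ∀ f zs → # f (weave zs) ≡ Σ# (λ s → # f (vertices s)) (map proj₁ (map proj₁ zs)) + # f (map proj₂ zs)
    #-weave f []                   = refl
    #-weave f (((s , v) , d) ∷ zs) rewrite #-++ f (vertices s) (d ∷ weave zs) | #-weave f zs =
      linarith 4 (λ a b c d → goal (a :+ (b :+ (c :+ d)) :≡ a :+ c :+ (b :+ d)))
        (# f (vertices s)) (if f d then 1 else 0) (Σ# (λ s → # f (vertices s)) (map proj₁ (map proj₁ zs))) (# f (map proj₂ zs))

    weave-closed : ∀ s ss zs → map proj₁ zs ≡ slots (s ∷ ss) (left s) → All (λ z → fits (proj₁ z) (proj₂ z) ≡ true) zs →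
                   Chain (adj G) (weave zs ++ take 1 (weave zs))
    weave-closed s []       zs@(_ ∷ _) e h with weave-chain s [] (left s) zs e h
    ... | ch with refl ← ∷-injectiveˡ e = ch
    weave-closed s (s′ ∷ ss) zs@(_ ∷ _) e h with weave-chain s (s′ ∷ ss) (left s) zs e h
    ... | ch with refl ← proj₁ (∷-injective e) = ch

  -- The tree and the cycle

  module _ {n : ℕ} (G : Graph n) where

    -- Neighbours and misses of v in a list; v counts among its own misses wherever it occurs.
    N M : Fin n → List (Fin n) → ℕ
    N v xs = # (adj G v) xs
    M v xs = # (λ u → not (adj G v u)) xs

    IsClaw : Claw n → Set
    IsClaw q = adj G (center q) (leaf₁ q) ≡ true × adj G (center q) (leaf₂ q) ≡ true × adj G (center q) (leaf₃ q) ≡ true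

    IsLink : Fin n → Claw n → Set
    IsLink z q = adj G (leaf₁ q) z ≡ true × adj G (center q) (leaf₁ q) ≡ true × adj G (leaf₂ q) (center q) ≡ true × adj G (leaf₃ q) (center q) ≡ true

  -- The tree is rooted at z. A claw of zt hangs its center below leaf₁, which is a child of z, and carries
  -- leaf₂ and leaf₃ as children. A claw of sp puts its center on the cycle between leaf₁ and leaf₂ and hangs it
  -- below leaf₃. A pair (x , y) of ms hangs the leaf x below y. The vertices of ds are distributed twice: over the
  -- gaps of the cycle, and as leaves of the tree below the vertices listed in `demands`.
  record Plan (n : ℕ) : Set where
    field
      z         : Fin n
      zt sp     : List (Claw n)
      ms        : List (Fin n × Fin n)
      ds R₁ F   : List (Fin n)
      s         : ℕ

  module Construct {n : ℕ} (G : Graph n) (plan : Plan n) where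

    open Plan plan

    Zs Ya U U′ W P Q O X Y : List (Fin n)
    Zs = map center zt
    Ya = map leaf₁ zt
    U  = map leaf₂ zt
    U′ = map leaf₃ zt
    W  = map center sp
    P  = map leaf₁ sp
    Q  = map leaf₂ sp
    O  = map leaf₃ sp
    X  = map proj₁ ms
    Y  = map proj₂ ms

    outer groups : List (List (Fin n))
    outer  = Ya ∷ U ∷ U′ ∷ P ∷ Q ∷ O ∷ X ∷ Y ∷ R₁ ∷ F ∷ []
    groups = (z ∷ []) ∷ Zs ∷ W ∷ ds ∷ outer

    -- `cycle-count` equates segments with gap fillers, `tree-count` equates leaves still needed
    -- with leaves available. The number s counts the vertices of `F` that take a third leaf.
    record Valid : Set where
      field
        complete : Complete (concat groups)
        zt-adj   : ∀ q → q ∈ zt → IsLink G z q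
        sp-adj   : ∀ q → q ∈ sp → IsClaw G q
        ms-adj   : ∀ q → q ∈ ms → adj G (proj₁ q) (proj₂ q) ≡ true
        covered  : ∀ v → v ∈ concat outer → ∃ λ y → y ∈ z ∷ Zs × adj G v y ≡ true
        sparse₁  : ∀ v → v ∈ concat outer → 20 * M G v ds ≤ n
        sparse₂  : ∀ d → d ∈ ds → 40 * M G d (concat outer) ≤ n
        large    : n ≤ 3 * length ds
        nonempty : 3 ≤ length ds
        root-big : 3 ≤ N G z (R₁ ++ F)
        cycle-count : length R₁ + length sp + length ms + 2 * length zt ≡ length ds
        tree-count  : s + (length sp + length ms + length zt + 2 * length F) ≡ length ds
        s-small     : s ≤ length F

    module _ (valid : Valid) where

      open Valid valid

      simple : Simple (concat groups)
      simple = complete-simple complete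

      -- One entry for each leaf from `ds` that an inner vertex still needs. A vertex of `O`, `Y` or
      -- `Ya` already has one child, namely the centre of its claw or its partner in `ms`; a vertex
      -- of `F` has none, and some take a third leaf so that `ds` is used up.
      demand-groups : List (List (Fin n))
      demand-groups = O ∷ Y ∷ Ya ∷ F ∷ F ∷ take s F ∷ []

      demands : List (Fin n)
      demands = concat demand-groups

      All-concat : ∀ {A : Set} {p : A → Set} xss → (∀ i {v} → v ∈ nth xss i → p v) → ∀ v → v ∈ concat xss → p v
      All-concat (xs ∷ xss) h v m with ∈-++⁻ xs m
      ... | inj₁ k = h 0 k
      ... | inj₂ k = All-concat xss (λ i → h (suc i)) v k

      ∈-take : ∀ k (xs : List (Fin n)) {v} → v ∈ take k xs → v ∈ xs
      ∈-take (suc k) (x ∷ xs) (here e)  = here e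
      ∈-take (suc k) (x ∷ xs) (there m) = there (∈-take k xs m)

      demands-outer : ∀ v → v ∈ demands → v ∈ concat outer
      demands-outer = All-concat demand-groups λ
        { 0 m → ∈-nth outer 5 m
        ; 1 m → ∈-nth outer 7 m
        ; 2 m → ∈-nth outer 0 m
        ; 3 m → ∈-nth outer 9 m
        ; 4 m → ∈-nth outer 9 m
        ; 5 m → ∈-nth outer 9 (∈-take s F m)
        ; (suc (suc (suc (suc (suc (suc _)))))) () }

      length-demands : length demands ≡ length ds
      length-demands = trans (sym (#-true demands)) (trans (#-concat _ demand-groups) (trans sizes tree-count))
        where
        sizes : Σ# (# (λ _ → true)) demand-groups ≡ s + (length sp + length ms + length zt + 2 * length F)
        sizes rewrite #-true O | #-true Y | #-true Ya | #-true F | #-true (take s F)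
                    | length-map leaf₃ sp | length-map proj₂ ms | length-map leaf₁ zt | length-take s F | m≤n⇒m⊓n≡m s-small =
          linarith 5 (λ s a b c f → goal (a :+ (b :+ (c :+ (f :+ (f :+ (s :+ con 0))))) :≡ s :+ (a :+ b :+ c :+ 2 :* f))) s (length sp) (length ms) (length zt) (length F)

      #-outer : ∀ f → # f (concat outer) ≡ Σ# (# f) outer
      #-outer f = #-concat f outer

      #-demands : ∀ f → # f demands ≤ 3 * # f (concat outer)
      #-demands f rewrite #-outer f | #-concat f demand-groups =
        linarith 11 (λ ya u u′ p q o x y r f t → t :≤ f :⇒
            goal (o :+ (y :+ (ya :+ (f :+ (f :+ (t :+ con 0))))) :≤ 3 :* (ya :+ (u :+ (u′ :+ (p :+ (q :+ (o :+ (x :+ (y :+ (r :+ (f :+ con 0))))))))))))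
          (# f Ya) (# f U) (# f U′) (# f P) (# f Q) (# f O) (# f X) (# f Y) (# f R₁) (# f F) _ (#-take f s F)

      M-sym : ∀ d xs → # (λ x → not (adj G x d)) xs ≡ M G d xs
      M-sym d xs = #-cong _ _ xs λ x → cong not (Graph.sym G x d)

      -- A vertex occurs at most three times among the demands, so the misses amount to at most n/20
      -- + 3n/40, well below n/3.
      tree-dense : ∀ p d → p ∈ demands → d ∈ ds →
                   M G p ds + # (λ x → not (adj G x d)) demands < length demands
      tree-dense p d p∈ d∈ = subst (M G p ds + # (λ x → not (adj G x d)) demands <_) (sym length-demands)
        (linarith 5 (λ a b c n l → 20 :* a :≤ n :⇒ b :≤ 3 :* c :⇒ 40 :* c :≤ n :⇒ n :≤ 3 :* l :⇒ con 3 :≤ l :⇒ goal (a :+ b :< l))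
          (M G p ds) (# (λ x → not (adj G x d)) demands) (M G d (concat outer)) n (length ds)
          (sparse₁ p (demands-outer p p∈))
          (subst (λ m → # (λ x → not (adj G x d)) demands ≤ 3 * m) (M-sym d (concat outer)) (#-demands _))
          (sparse₂ d d∈) large nonempty)

      abstract
        tree-matching : ∃ λ td → map proj₁ td ≡ demands × map proj₂ td ↭ ds × All (λ e → adj G (proj₁ e) (proj₂ e) ≡ true) td
        tree-matching = perfectMatching (adj G) demands ds tree-dense length-demands

      td : List (Fin n × Fin n)
      td = proj₁ tree-matching

      td-demands : map proj₁ td ≡ demands
      td-demands = proj₁ (proj₂ tree-matching)

      td-ds : map proj₂ td ↭ ds
      td-ds = proj₁ (proj₂ (proj₂ tree-matching))

      td-adj : ∀ e → e ∈ td → adj G (proj₁ e) (proj₂ e) ≡ true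
      td-adj e m = All.lookup (proj₂ (proj₂ (proj₂ tree-matching))) m

      single : Fin n → Segment G
      single v = segment v [] v λ _ ch → ch

      triple : ∀ q → IsClaw G q → Segment G
      triple (claw w a b _) (wa , wb , _) = segment a (w ∷ b ∷ []) b λ _ ch → trans (Graph.sym G a w) wa , wb , ch

      triples : ∀ qs → (∀ q → q ∈ qs → IsClaw G q) → List (Segment G)
      triples []       h = []
      triples (q ∷ qs) h = triple q (h q (here refl)) ∷ triples qs λ q m → h q (there m)

      single-groups : List (List (Fin n))
      single-groups = X ∷ U ∷ U′ ∷ R₁ ∷ []

      segments : List (Segment G)
      segments = triples sp sp-adj ++ map single (concat single-groups)

      Σ-triples : ∀ f qs h → Σ# (λ s → # f (vertices G s)) (triples qs h) ≡ # f (map leaf₁ qs) + (# f (map center qs) + # f (map leaf₂ qs))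
      Σ-triples f []       h = refl
      Σ-triples f (claw w a b _ ∷ qs) h rewrite Σ-triples f qs (λ q m → h q (there m)) =
        linarith 6 (λ a w b A W B → goal (a :+ (w :+ (b :+ con 0)) :+ (A :+ (W :+ B)) :≡ a :+ A :+ (w :+ W :+ (b :+ B))))
          (if f a then 1 else 0) (if f w then 1 else 0) (if f b then 1 else 0) _ _ _

      Σ-singles : ∀ f vs → Σ# (λ s → # f (vertices G s)) (map single vs) ≡ # f vs
      Σ-singles f []       = refl
      Σ-singles f (v ∷ vs) rewrite Σ-singles f vs = cong (_+ # f vs) (+-identityʳ _)

      #-rights : ∀ f → # f (map right segments) ≡ # f Q + # f (concat single-groups)
      #-rights f rewrite map-++ right (triples sp sp-adj) (map single (concat single-groups))
                       | #-++ f (map right (triples sp sp-adj)) (map right (map single (concat single-groups)))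
                       | #-map f right (map single (concat single-groups)) | #-map (f ∘ right) single (concat single-groups)
                       = cong (_+ # f (concat single-groups)) (go sp sp-adj)
        where
        go : ∀ qs h → # f (map right (triples qs h)) ≡ # f (map leaf₂ qs)
        go []       h = refl
        go (claw w a b c ∷ qs) h = cong ((if f b then 1 else 0) +_) (go qs λ q m → h q (there m))

      #-lefts : ∀ f → # f (map left segments) ≡ # f P + # f (concat single-groups)
      #-lefts f rewrite map-++ left (triples sp sp-adj) (map single (concat single-groups))
                       | #-++ f (map left (triples sp sp-adj)) (map left (map single (concat single-groups)))
                       | #-map f left (map single (concat single-groups)) | #-map (f ∘ left) single (concat single-groups)
                       = cong (_+ # f (concat single-groups)) (go sp sp-adj)
        where
        go : ∀ qs h → # f (map left (triples qs h)) ≡ # f (map leaf₁ qs)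
        go []       h = refl
        go (claw w a b c ∷ qs) h = cong ((if f a then 1 else 0) +_) (go qs λ q m → h q (there m))

      length-triples : ∀ qs h → length (triples qs h) ≡ length qs
      length-triples []       h = refl
      length-triples (q ∷ qs) h = cong suc (length-triples qs λ q m → h q (there m))

      length-segments : length segments ≡ length ds
      length-segments rewrite length-++ (triples sp sp-adj) {map single (concat single-groups)} | length-triples sp sp-adj
                            | length-map single (concat single-groups) = trans (cong (length sp +_) sizes) (trans
          (linarith 4 (λ r s m t → goal (s :+ (m :+ (t :+ (t :+ (r :+ con 0)))) :≡ r :+ s :+ m :+ 2 :* t)) (length R₁) (length sp) (length ms) (length zt))
          cycle-count)
        where
        sizes : length (concat single-groups) ≡ length ms + (length zt + (length zt + (length R₁ + 0)))
        sizes rewrite sym (#-true (concat single-groups)) | #-concat (λ _ → true) single-groups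
                    | #-true X | #-true U | #-true U′ | #-true R₁ | length-map proj₁ ms | length-map leaf₂ zt | length-map leaf₃ zt = refl

      CycleThrough : List (Segment G) → Set
      CycleThrough ss = ∃ λ zs → Chain (adj G) (weave G zs ++ take 1 (weave G zs)) × map proj₁ (map proj₁ zs) ≡ ss × map proj₂ zs ↭ ds

      module _ (s₀ : Segment G) (ss : List (Segment G)) (same : length (s₀ ∷ ss) ≡ length ds)
        (lefts  : ∀ f → # f (map left (s₀ ∷ ss)) ≤ # f (concat outer))
        (rights : ∀ f → # f (map right (s₀ ∷ ss)) ≤ # f (concat outer)) where

        private
          gaps : List (Segment G × Fin n)
          gaps = slots G (s₀ ∷ ss) (left s₀)

          right-count : ∀ f → # (f ∘ right ∘ proj₁) gaps ≤ # f (concat outer)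
          right-count f = ≤-trans (≤-reflexive (trans (sym (#-map (f ∘ right) proj₁ gaps))
            (trans (cong (# (f ∘ right)) (slots-segments G (s₀ ∷ ss) (left s₀))) (sym (#-map f right (s₀ ∷ ss)))))) (rights f)

          next-count : ∀ f → # (f ∘ proj₂) gaps ≤ # f (concat outer)
          next-count f = ≤-trans (≤-reflexive (trans (sym (#-map f proj₂ gaps))
            (trans (cong (# f) (slots-ends G s₀ ss (left s₀))) (#-↭ (++-comm (map left ss) (left s₀ ∷ [])) f)))) (lefts f)

          gap-right : ∀ p → p ∈ gaps → right (proj₁ p) ∈ concat outer
          gap-right p m = #==⇒∈ (concat outer) (≤-trans (#-∈ _ gaps m (==-refl (right (proj₁ p)))) (right-count (right (proj₁ p) ==_)))

          gap-next : ∀ p → p ∈ gaps → proj₂ p ∈ concat outer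
          gap-next p m = #==⇒∈ (concat outer) (≤-trans (#-∈ _ gaps m (==-refl (proj₂ p))) (next-count (proj₂ p ==_)))

          length-gaps : length gaps ≡ length ds
          length-gaps = trans (sym (length-map proj₁ gaps)) (trans (cong length (slots-segments G (s₀ ∷ ss) (left s₀))) same)

          -- Filling a gap means being adjacent to both of its ends, and each outer vertex is at
          -- most once a left and at most once a right end: the misses amount to at most 2n/20 +
          -- 2n/40.
          gaps-dense : ∀ p d → p ∈ gaps → d ∈ ds → # (λ y → not (fits G p y)) ds + # (λ q → not (fits G q d)) gaps < length gaps
          gaps-dense p d p∈ d∈ = subst (# (λ y → not (fits G p y)) ds + # (λ q → not (fits G q d)) gaps <_) (sym length-gaps)
            (linarith 9 (λ a b a₁ a₂ b₁ b₂ c n l → a :≤ a₁ :+ a₂ :⇒ b :≤ b₁ :+ b₂ :⇒ 20 :* a₁ :≤ n :⇒ 20 :* a₂ :≤ n :⇒ b₁ :≤ c :⇒ b₂ :≤ c :⇒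
                 40 :* c :≤ n :⇒ n :≤ 3 :* l :⇒ con 3 :≤ l :⇒ goal (a :+ b :< l))
              (# (λ y → not (fits G p y)) ds) (# (λ q → not (fits G q d)) gaps)
              (M G (right (proj₁ p)) ds) (M G (proj₂ p) ds)
              (# (λ q → not (adj G (right (proj₁ q)) d)) gaps) (# (λ q → not (adj G (proj₂ q) d)) gaps) (M G d (concat outer)) n (length ds)
              (≤-trans (#-mono _ _ ds λ y _ → not-∧ (adj G (right (proj₁ p)) y) _) (#-∨ _ _ ds))
              (≤-trans (#-mono _ _ gaps λ q _ → not-∧ (adj G (right (proj₁ q)) d) _) (#-∨ _ _ gaps))
              (sparse₁ _ (gap-right p p∈)) (sparse₁ _ (gap-next p p∈))
              (≤-trans (right-count λ x → not (adj G x d)) (≤-reflexive (M-sym d (concat outer))))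
              (≤-trans (next-count λ x → not (adj G x d)) (≤-reflexive (M-sym d (concat outer))))
              (sparse₂ d d∈) large nonempty)

          close-up : (∃ λ zs → map proj₁ zs ≡ gaps × map proj₂ zs ↭ ds × All (λ e → fits G (proj₁ e) (proj₂ e) ≡ true) zs) → CycleThrough (s₀ ∷ ss)
          close-up (zs , e , π , ok) = zs , weave-closed G s₀ ss zs e ok , trans (cong (map proj₁) e) (slots-segments G (s₀ ∷ ss) (left s₀)) , π

        cycle-through-nonempty : CycleThrough (s₀ ∷ ss)
        cycle-through-nonempty = close-up (perfectMatching (fits G) gaps ds gaps-dense length-gaps)

      cycle-through : ∀ ss → length ss ≡ length ds →
        (∀ f → # f (map left ss) ≤ # f (concat outer)) → (∀ f → # f (map right ss) ≤ # f (concat outer)) → CycleThrough ss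
      cycle-through []       e = case subst (3 ≤_) (sym e) nonempty of λ ()
      cycle-through (s ∷ ss) e = cycle-through-nonempty s ss e

      single-outer : ∀ f → # f (concat single-groups) + (# f P + # f Q) ≤ # f (concat outer)
      single-outer f rewrite #-outer f | #-concat f single-groups =
        linarith 10 (λ ya u u′ p q o x y r f →
            goal (x :+ (u :+ (u′ :+ (r :+ con 0))) :+ (p :+ q) :≤ ya :+ (u :+ (u′ :+ (p :+ (q :+ (o :+ (x :+ (y :+ (r :+ (f :+ con 0)))))))))))
          (# f Ya) (# f U) (# f U′) (# f P) (# f Q) (# f O) (# f X) (# f Y) (# f R₁) (# f F)

      lefts-outer : ∀ f → # f (map left segments) ≤ # f (concat outer)
      lefts-outer f rewrite #-lefts f =
        linarith 4 (λ p q s o → s :+ (p :+ q) :≤ o :⇒ goal (p :+ s :≤ o)) (# f P) (# f Q) (# f (concat single-groups)) (# f (concat outer)) (single-outer f)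

      rights-outer : ∀ f → # f (map right segments) ≤ # f (concat outer)
      rights-outer f rewrite #-rights f =
        linarith 4 (λ p q s o → s :+ (p :+ q) :≤ o :⇒ goal (q :+ s :≤ o)) (# f P) (# f Q) (# f (concat single-groups)) (# f (concat outer)) (single-outer f)

      abstract
        the-cycle : CycleThrough segments
        the-cycle = cycle-through segments length-segments lefts-outer rights-outer

      C : List (Fin n)
      C = weave G (proj₁ the-cycle)

      -- The leaves and the inner vertices of the tree. Their counts add up to that of all vertices,
      -- which gives disjointness and exhaustion at the same time.
      cycle-groups inner-groups : List (List (Fin n))
      cycle-groups = P ∷ W ∷ Q ∷ X ∷ U ∷ U′ ∷ R₁ ∷ ds ∷ []
      inner-groups = (z ∷ []) ∷ Zs ∷ Ya ∷ O ∷ Y ∷ F ∷ []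

      #-C : ∀ f → # f C ≡ Σ# (# f) cycle-groups
      #-C f with the-cycle
      ... | zs , _ , e , π rewrite #-weave G f zs | e | #-↭ π f
        | Σ#-++ (λ s → # f (vertices G s)) (triples sp sp-adj) (map single (concat single-groups))
        | Σ-triples f sp sp-adj | Σ-singles f (concat single-groups) | #-concat f single-groups =
        linarith 8 (λ p w q x u u′ r d → goal (p :+ (w :+ q) :+ (x :+ (u :+ (u′ :+ (r :+ con 0)))) :+ d :≡ p :+ (w :+ (q :+ (x :+ (u :+ (u′ :+ (r :+ (d :+ con 0)))))))))
          (# f P) (# f W) (# f Q) (# f X) (# f U) (# f U′) (# f R₁) (# f ds)

      #-C-inner : ∀ f → # f C + # f (concat inner-groups) ≡ # f (allFin n)
      #-C-inner f rewrite #-C f | #-concat f inner-groups = trans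
        (linarith 14 (λ z zs w d ya u u′ p q o x y r f → goal (
           p :+ (w :+ (q :+ (x :+ (u :+ (u′ :+ (r :+ (d :+ con 0))))))) :+ (z :+ (zs :+ (ya :+ (o :+ (y :+ (f :+ con 0)))))) :≡
           z :+ (zs :+ (w :+ (d :+ (ya :+ (u :+ (u′ :+ (p :+ (q :+ (o :+ (x :+ (y :+ (r :+ (f :+ con 0))))))))))))) ))
          (# f (z ∷ [])) (# f Zs) (# f W) (# f ds) (# f Ya) (# f U) (# f U′) (# f P) (# f Q) (# f O) (# f X) (# f Y) (# f R₁) (# f F))
        (sym (trans (count complete f) (#-concat f groups)))

      #-C-inner≡1 : ∀ v → # (v ==_) C + # (v ==_) (concat inner-groups) ≤ 1
      #-C-inner≡1 v = ≤-trans (≤-reflexive (#-C-inner (v ==_))) (unique⇒simple (allFin⁺ n) v)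

      C-inner-disjoint : ∀ {v} → v ∈ C → v ∉ concat inner-groups
      C-inner-disjoint {v} m k = <-irrefl refl (≤-trans (+-mono-≤ (∈⇒#== C m) (∈⇒#== (concat inner-groups) k)) (#-C-inner≡1 v))

      inner-of-∉C : ∀ {v} → v ∉ C → v ∈ concat inner-groups
      inner-of-∉C {v} h = #==⇒∈ (concat inner-groups)
        (subst (λ k → 0 < k + # (v ==_) (concat inner-groups)) (#-not∈ C h)
          (subst (0 <_) (sym (#-C-inner (v ==_))) (∈⇒#== (allFin n) (∈-allFin v))))

      C-cycle : IsCycle (adj G) C
      C-cycle = long , simple⇒unique (λ v → ≤-trans (m≤m+n _ _) (#-C-inner≡1 v)) , proj₁ (proj₂ the-cycle)
        where
        long : 3 ≤ length C
        long rewrite sym (#-true C) | #-C (λ _ → true) = ≤-trans nonempty (subst (_≤ Σ# (# (λ _ → true)) cycle-groups) (#-true ds)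
          (linarith 8 (λ p w q x u u′ r d → goal (d :≤ p :+ (w :+ (q :+ (x :+ (u :+ (u′ :+ (r :+ (d :+ con 0)))))))))
            (# _ P) (# _ W) (# _ Q) (# _ X) (# _ U) (# _ U′) (# _ R₁) (# (λ _ → true) ds)))

      -- Because z comes first in the list, every generic vertex adjacent to z becomes a child of z;
      -- this is how the root gets its three children. The default z is never reached by outer
      -- vertices, which are all covered.
      parentOf : Fin n → Fin n
      parentOf v = first (adj G v) z (z ∷ Zs)

      generic : Fin n → Entry
      generic v = entry v 3 (parentOf v)

      -- The ranks are z : 0, `Ya` : 1, `Zs` : 2, vertices whose parent lies in z ∷ `Zs` : 3, and 4
      -- for what hangs below a vertex of `O` or `Y` or below a demand. The positions of the groups
      -- serve as indices in the case distinctions below.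
      entry-groups : List (List (Entry {n}))
      entry-groups =
          (entry z 0 z ∷ [])
        ∷ map (λ q → entry (center q) 2 (leaf₁ q)) zt
        ∷ map (λ q → entry (leaf₁ q) 1 z) zt
        ∷ map (λ q → entry (leaf₂ q) 3 (center q)) zt
        ∷ map (λ q → entry (leaf₃ q) 3 (center q)) zt
        ∷ map (λ q → entry (center q) 4 (leaf₃ q)) sp
        ∷ map (generic ∘ leaf₁) sp
        ∷ map (generic ∘ leaf₂) sp
        ∷ map (generic ∘ leaf₃) sp
        ∷ map (λ q → entry (proj₁ q) 4 (proj₂ q)) ms
        ∷ map (generic ∘ proj₂) ms
        ∷ map generic R₁
        ∷ map generic F
        ∷ map (λ e → entry (proj₂ e) 4 (proj₁ e)) td
        ∷ []

      entries : List Entry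
      entries = concat entry-groups

      abstract
        entries-complete : Complete (map key entries)
        entries-complete = equinumerous λ f → trans (trans (count complete f) (#-concat f groups)) (trans (regroup f) (sym (trans (#-map f key entries) (#-concat (f ∘ key) entry-groups))))
          where
          regrouped : List (List (Fin n))
          regrouped = (z ∷ []) ∷ Zs ∷ Ya ∷ U ∷ U′ ∷ W ∷ P ∷ Q ∷ O ∷ X ∷ Y ∷ R₁ ∷ F ∷ ds ∷ []
          keys : ∀ {B : Set} (f : Fin n → Bool) (g : B → Entry) (h : B → Fin n) → (∀ b → key (g b) ≡ h b) → ∀ xs → # f (map h xs) ≡ # (f ∘ key) (map g xs)
          keys f g h e []       = refl
          keys f g h e (x ∷ xs) = cong₂ (λ v m → (if f v then 1 else 0) + m) (sym (e x)) (keys f g h e xs)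
          by-groups : ∀ f → Σ# (# f) regrouped ≡ Σ# (# (f ∘ key)) entry-groups
          by-groups f =
            cong₂ _+_ {x = # f (z ∷ [])} refl (
            cong₂ _+_ (keys f (λ q → entry (center q) 2 (leaf₁ q)) center (λ _ → refl) zt) (
            cong₂ _+_ (keys f (λ q → entry (leaf₁ q) 1 z) leaf₁ (λ _ → refl) zt) (
            cong₂ _+_ (keys f (λ q → entry (leaf₂ q) 3 (center q)) leaf₂ (λ _ → refl) zt) (
            cong₂ _+_ (keys f (λ q → entry (leaf₃ q) 3 (center q)) leaf₃ (λ _ → refl) zt) (
            cong₂ _+_ (keys f (λ q → entry (center q) 4 (leaf₃ q)) center (λ _ → refl) sp) (
            cong₂ _+_ (keys f (generic ∘ leaf₁) leaf₁ (λ _ → refl) sp) (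
            cong₂ _+_ (keys f (generic ∘ leaf₂) leaf₂ (λ _ → refl) sp) (
            cong₂ _+_ (keys f (generic ∘ leaf₃) leaf₃ (λ _ → refl) sp) (
            cong₂ _+_ (keys f (λ q → entry (proj₁ q) 4 (proj₂ q)) proj₁ (λ _ → refl) ms) (
            cong₂ _+_ (keys f (generic ∘ proj₂) proj₂ (λ _ → refl) ms) (
            cong₂ _+_ (sym (#-map (f ∘ key) generic R₁)) (
            cong₂ _+_ (sym (#-map (f ∘ key) generic F)) (
            cong₂ _+_ (trans (sym (#-↭ td-ds f)) (keys f (λ e → entry (proj₂ e) 4 (proj₁ e)) proj₂ (λ _ → refl) td)) refl)))))))))))))
          regroup : ∀ f → Σ# (# f) groups ≡ Σ# (# (f ∘ key)) entry-groups
          regroup f = trans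
            (linarith 14 (λ z zs w d ya u u′ p q o x y r f → goal (
               z :+ (zs :+ (w :+ (d :+ (ya :+ (u :+ (u′ :+ (p :+ (q :+ (o :+ (x :+ (y :+ (r :+ (f :+ con 0))))))))))))) :≡
               z :+ (zs :+ (ya :+ (u :+ (u′ :+ (w :+ (p :+ (q :+ (o :+ (x :+ (y :+ (r :+ (f :+ (d :+ con 0)))))))))))))))
              (# f (z ∷ [])) (# f Zs) (# f W) (# f ds) (# f Ya) (# f U) (# f U′) (# f P) (# f Q) (# f O) (# f X) (# f Y) (# f R₁) (# f F))
            (by-groups f)

      open Directory entries entries-complete

      p : Fin n → Fin n
      p = parentIn

      rk : Fin n → ℕ
      rk = rankIn

      p-entry : ∀ i {e} → e ∈ nth entry-groups i → p (key e) ≡ parent e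
      p-entry i m = parentIn-key (∈-nth entry-groups i m)

      below : ∀ {k i} e → e ∈ nth entry-groups i → rank e < k → rk (key e) < k
      below {k} {i} e m lt = subst (_< k) (sym (rankIn-key (∈-nth entry-groups i m))) lt

      Proper : Entry → Set
      Proper e = e ≡ entry z 0 z ⊎ (adj G (key e) (parent e) ≡ true × rk (parent e) < rank e)

      generic-proper : ∀ v → v ∈ concat outer → Proper (generic v)
      generic-proper v m with covered v m
      ... | y , y∈ , a with first-∈ (adj G v) {z} (z ∷ Zs) y∈ a
      ... | k , a′ = inj₂ (a′ , low k)
        where
        low : ∀ {y} → y ∈ z ∷ Zs → rk y < 3
        low (here refl) = below {i = 0} (entry z 0 z) (here refl) (s≤s z≤n)
        low (there m) with ∈-map⁻ center m
        ... | q , m′ , refl = below {i = 1} (entry (center q) 2 (leaf₁ q)) (∈-map⁺ _ m′) ≤-refl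

      demand-rank : ∀ v → v ∈ demands → rk v < 4
      demand-rank = All-concat demand-groups λ
        { 0 m → let (q , m′ , e) = ∈-map⁻ leaf₃ m in subst (λ v → rk v < 4) (sym e) (below {i = 8} (generic (leaf₃ q)) (∈-map⁺ _ m′) ≤-refl)
        ; 1 m → let (q , m′ , e) = ∈-map⁻ proj₂ m in subst (λ v → rk v < 4) (sym e) (below {i = 10} (generic (proj₂ q)) (∈-map⁺ _ m′) ≤-refl)
        ; 2 m → let (q , m′ , e) = ∈-map⁻ leaf₁ m in subst (λ v → rk v < 4) (sym e) (below {i = 2} (entry (leaf₁ q) 1 z) (∈-map⁺ _ m′) (s≤s (s≤s z≤n)))
        ; 3 {v} m → below {i = 12} (generic v) (∈-map⁺ generic m) ≤-refl
        ; 4 {v} m → below {i = 12} (generic v) (∈-map⁺ generic m) ≤-refl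
        ; 5 {v} m → below {i = 12} (generic v) (∈-map⁺ generic (∈-take s F m)) ≤-refl
        ; (suc (suc (suc (suc (suc (suc _)))))) () }

      td-demand : ∀ {e} → e ∈ td → proj₁ e ∈ demands
      td-demand m = subst (_ ∈_) td-demands (∈-map⁺ proj₁ m)

      proper : ∀ i e → e ∈ nth entry-groups i → Proper e
      proper 0 e (here refl) = inj₁ refl
      proper 1 e m with ∈-map⁻ _ m
      ... | q , m′ , refl = inj₂ (proj₁ (proj₂ (zt-adj q m′)) , below {i = 2} (entry (leaf₁ q) 1 z) (∈-map⁺ _ m′) ≤-refl)
      proper 2 e m with ∈-map⁻ _ m
      ... | q , m′ , refl = inj₂ (proj₁ (zt-adj q m′) , below {i = 0} (entry z 0 z) (here refl) ≤-refl)
      proper 3 e m with ∈-map⁻ _ m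
      ... | q , m′ , refl = inj₂ (proj₁ (proj₂ (proj₂ (zt-adj q m′))) , below {i = 1} (entry (center q) 2 (leaf₁ q)) (∈-map⁺ _ m′) ≤-refl)
      proper 4 e m with ∈-map⁻ _ m
      ... | q , m′ , refl = inj₂ (proj₂ (proj₂ (proj₂ (zt-adj q m′))) , below {i = 1} (entry (center q) 2 (leaf₁ q)) (∈-map⁺ _ m′) ≤-refl)
      proper 5 e m with ∈-map⁻ _ m
      ... | q , m′ , refl = inj₂ (proj₂ (proj₂ (sp-adj q m′)) , below {i = 8} (generic (leaf₃ q)) (∈-map⁺ _ m′) ≤-refl)
      proper 6 e m with ∈-map⁻ _ m
      ... | q , m′ , refl = generic-proper _ (∈-nth outer 3 (∈-map⁺ leaf₁ m′))
      proper 7 e m with ∈-map⁻ _ m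
      ... | q , m′ , refl = generic-proper _ (∈-nth outer 4 (∈-map⁺ leaf₂ m′))
      proper 8 e m with ∈-map⁻ _ m
      ... | q , m′ , refl = generic-proper _ (∈-nth outer 5 (∈-map⁺ leaf₃ m′))
      proper 9 e m with ∈-map⁻ _ m
      ... | q , m′ , refl = inj₂ (ms-adj q m′ , below {i = 10} (generic (proj₂ q)) (∈-map⁺ _ m′) ≤-refl)
      proper 10 e m with ∈-map⁻ _ m
      ... | q , m′ , refl = generic-proper _ (∈-nth outer 7 (∈-map⁺ proj₂ m′))
      proper 11 e m with ∈-map⁻ _ m
      ... | q , m′ , refl = generic-proper _ (∈-nth outer 8 m′)
      proper 12 e m with ∈-map⁻ _ m
      ... | q , m′ , refl = generic-proper _ (∈-nth outer 9 m′)
      proper 13 e m with ∈-map⁻ _ m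
      ... | q , m′ , refl = inj₂ (trans (Graph.sym G _ _) (td-adj q m′) , demand-rank _ (td-demand m′))
      proper (suc (suc (suc (suc (suc (suc (suc (suc (suc (suc (suc (suc (suc (suc _)))))))))))))) e ()

      p-root : p z ≡ z
      p-root = p-entry 0 (here refl)

      proper-at : ∀ v → v ≢ z → adj G v (p v) ≡ true × rk (p v) < rk v
      proper-at v v≢z with lookup-entry v
      ... | e , m , refl , pe , re with All-concat {p = Proper} entry-groups (λ i → proper i _) e m
      ...   | inj₁ refl     = ⊥-elim (v≢z refl)
      ...   | inj₂ (a , lt) = subst (λ u → adj G (key e) u ≡ true) (sym pe) a , subst₂ _<_ (cong rk (sym pe)) (sym re) lt

      parentOf-∈ : ∀ v → v ∈ concat outer → parentOf v ∈ concat inner-groups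
      parentOf-∈ v m with covered v m
      ... | y , y∈ , a with first-∈ (adj G v) {z} (z ∷ Zs) y∈ a
      ... | here e  , _ = subst (_∈ concat inner-groups) (sym e) (∈-nth inner-groups 0 (here refl))
      ... | there k , _ = ∈-nth inner-groups 1 k

      demand-inner : ∀ v → v ∈ demands → v ∈ concat inner-groups
      demand-inner = All-concat demand-groups λ
        { 0 m → ∈-nth inner-groups 3 m
        ; 1 m → ∈-nth inner-groups 4 m
        ; 2 m → ∈-nth inner-groups 2 m
        ; 3 m → ∈-nth inner-groups 5 m
        ; 4 m → ∈-nth inner-groups 5 m
        ; 5 m → ∈-nth inner-groups 5 (∈-take s F m)
        ; (suc (suc (suc (suc (suc (suc _)))))) () }

      parent-inner : ∀ i e → e ∈ nth entry-groups i → parent e ∈ concat inner-groups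
      parent-inner 0 e (here refl) = ∈-nth inner-groups 0 (here refl)
      parent-inner 1 e m with ∈-map⁻ _ m
      ... | q , m′ , refl = ∈-nth inner-groups 2 (∈-map⁺ leaf₁ m′)
      parent-inner 2 e m with ∈-map⁻ _ m
      ... | q , m′ , refl = ∈-nth inner-groups 0 (here refl)
      parent-inner 3 e m with ∈-map⁻ _ m
      ... | q , m′ , refl = ∈-nth inner-groups 1 (∈-map⁺ center m′)
      parent-inner 4 e m with ∈-map⁻ _ m
      ... | q , m′ , refl = ∈-nth inner-groups 1 (∈-map⁺ center m′)
      parent-inner 5 e m with ∈-map⁻ _ m
      ... | q , m′ , refl = ∈-nth inner-groups 3 (∈-map⁺ leaf₃ m′)
      parent-inner 6 e m with ∈-map⁻ _ m
      ... | q , m′ , refl = parentOf-∈ _ (∈-nth outer 3 (∈-map⁺ leaf₁ m′))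
      parent-inner 7 e m with ∈-map⁻ _ m
      ... | q , m′ , refl = parentOf-∈ _ (∈-nth outer 4 (∈-map⁺ leaf₂ m′))
      parent-inner 8 e m with ∈-map⁻ _ m
      ... | q , m′ , refl = parentOf-∈ _ (∈-nth outer 5 (∈-map⁺ leaf₃ m′))
      parent-inner 9 e m with ∈-map⁻ _ m
      ... | q , m′ , refl = ∈-nth inner-groups 4 (∈-map⁺ proj₂ m′)
      parent-inner 10 e m with ∈-map⁻ _ m
      ... | q , m′ , refl = parentOf-∈ _ (∈-nth outer 7 (∈-map⁺ proj₂ m′))
      parent-inner 11 e m with ∈-map⁻ _ m
      ... | q , m′ , refl = parentOf-∈ _ (∈-nth outer 8 m′)
      parent-inner 12 e m with ∈-map⁻ _ m
      ... | q , m′ , refl = parentOf-∈ _ (∈-nth outer 9 m′)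
      parent-inner 13 e m with ∈-map⁻ _ m
      ... | q , m′ , refl = demand-inner _ (td-demand m′)
      parent-inner (suc (suc (suc (suc (suc (suc (suc (suc (suc (suc (suc (suc (suc (suc _)))))))))))))) e ()

      C-leaves : ∀ v → v ∈ C → v ≢ z × (∀ u → p u ≢ v)
      C-leaves v m = (λ { refl → C-inner-disjoint m (∈-nth inner-groups 0 (here refl)) })
                   , childless
        where
        childless : ∀ u → p u ≢ v
        childless u e with lookup-entry u
        ... | x , x∈ , _ , px , _ = C-inner-disjoint m (subst (_∈ concat inner-groups) (trans (sym px) e)
          (All-concat {p = λ e → parent e ∈ concat inner-groups} entry-groups (λ i → parent-inner i _) x x∈))

      not-root : ∀ i {v} → v ∈ nth groups (suc i) → v ≢ z
      not-root i m refl = apart groups 0 (suc i) simple (here refl) m refl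

      root-children : Children p z z 3
      root-children = record
        { children = filterᵇ (adj G z) (R₁ ++ F)
        ; distinct = simple⇒unique λ v → ≤-trans (filter-≤ v) (R₁F-simple v)
        ; are      = λ u m → are u (∈-filterᵇ⁻ (adj G z) (R₁ ++ F) m)
        ; number   = subst (3 ≤_) (sym (length-filterᵇ (adj G z) (R₁ ++ F))) root-big }
        where
        filter-≤ : ∀ v → # (v ==_) (filterᵇ (adj G z) (R₁ ++ F)) ≤ # (v ==_) (R₁ ++ F)
        filter-≤ v = ≤-trans (m≤m+n _ _) (≤-reflexive (#-split (v ==_) (adj G z) (R₁ ++ F)))
        R₁F-simple : Simple (R₁ ++ F)
        R₁F-simple v rewrite #-++ (v ==_) R₁ F = linarith 15
          (λ z zs w d ya u u′ p q o x y r f t → t :≡ (z :+ (zs :+ (w :+ (d :+ (ya :+ (u :+ (u′ :+ (p :+ (q :+ (o :+ (x :+ (y :+ (r :+ (f :+ con 0)))))))))))))) :⇒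
            t :≤ con 1 :⇒ goal (r :+ f :≤ con 1))
          (# g (z ∷ [])) (# g Zs) (# g W) (# g ds) (# g Ya) (# g U) (# g U′) (# g P) (# g Q) (# g O) (# g X) (# g Y) (# g R₁) (# g F) (# g (concat groups))
          (#-concat g groups) (simple v)
          where g = v ==_
        generic-child : ∀ {u} → adj G z u ≡ true → parentOf u ≡ z
        generic-child {u} a = first-head (adj G u) z Zs (trans (Graph.sym G u z) a)
        are : ∀ u → u ∈ R₁ ++ F × adj G z u ≡ true → p u ≡ z × u ≢ z
        are u (m , a) with ∈-++⁻ R₁ m
        ... | inj₁ k = trans (p-entry 11 (∈-map⁺ generic k)) (generic-child a) , not-root 11 k
        ... | inj₂ k = trans (p-entry 12 (∈-map⁺ generic k)) (generic-child a) , not-root 12 k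

      two-children : ∀ {v a b} → a ≢ b → p a ≡ v → p b ≡ v → a ≢ z → b ≢ z → Children p z v 2
      two-children {v} {a} {b} a≢b pa pb az bz = record
        { children = a ∷ b ∷ [] ; distinct = (a≢b ∷ []) ∷ ([] ∷ [])
        ; are = λ { _ (here refl) → pa , az ; _ (there (here refl)) → pb , bz } ; number = ≤-refl }

      demand-child : ∀ v → v ∈ demands → ∃ λ d → d ∈ ds × p d ≡ v
      demand-child v m with ∈-map⁻ proj₁ (subst (v ∈_) (sym td-demands) m)
      ... | e , k , refl = proj₂ e , ∈-resp-↭ td-ds (∈-map⁺ proj₂ k) , p-entry 13 (∈-map⁺ _ k)

      td-split : ∃ λ t₁ → ∃ λ t₂ → ∃ λ t₃ → td ≡ t₁ ++ t₂ ++ t₃ × F ≡ map proj₁ t₂ × (∀ {v} → v ∈ F → v ∈ map proj₁ t₃)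
      td-split = split-repeated proj₁ td O Y Ya F td-demands

      -- The two pairs share the demanding vertex but stand in different parts of the matching, and
      -- each vertex of `ds` is matched only once; hence the two leaves differ.
      two-demands : ∀ t₁ t₂ t₃ → td ≡ t₁ ++ t₂ ++ t₃ → ∀ x y → x ∈ t₂ → y ∈ t₃ → proj₁ x ≡ proj₁ y → Children p z (proj₁ x) 2
      two-demands t₁ t₂ t₃ e x y k l x≡y =
        two-children different (child k∈) (trans (child l∈) (sym x≡y)) (not-root 2 (in-ds k∈)) (not-root 2 (in-ds l∈))
        where
        k∈ : x ∈ td
        k∈ = subst (x ∈_) (sym e) (∈-++⁺ʳ t₁ (∈-++⁺ˡ k))
        l∈ : y ∈ td
        l∈ = subst (y ∈_) (sym e) (∈-++⁺ʳ t₁ (∈-++⁺ʳ t₂ l))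
        child : ∀ {w} → w ∈ td → p (proj₂ w) ≡ proj₁ w
        child w∈ = p-entry 13 (∈-map⁺ _ w∈)
        in-ds : ∀ {w} → w ∈ td → proj₂ w ∈ ds
        in-ds w∈ = ∈-resp-↭ td-ds (∈-map⁺ proj₂ w∈)
        different : proj₂ x ≢ proj₂ y
        different eq = <-irrefl refl (≤-trans (+-mono-≤ (∈⇒#== (map proj₂ t₂) (∈-map⁺ proj₂ k)) (subst (λ w → 0 < # (w ==_) (map proj₂ t₃)) (sym eq) (∈⇒#== (map proj₂ t₃) (∈-map⁺ proj₂ l)))) bound)
          where
          f = proj₂ x ==_
          bound : # f (map proj₂ t₂) + # f (map proj₂ t₃) ≤ 1
          bound = linarith 5 (λ a b c d s → a :+ (b :+ c) :≡ d :⇒ d :≤ s :⇒ s :≤ con 1 :⇒ goal (b :+ c :≤ con 1))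
            (# f (map proj₂ t₁)) (# f (map proj₂ t₂)) (# f (map proj₂ t₃)) (# f ds) (# f (concat groups))
            (trans (sym (trans (cong (# f) (trans (cong (map proj₂) e) (trans (map-++ proj₂ t₁ (t₂ ++ t₃)) (cong (map proj₂ t₁ ++_) (map-++ proj₂ t₂ t₃)))))
               (trans (#-++ f (map proj₂ t₁) _) (cong (# f (map proj₂ t₁) +_) (#-++ f (map proj₂ t₂) (map proj₂ t₃)))))) (#-↭ td-ds f))
            (subst (# f ds ≤_) (sym (#-concat f groups))
              (linarith 5 (λ a b c d r → goal (d :≤ a :+ (b :+ (c :+ (d :+ r))))) (# f (z ∷ [])) (# f Zs) (# f W) (# f ds) _))
            (simple (proj₂ x))

      demand-children : ∀ v → v ∈ F → Children p z v 2
      demand-children v m =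
        let (t₁ , t₂ , t₃ , e , e₂ , e₃) = td-split
            (x , k , v≡x) = ∈-map⁻ proj₁ (subst (v ∈_) e₂ m)
            (y , l , v≡y) = ∈-map⁻ proj₁ (e₃ m)
        in subst (λ v → Children p z v 2) (sym v≡x) (two-demands t₁ t₂ t₃ e x y k l (trans (sym v≡x) v≡y))

      inner-children : ∀ i {v} → v ∈ nth inner-groups i → v ≢ z → Children p z v 2
      inner-children 0 (here refl) h = ⊥-elim (h refl)
      inner-children 1 m h =
        let (q , m′ , e) = ∈-map⁻ center m
        in subst (λ v → Children p z v 2) (sym e) (two-children (apart groups 5 6 simple (∈-map⁺ leaf₂ m′) (∈-map⁺ leaf₃ m′))
             (p-entry 3 (∈-map⁺ _ m′)) (p-entry 4 (∈-map⁺ _ m′)) (not-root 4 (∈-map⁺ leaf₂ m′)) (not-root 5 (∈-map⁺ leaf₃ m′)))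
      inner-children 2 m h =
        let (q , m′ , e) = ∈-map⁻ leaf₁ m
            (d , d∈ , pd) = demand-child _ (∈-nth demand-groups 2 m)
        in subst (λ v → Children p z v 2) (sym e) (two-children (apart groups 1 3 simple (∈-map⁺ center m′) d∈)
             (p-entry 1 (∈-map⁺ _ m′)) (trans pd e) (not-root 0 (∈-map⁺ center m′)) (not-root 2 d∈))
      inner-children 3 m h =
        let (q , m′ , e) = ∈-map⁻ leaf₃ m
            (d , d∈ , pd) = demand-child _ (∈-nth demand-groups 0 m)
        in subst (λ v → Children p z v 2) (sym e) (two-children (apart groups 2 3 simple (∈-map⁺ center m′) d∈)
             (p-entry 5 (∈-map⁺ _ m′)) (trans pd e) (not-root 1 (∈-map⁺ center m′)) (not-root 2 d∈))
      inner-children 4 m h =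
        let (q , m′ , e) = ∈-map⁻ proj₂ m
            (d , d∈ , pd) = demand-child _ (∈-nth demand-groups 1 m)
        in subst (λ v → Children p z v 2) (sym e) (two-children (apart groups 3 10 simple d∈ (∈-map⁺ proj₁ m′) ∘ sym)
             (p-entry 9 (∈-map⁺ _ m′)) (trans pd e) (not-root 9 (∈-map⁺ proj₁ m′)) (not-root 2 d∈))
      inner-children 5 m h = demand-children _ m
      inner-children (suc (suc (suc (suc (suc (suc _)))))) ()

      spanning-generalized-Halin : HasSpanningGenHalin G
      spanning-generalized-Halin = ParentTree.generalized-Halin G p rk z p-root (λ v h → proj₁ (proper-at v h)) (λ v h → proj₂ (proper-at v h)) C C-cycle C-leaves root-children
        λ v v∉C → All-concat inner-groups (λ i m → inner-children i m) v (inner-of-∉C v∉C)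

  -- Covers and matchings

  module _ {n : ℕ} (G : Graph n) where

    N+M : ∀ v xs → N G v xs + M G v xs ≡ length xs
    N+M v xs = #-not (adj G v) xs

    Σ-M-swap : ∀ xs ys → Σ# (λ u → M G u ys) xs ≡ Σ# (λ v → M G v xs) ys
    Σ-M-swap xs ys = trans (Σ#-swap (λ u v → not (adj G u v)) xs ys) (Σ#-cong ys)
      where
      Σ#-cong : ∀ ys → Σ# (λ v → # (λ u → not (adj G u v)) xs) ys ≡ Σ# (λ v → M G v xs) ys
      Σ#-cong []       = refl
      Σ#-cong (y ∷ ys) = cong₂ _+_ (#-cong _ _ xs λ x → cong not (Graph.sym G x y)) (Σ#-cong ys)

    Σ-N-swap : ∀ xs ys → Σ# (λ u → N G u ys) xs ≡ Σ# (λ v → N G v xs) ys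
    Σ-N-swap xs ys = trans (Σ#-swap (adj G) xs ys) (Σ#-cong ys)
      where
      Σ#-cong : ∀ ys → Σ# (λ v → # (λ u → adj G u v) xs) ys ≡ Σ# (λ v → N G v xs) ys
      Σ#-cong []       = refl
      Σ#-cong (y ∷ ys) = cong₂ _+_ (#-cong _ _ xs λ x → Graph.sym G x y) (Σ#-cong ys)

    -- Averaging: if every z in `Cs` missed more than c vertices of Q, double counting the misses
    -- would exceed the given sum.
    few-misses : ∀ Q Cs c → Σ# (λ v → M G v Cs) Q < length Cs * suc c → ∃ λ z → ∃ λ Cs′ → Cs ↭ z ∷ Cs′ × M G z Q ≤ c
    few-misses Q Cs c lt with pull (λ z → M G z Q ≤ᵇ c) Cs
    ... | inj₁ (z , Cs′ , π , h) = z , Cs′ , π , ≤ᵇ⇒≤ _ _ (subst T (sym h) tt)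
    ... | inj₂ none = ⊥-elim (<⇒≱ lt (≤-trans
      (Σ#-lower 1 (suc c) (λ z → M G z Q) Cs λ z m → ≤-trans (≰⇒> λ le → subst T (none z m) (≤⇒≤ᵇ le)) (≤-reflexive (sym (+-identityʳ _))))
      (≤-reflexive (trans (+-identityʳ _) (Σ-M-swap Cs Q)))))

    missed : Fin n → List (Fin n) → List (Fin n)
    missed z Q = filterᵇ (λ v → not (adj G z v)) Q

    length-missed : ∀ z Q → length (missed z Q) ≡ M G z Q
    length-missed z Q = length-filterᵇ (λ v → not (adj G z v)) Q

    missed-or-adj : ∀ z Q v → v ∈ Q → v ∈ missed z Q ⊎ adj G v z ≡ true
    missed-or-adj z Q v m with adj G z v in eq
    ... | true  = inj₂ (trans (Graph.sym G v z) eq)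
    ... | false = inj₁ (∈-filterᵇ⁺ (λ v → not (adj G z v)) Q m (cong not eq))

    Covered : List (Fin n) → List (Fin n) → Set
    Covered zs Q = ∀ v → v ∈ Q → ∃ λ y → y ∈ zs × adj G v y ≡ true

    CoverFrom : List (Fin n) → ℕ → List (Fin n) → Set
    CoverFrom Cs L Q = ∃ λ zs → ∃ λ ds → length zs ≤ L × (∀ f → # f Cs ≡ # f zs + # f ds) × Covered zs Q

    -- Each chosen z misses at most half of the vertices not covered so far.
    halving-cover : ∀ L Q Cs → length Q < 2 ^ L → (∀ v → v ∈ Q → 2 * M G v Cs + L ≤ length Cs) →
      CoverFrom Cs L Q
    halving-cover L       []       Cs _        _ = [] , Cs , z≤n , (λ _ → refl) , λ _ ()
    halving-cover zero    (v ∷ Q)  Cs (s≤s ()) _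
    halving-cover (suc L) Q@(v ∷ _) Cs lt dense = extend (few-misses Q Cs (length Q / 2) average)
      where
      half : length Q < 2 * suc (length Q / 2)
      half = linarith 3 (λ q r h → q :≡ r :+ 2 :* h :⇒ r :< con 2 :⇒ goal (q :< 2 :* (con 1 :+ h)))
        (length Q) (length Q % 2) (length Q / 2) (trans (m≡m%n+[m/n]*n (length Q) 2) (cong (length Q % 2 +_) (*-comm (length Q / 2) 2))) (m%n<n (length Q) 2)
      cs-positive : 0 < length Cs
      cs-positive = ≤-trans (m≤n+m 1 _) (≤-trans (≤-reflexive (+-assoc (2 * M G v Cs) L 1)) (≤-trans (≤-reflexive (cong (2 * M G v Cs +_) (+-comm L 1))) (dense v (here refl))))
      -- Every v in Q misses at most half of `Cs`, so on average a vertex of `Cs` misses at most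
      -- half of Q.
      average : Σ# (λ v → M G v Cs) Q < length Cs * suc (length Q / 2)
      average = *-cancelˡ-< 2 _ _ (≤-trans (s≤s (Σ#-upper 2 (length Cs) (λ v → M G v Cs) Q λ v m → m+n≤o⇒m≤o _ (dense v m)))
        (≤-trans (*-monoˡ-< (length Cs) {{>-nonZero cs-positive}} half) (≤-reflexive (trans (cong (_* length Cs) (refl {x = 2 * suc (length Q / 2)})) (regroup (suc (length Q / 2)) (length Cs))))))
        where
        regroup : ∀ a b → 2 * a * b ≡ 2 * (b * a)
        regroup a b = trans (*-assoc 2 a b) (cong (2 *_) (*-comm a b))
      extend : (∃ λ z → ∃ λ Cs′ → Cs ↭ z ∷ Cs′ × M G z Q ≤ length Q / 2) →
        CoverFrom Cs (suc L) Q
      extend (z , Cs′ , π , few) = finish (halving-cover L (missed z Q) Cs′ smaller dense′)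
        where
        smaller : length (missed z Q) < 2 ^ L
        smaller = linarith 5 (λ q r h m p → q :≡ r :+ 2 :* h :⇒ m :≤ h :⇒ q :< 2 :* p :⇒ goal (m :< p))
          (length Q) (length Q % 2) (length Q / 2) (length (missed z Q)) (2 ^ L)
          (trans (m≡m%n+[m/n]*n (length Q) 2) (cong (length Q % 2 +_) (*-comm (length Q / 2) 2)))
          (≤-trans (≤-reflexive (length-missed z Q)) few) lt
        -- The summand L pays for the shrinking pool: both `Cs` and L drop by one.
        dense′ : ∀ v → v ∈ missed z Q → 2 * M G v Cs′ + L ≤ length Cs′
        dense′ v m = linarith 6 (λ a b l c c′ i → 2 :* a :+ (con 1 :+ l) :≤ c :⇒ c :≡ con 1 :+ c′ :⇒ a :≡ i :+ b :⇒ goal (2 :* b :+ l :≤ c′))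
          (M G v Cs) (M G v Cs′) L (length Cs) (length Cs′) (if not (adj G v z) then 1 else 0)
          (dense v (proj₁ (∈-filterᵇ⁻ (λ v → not (adj G z v)) Q m))) (↭-length π) (#-↭ π _)
        finish : CoverFrom Cs′ L (missed z Q) →
          CoverFrom Cs (suc L) Q
        finish (zs , ds , le , eq , cov) = z ∷ zs , ds , s≤s le
          , (λ f → trans (#-↭ π f) (trans (cong ((if f z then 1 else 0) +_) (eq f)) (sym (+-assoc (if f z then 1 else 0) _ _)))) , cover
          where
          cover : Covered (z ∷ zs) Q
          cover v m with missed-or-adj z Q v m
          ... | inj₂ a = z , here refl , a
          ... | inj₁ k with cov v k
          ...   | y , y∈ , a = y , there y∈ , a

    Independent : List (Fin n) → Set
    Independent xs = ∀ u v → u ∈ xs → v ∈ xs → adj G u v ≡ false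

    -- Greedy choice of edges. If it gets stuck before the j-th edge, the endpoints chosen so far
    -- meet every edge and are fewer than 2j.
    matching-or-independent : ∀ j As →
      (∃ λ ms → ∃ λ Av → length ms ≡ j × (∀ f → # f As ≡ # f (map proj₁ ms) + # f (map proj₂ ms) + # f Av) × (∀ q → q ∈ ms → adj G (proj₁ q) (proj₂ q) ≡ true))
      ⊎ (∃ λ W → ∃ λ Av → length W ≤ 2 * j × (∀ f → # f As ≡ # f W + # f Av) × Independent Av)
    matching-or-independent zero    As = inj₁ ([] , As , refl , (λ _ → refl) , λ _ ())
    matching-or-independent (suc j) As with pull (λ u → 0 <ᵇ N G u As) As
    ... | inj₂ none = inj₂ ([] , As , z≤n , (λ _ → refl) , independent)
      where
      independent : Independent As
      independent u v u∈ v∈ with adj G u v in eq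
      ... | false = refl
      ... | true  = ⊥-elim (subst T (none u u∈) (<⇒<ᵇ (#-∈ (adj G u) As v∈ eq)))
    ... | inj₁ (u , As′ , π , h) with #-pull (adj G u) As′ (positive h)
      where
      positive : (0 <ᵇ N G u As) ≡ true → 0 < N G u As′
      -- As u is not adjacent to itself, its neighbour survives the removal of u.
      positive h = subst (0 <_) (trans (#-↭ π (adj G u)) (cong (λ b → (if b then 1 else 0) + N G u As′) (Graph.irrefl G u))) (<ᵇ⇒< 0 _ (subst T (sym h) tt))
    ...   | v , As″ , π′ , uv with matching-or-independent j As″
    ...     | inj₁ (ms , Av , len , eq , ok) = inj₁ ((u , v) ∷ ms , Av , cong suc len
        , (λ f → linarith 8 (λ a a′ a″ iu iv x y r → a :≡ iu :+ a′ :⇒ a′ :≡ iv :+ a″ :⇒ a″ :≡ x :+ y :+ r :⇒ goal (a :≡ iu :+ x :+ (iv :+ y) :+ r))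
            (# f As) (# f As′) (# f As″) (if f u then 1 else 0) (if f v then 1 else 0) (# f (map proj₁ ms)) (# f (map proj₂ ms)) (# f Av) (#-↭ π f) (#-↭ π′ f) (eq f))
        , λ { _ (here refl) → uv ; q (there m) → ok q m })
    ...     | inj₂ (W , Av , len , eq , ind) = inj₂ (u ∷ v ∷ W , Av , ≤-trans (s≤s (s≤s len)) (≤-reflexive (linarith 1 (λ j → goal (con 2 :+ 2 :* j :≡ 2 :* (con 1 :+ j))) j))
        , (λ f → linarith 7 (λ a a′ a″ iu iv w r → a :≡ iu :+ a′ :⇒ a′ :≡ iv :+ a″ :⇒ a″ :≡ w :+ r :⇒ goal (a :≡ iu :+ (iv :+ w) :+ r))
            (# f As) (# f As′) (# f As″) (if f u then 1 else 0) (if f v then 1 else 0) (# f W) (# f Av) (#-↭ π f) (#-↭ π′ f) (eq f))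
        , ind)

  -- Making up the deficit

  -- Boxed, so that large literals c are never unfolded during conversion checking.
  record Dominated (c x y : ℕ) : Set where
    constructor dominated
    field dominates : c * x ≤ y
  open Dominated public

  module _ {n : ℕ} (G : Graph n) where

    -- The field `enough` is the balance inequality for m = 1 + `length zt` inner vertices in B and
    -- j = `length ms` edges inside A.
    record Solution (As Cs : List (Fin n)) (b L k : ℕ) : Set where
      field
        z        : Fin n
        zt ds Av : List (Fin n)
        ms       : List (Fin n × Fin n)
        As-count : ∀ f → # f As ≡ # f (map proj₁ ms) + # f (map proj₂ ms) + # f Av
        Cs-count : ∀ f → # f Cs ≡ # f (z ∷ []) + (# f zt + # f ds)
        ms-adj   : ∀ q → q ∈ ms → adj G (proj₁ q) (proj₂ q) ≡ true
        covered  : Covered G (z ∷ zt) As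
        few-zt   : length zt ≤ L
        few-ms   : length ms ≤ 5 * k
        enough   : 2 * n + 2 * length zt + 3 ≤ 5 * b + length ms

    -- Once the smaller side reaches size target, the tree can afford L inner vertices there
    -- without using any edge inside the larger side.
    record Stage : Set where
      field
        L k target : ℕ
        As Bs Cs   : List (Fin n)
        complete   : ∀ f → # f As + # f Bs ≡ # f (allFin n)
        Cs⊆Bs      : ∀ f → # f Cs ≤ # f Bs
        degree     : ∀ v → 2 * n + 3 ≤ 5 * N G v (allFin n)
        sparse     : ∀ v → v ∈ As → 20 * M G v Cs ≤ n
        Cs-large   : n ≤ 3 * length Cs
        As-large   : n ≤ 2 * length As
        2≤L        : 2 ≤ L
        n<2^L      : n < 2 ^ L
        n-large′   : Dominated 1000000 (L * L) n
        T-upper    : 5 * target ≤ 2 * n + 2 * L + 7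
        T-lower    : 2 * n + 2 * L + 3 ≤ 5 * target
        reached    : target ≤ length Bs + k
        k-minimal  : 0 < k → length Bs + k ≤ target
        k-small′   : Dominated 1000 k n
        no-hub     : 0 < k → ∀ v → v ∈ As → N G v As < 20 * k

    module Endgame (stage : Stage) where

      open Stage stage

      private
        b : ℕ
        b = length Bs

        n-large = dominates n-large′
        k-small = dominates k-small′

      L≤LL : 2 * L ≤ L * L
      L≤LL = *-monoˡ-≤ L 2≤L

      length-sum : length As + length Bs ≡ n
      length-sum = trans (sym (cong₂ _+_ (#-true As) (#-true Bs))) (trans (complete _) (trans (#-true (allFin n)) (length-tabulate id)))

      M-Cs≤M-Bs : ∀ v → M G v Cs ≤ M G v Bs
      M-Cs≤M-Bs v = Cs⊆Bs _

      As-nonempty : 0 < length As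
      As-nonempty = linarith 4 (λ n a l s → n :≤ 2 :* a :⇒ 1000000 :* s :≤ n :⇒ 2 :* l :≤ s :⇒ con 2 :≤ l :⇒ goal (con 1 :≤ a)) n (length As) L (L * L) As-large n-large L≤LL 2≤L

      -- Halving the uncovered part takes at most L inner vertices, z among them; the summand 2 L in
      -- the last premise pays for these.
      cover-solution : ∀ ms Av → (∀ f → # f As ≡ # f (map proj₁ ms) + # f (map proj₂ ms) + # f Av) →
        (∀ q → q ∈ ms → adj G (proj₁ q) (proj₂ q) ≡ true) → length ms ≤ 5 * k → 2 * n + 2 * L + 3 ≤ 5 * b + length ms → Solution As Cs b L k
      cover-solution ms Av eq ok few en = use (halving-cover G L As Cs
          (≤-trans (s≤s (≤-trans (m≤m+n _ _) (≤-reflexive length-sum))) n<2^L)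
          λ v m → linarith 5 (λ m l s c n → 20 :* m :≤ n :⇒ n :≤ 3 :* c :⇒ 1000000 :* s :≤ n :⇒ 2 :* l :≤ s :⇒ goal (2 :* m :+ l :≤ c))
            (M G v Cs) L (L * L) (length Cs) n (sparse v m) Cs-large n-large L≤LL)
        where
        nonempty-member : ∀ xs → 0 < length xs → ∃ λ (v : Fin n) → v ∈ xs
        nonempty-member (x ∷ xs) _ = x , here refl
        use : CoverFrom G Cs L As → Solution As Cs b L k
        use ([] , ds , _ , _ , cov) = ⊥-elim (none (proj₂ (nonempty-member As As-nonempty)))
          where
          none : ∀ {v} → v ∈ As → ⊥
          none m with cov _ m
          ... | _ , () , _
        use (z ∷ zt , ds , le , ceq , cov) = record
          { z = z ; zt = zt ; ds = ds ; Av = Av ; ms = ms ; As-count = eq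
          ; Cs-count = λ f → trans (ceq f) (linarith 3 (λ a b c → goal (a :+ b :+ c :≡ a :+ con 0 :+ (b :+ c))) (if f z then 1 else 0) (# f zt) (# f ds))
          ; ms-adj = ok ; covered = cov ; few-zt = ≤-trans (n≤1+n _) le ; few-ms = few
          ; enough = linarith 5 (λ n l t b j → con 1 :+ t :≤ l :⇒ 2 :* n :+ 2 :* l :+ con 3 :≤ 5 :* b :+ j :⇒ goal (2 :* n :+ 2 :* t :+ con 3 :≤ 5 :* b :+ j))
              n L (length zt) b (length ms) le en }

      -- The basic trade-off of the endgame: whatever `Bs` lacks in size, and whatever v misses in
      -- it, has to be made up by neighbours of v in `As`.
      degree-As-Bs : ∀ v → 2 * n + 3 + 5 * M G v Bs ≤ 5 * N G v As + 5 * b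
      degree-As-Bs v = linarith 6 (λ n d p q m b → 2 :* n :+ con 3 :≤ 5 :* d :⇒ p :+ q :≡ d :⇒ q :+ m :≡ b :⇒ goal (2 :* n :+ con 3 :+ 5 :* m :≤ 5 :* p :+ 5 :* b))
        n (N G v (allFin n)) (N G v As) (N G v Bs) (M G v Bs) b (degree v) (complete (adj G v)) (N+M G v Bs)

      module _ (0<k : 0 < k) where

        Σ-N-bound : ∀ {j} W Av → length W ≤ j → (∀ f → # f As ≡ # f W + # f Av) → Σ# (λ v → N G v Av) W ≤ j * (20 * k)
        Σ-N-bound {j} W Av le eq = ≤-trans (≤-reflexive (sym (+-identityʳ _))) (≤-trans
          (Σ#-upper 1 (20 * k) (λ v → N G v Av) W λ v m → ≤-trans (≤-reflexive (+-identityʳ _)) (≤-trans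
            (≤-trans (m≤n+m (N G v Av) (N G v W)) (≤-reflexive (sym (eq (adj G v))))) (<⇒≤ (no-hub 0<k v (W⊆As v m)))))
          (*-monoˡ-≤ (20 * k) le))
          where
          W⊆As : ∀ v → v ∈ W → v ∈ As
          W⊆As v m = #==⇒∈ As (≤-trans (∈⇒#== W m) (≤-trans (m≤m+n _ _) (≤-reflexive (sym (eq (v ==_))))))

        Av-degree : ∀ W Av → (∀ f → # f As ≡ # f W + # f Av) → Independent G Av → ∀ v → v ∈ Av → N G v As ≡ N G v W
        Av-degree W Av eq ind v m = trans (eq (adj G v)) (trans (cong (N G v W +_) (#-none (adj G v) Av λ u m′ → ind v u m m′)) (+-identityʳ _))

        -- Every vertex of As has a neighbour in As, so an independent set missing few vertices of As
        -- would force a vertex of large degree.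
        independent-impossible : 5 * b < 2 * n + 3 → ∀ W Av → length W ≤ 2 * (5 * k) → (∀ f → # f As ≡ # f W + # f Av) → Independent G Av → ⊥
        -- For k ≥ 2L + 4 the trade-off gives every vertex at least 4k/5 neighbours in `As`. All
        -- edges leaving the independent set end in at most 10k vertices of W, each with fewer than
        -- 20k neighbours, so 4 |Av| ≤ 1000 k, although |Av| is about n/2 or more.
        independent-impossible deficit W Av le eq ind with 2 * L + 4 ≤? k
        ... | yes big = <⇒≱ (linarith 5 (λ n k a av w → n :≤ 2 :* a :⇒ a :≡ w :+ av :⇒ w :≤ 2 :* (5 :* k) :⇒ 1000 :* k :≤ n :⇒ con 1 :≤ k :⇒ goal (1000 :* k :< 4 :* av))
                n k (length As) (length Av) (length W) As-large split le k-small 0<k)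
              (*-cancelʳ-≤ (4 * length Av) (1000 * k) k {{>-nonZero 0<k}} (begin
                4 * length Av * k                   ≡⟨ trans (cong (_* k) (*-comm 4 (length Av))) (*-assoc (length Av) 4 k) ⟩
                length Av * (4 * k)                 ≤⟨ Σ#-lower 5 (4 * k) (λ v → N G v W) Av (λ v m → subst (λ d → 4 * k ≤ 5 * d) (Av-degree W Av eq ind v m) (high-degree v)) ⟩
                5 * Σ# (λ v → N G v W) Av           ≡⟨ cong (5 *_) (Σ-N-swap G Av W) ⟩
                5 * Σ# (λ v → N G v Av) W           ≤⟨ *-monoʳ-≤ 5 (Σ-N-bound W Av le eq) ⟩
                5 * (2 * (5 * k) * (20 * k))        ≡⟨ regroup 5 2 5 20 k ⟩
                1000 * k * k                        ∎))
          where
          open ≤-Reasoning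
          split : length As ≡ length W + length Av
          split = trans (sym (#-true As)) (trans (eq _) (cong₂ _+_ (#-true W) (#-true Av)))
          high-degree : ∀ v → 4 * k ≤ 5 * N G v As
          high-degree v = linarith 7 (λ n l k b t d m → 2 :* l :+ con 4 :≤ k :⇒ 2 :* n :+ con 3 :+ 5 :* m :≤ 5 :* d :+ 5 :* b :⇒ b :+ k :≤ t :⇒ 5 :* t :≤ 2 :* n :+ 2 :* l :+ con 7 :⇒ goal (4 :* k :≤ 5 :* d))
            n L k b target (N G v As) (M G v Bs) big (degree-As-Bs v) (k-minimal 0<k) T-upper
          regroup : ∀ d a b c k → d * (a * (b * k) * (c * k)) ≡ d * a * b * c * k * k
          regroup = solve-∀
        -- Here k ≤ 4L, and degrees are only known to be positive; now |Av| ≤ 200 k² ≤ 3200 L²,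
        -- which is small because 1000000 L² ≤ n.
        ... | no small = <⇒≱ (linarith 9 (λ n k a av w l s kk t → n :≤ 2 :* a :⇒ a :≡ w :+ av :⇒ w :≤ 2 :* (5 :* k) :⇒ 1000 :* k :≤ n :⇒ 1000000 :* s :≤ n :⇒ t :≡ 200 :* kk :⇒ kk :≤ 16 :* s :⇒ 2 :* l :≤ s :⇒ con 2 :≤ l :⇒ goal (t :< av))
                n k (length As) (length Av) (length W) L (L * L) (k * k) (200 * (k * k)) As-large split le k-small n-large refl k² L≤LL 2≤L)
              (begin
                length Av                           ≡⟨ sym (*-identityʳ _) ⟩
                length Av * 1                       ≤⟨ Σ#-lower 1 1 (λ v → N G v W) Av (λ v m → ≤-trans (subst (1 ≤_) (Av-degree W Av eq ind v m) (positive-degree v)) (≤-reflexive (sym (+-identityʳ _)))) ⟩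
                1 * Σ# (λ v → N G v W) Av           ≡⟨ +-identityʳ _ ⟩
                Σ# (λ v → N G v W) Av               ≡⟨ Σ-N-swap G Av W ⟩
                Σ# (λ v → N G v Av) W               ≤⟨ Σ-N-bound W Av le eq ⟩
                2 * (5 * k) * (20 * k)              ≡⟨ regroup 2 5 20 k ⟩
                200 * (k * k)                       ∎)
          where
          open ≤-Reasoning
          split : length As ≡ length W + length Av
          split = trans (sym (#-true As)) (trans (eq _) (cong₂ _+_ (#-true W) (#-true Av)))
          positive-degree : ∀ v → 1 ≤ N G v As
          positive-degree v = linarith 4 (λ n b d m → 5 :* b :< 2 :* n :+ con 3 :⇒ 2 :* n :+ con 3 :+ 5 :* m :≤ 5 :* d :+ 5 :* b :⇒ goal (con 1 :≤ d))
            n b (N G v As) (M G v Bs) deficit (degree-As-Bs v)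
          k≤4L : k ≤ 4 * L
          k≤4L = linarith 2 (λ k l → k :< 2 :* l :+ con 4 :⇒ con 2 :≤ l :⇒ goal (k :≤ 4 :* l)) k L (≰⇒> small) 2≤L
          k² : k * k ≤ 16 * (L * L)
          k² = ≤-trans (*-mono-≤ k≤4L k≤4L) (≤-reflexive (square 4 L))
            where
            square : ∀ c l → c * l * (c * l) ≡ c * c * (l * l)
            square = solve-∀
          regroup : ∀ a b c k → a * (b * k) * (c * k) ≡ a * b * c * (k * k)
          regroup = solve-∀

        module _ (surplus : 2 * n + 3 ≤ 5 * b) where

          k≤L : k ≤ L
          k≤L = linarith 5 (λ n k l b t → 2 :* n :+ con 3 :≤ 5 :* b :⇒ b :+ k :≤ t :⇒ 5 :* t :≤ 2 :* n :+ 2 :* l :+ con 7 :⇒ con 2 :≤ l :⇒ goal (k :≤ l))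
            n k L b target surplus (k-minimal 0<k) T-upper 2≤L

          -- Misses exceed the neighbours in `As` by at most b - (2n + 3)/5 ≤ L, and without hubs
          -- there are fewer than 20 k ≤ 20 L such neighbours.
          few-missed : ∀ v → v ∈ As → M G v Cs ≤ 21 * L
          few-missed v m = ≤-trans (M-Cs≤M-Bs v) (linarith 7 (λ n k l b t d m → 2 :* n :+ con 3 :+ 5 :* m :≤ 5 :* d :+ 5 :* b :⇒ d :< 20 :* k :⇒ b :+ k :≤ t :⇒
              5 :* t :≤ 2 :* n :+ 2 :* l :+ con 7 :⇒ k :≤ l :⇒ con 1 :≤ l :⇒ goal (m :≤ 21 :* l))
            n k L b target (N G v As) (M G v Bs) (degree-As-Bs v) (no-hub 0<k v m) (k-minimal 0<k) T-upper k≤L (≤-trans (n≤1+n 1) 2≤L))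

          -- Since |As| ≤ 3 |Cs|, some z misses at most 3 · 21 L = 63 L vertices of `As`. These miss
          -- together at most 63 · 21 L² = 1323 L² < |Cs| - 1 vertices, so a second vertex of `Cs`
          -- sees all of them. The bound with 2n + 5 is the balance for m = 2.
          pair-solution : ∀ ms Av → (∀ f → # f As ≡ # f (map proj₁ ms) + # f (map proj₂ ms) + # f Av) →
            (∀ q → q ∈ ms → adj G (proj₁ q) (proj₂ q) ≡ true) → length ms ≤ 5 * k → 2 * n + 5 ≤ 5 * b + length ms → Solution As Cs b L k
          pair-solution ms Av eq ok few en = second (few-misses G As Cs (63 * L) average)
            where
            average : Σ# (λ v → M G v Cs) As < length Cs * suc (63 * L)
            average = subst (Σ# (λ v → M G v Cs) As <_) (sym (trans (*-suc (length Cs) (63 * L)) (cong (length Cs +_) (left-comm 63 (length Cs) L))))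
              (linarith 5 (λ s a c p q → s :≤ a :⇒ a :≤ 3 :* p :⇒ 63 :* q :≡ 3 :* p :⇒ con 1 :≤ c :⇒ goal (s :< c :+ 63 :* q))
                (Σ# (λ v → M G v Cs) As) (length As * (21 * L)) (length Cs) (length Cs * (21 * L)) (length Cs * L)
                (≤-trans (≤-reflexive (sym (+-identityʳ _))) (Σ#-upper 1 (21 * L) _ As λ v m → ≤-trans (≤-reflexive (+-identityʳ _)) (few-missed v m)))
                (≤-trans (*-monoˡ-≤ (21 * L) {length As} {3 * length Cs} (linarith 4 (λ a b n c → a :+ b :≡ n :⇒ n :≤ 3 :* c :⇒ goal (a :≤ 3 :* c)) (length As) b n (length Cs) length-sum Cs-large))
                  (≤-reflexive (*-assoc 3 (length Cs) (21 * L))))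
                (regroup 21 3 (length Cs) L)
                (linarith 4 (λ a b n c → con 1 :≤ a :⇒ a :+ b :≡ n :⇒ n :≤ 3 :* c :⇒ goal (con 1 :≤ c)) (length As) b n (length Cs) As-nonempty length-sum Cs-large))
              where
              regroup : ∀ a d c l → d * a * (c * l) ≡ d * (c * (a * l))
              regroup = solve-∀
              left-comm : ∀ a c l → c * (a * l) ≡ a * (c * l)
              left-comm = solve-∀
            second : (∃ λ z → ∃ λ Cs′ → Cs ↭ z ∷ Cs′ × M G z As ≤ 63 * L) → Solution As Cs b L k
            second (z , Cs′ , π , le) = third (few-misses G (missed G z As) Cs′ 0 average′)
              where
              average′ : Σ# (λ v → M G v Cs′) (missed G z As) < length Cs′ * 1
              average′ = subst (Σ# (λ v → M G v Cs′) (missed G z As) <_) (sym (*-identityʳ _))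
                (linarith 6 (λ s p q c n t → s :≤ p :⇒ p :≤ 1323 :* q :⇒ t :≡ con 1 :+ c :⇒ n :≤ 3 :* t :⇒ 1000000 :* q :≤ n :⇒ con 1 :≤ q :⇒ goal (s :< c))
                  (Σ# (λ v → M G v Cs′) (missed G z As)) (length (missed G z As) * (21 * L)) (L * L) (length Cs′) n (length Cs)
                  (≤-trans (≤-reflexive (sym (+-identityʳ _))) (Σ#-upper 1 (21 * L) _ (missed G z As) λ v m → ≤-trans (≤-reflexive (+-identityʳ _))
                    (≤-trans (≤-trans (m≤n+m (M G v Cs′) (if not (adj G v z) then 1 else 0)) (≤-reflexive (sym (#-↭ π _))))
                      (few-missed v (proj₁ (∈-filterᵇ⁻ (λ v → not (adj G z v)) As m))))))
                  (≤-trans (*-monoˡ-≤ (21 * L) (≤-trans (≤-reflexive (length-missed G z As)) le)) (≤-reflexive (regroup 63 21 L)))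
                  (↭-length π) Cs-large n-large (*-mono-≤ 1≤L 1≤L))
                where
                1≤L : 1 ≤ L
                1≤L = ≤-trans (n≤1+n 1) 2≤L
                regroup : ∀ a c l → a * l * (c * l) ≡ a * c * (l * l)
                regroup = solve-∀
              third : (∃ λ z₂ → ∃ λ ds → Cs′ ↭ z₂ ∷ ds × M G z₂ (missed G z As) ≤ 0) → Solution As Cs b L k
              third (z₂ , ds , π₂ , none) = record
                { z = z ; zt = z₂ ∷ [] ; ds = ds ; Av = Av ; ms = ms ; As-count = eq
                ; Cs-count = λ f → trans (#-↭ π f) (trans (cong ((if f z then 1 else 0) +_) (#-↭ π₂ f))
                    (linarith 3 (λ a b c → goal (a :+ (b :+ c) :≡ a :+ con 0 :+ (b :+ con 0 :+ c))) (if f z then 1 else 0) (if f z₂ then 1 else 0) (# f ds)))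
                ; ms-adj = ok ; covered = cover ; few-zt = ≤-trans (n≤1+n 1) 2≤L ; few-ms = few
                ; enough = ≤-trans (≤-reflexive (+-assoc (2 * n) 2 3)) en }
                where
                cover : Covered G (z ∷ z₂ ∷ []) As
                cover v m with missed-or-adj G z As v m
                ... | inj₂ a = z , here refl , a
                ... | inj₁ k with adj G z₂ v in eq₂
                ...   | true  = z₂ , there (here refl) , trans (Graph.sym G v z₂) eq₂
                ...   | false = ⊥-elim (<⇒≱ (#-∈ (λ u → not (adj G z₂ u)) (missed G z As) k (cong not eq₂)) none)

          -- For such b the trade-off rounds to: misses in `Cs` are at most the neighbours in `As`.
          -- Four vertices, each with at most 20 k neighbours, meet all edges inside `As`, so the
          -- misses sum to at most 160 k < |Cs| and some z misses nothing.
          single-solution : 5 * b ≤ 2 * n + 4 → ∀ W Av → length W ≤ 4 → (∀ f → # f As ≡ # f W + # f Av) → Independent G Av → Solution As Cs b L k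
          single-solution tight W Av le eq ind = use (few-misses G As Cs 0 average)
            where
            W-bound : ∀ xs → (∀ v → N G v xs ≤ N G v As) → Σ# (λ v → N G v xs) W ≤ 4 * (20 * k)
            W-bound xs h = ≤-trans (≤-reflexive (sym (+-identityʳ _))) (≤-trans
              (Σ#-upper 1 (20 * k) (λ v → N G v xs) W λ v m → ≤-trans (≤-reflexive (+-identityʳ _)) (≤-trans (h v)
                (<⇒≤ (no-hub 0<k v (#==⇒∈ As (≤-trans (∈⇒#== W m) (≤-trans (m≤m+n _ _) (≤-reflexive (sym (eq (v ==_)))))))))))
              (*-monoˡ-≤ (20 * k) le))
            edges : Σ# (λ v → N G v As) As ≤ 4 * (20 * k) + 4 * (20 * k)
            edges = begin
              Σ# (λ v → N G v As) As                              ≤⟨ Σ#-mono _ _ As (λ v _ → ≤-reflexive (eq (adj G v))) ⟩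
              Σ# (λ v → N G v W + N G v Av) As                    ≡⟨ Σ#-+ (λ v → N G v W) (λ v → N G v Av) As ⟩
              Σ# (λ v → N G v W) As + Σ# (λ v → N G v Av) As      ≡⟨ cong₂ _+_ (Σ-N-swap G As W) (Σ-N-swap G As Av) ⟩
              Σ# (λ v → N G v As) W + Σ# (λ v → N G v As) Av      ≤⟨ +-mono-≤ (W-bound As λ _ → ≤-refl) (Σ#-mono _ _ Av λ v m → ≤-reflexive (Av-degree W Av eq ind v m)) ⟩
              4 * (20 * k) + Σ# (λ v → N G v W) Av                ≡⟨ cong (4 * (20 * k) +_) (Σ-N-swap G Av W) ⟩
              4 * (20 * k) + Σ# (λ v → N G v Av) W                ≤⟨ +-monoʳ-≤ (4 * (20 * k)) (W-bound Av λ v → ≤-trans (m≤n+m _ (N G v W)) (≤-reflexive (sym (eq (adj G v))))) ⟩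
              4 * (20 * k) + 4 * (20 * k)                         ∎
              where open ≤-Reasoning
            M≤N : ∀ v → M G v Cs ≤ N G v As
            M≤N v = ≤-trans (M-Cs≤M-Bs v) (linarith 4 (λ n b d m → 2 :* n :+ con 3 :+ 5 :* m :≤ 5 :* d :+ 5 :* b :⇒ 5 :* b :≤ 2 :* n :+ con 4 :⇒ goal (m :≤ d))
              n b (N G v As) (M G v Bs) (degree-As-Bs v) tight)
            average : Σ# (λ v → M G v Cs) As < length Cs * 1
            average = subst (Σ# (λ v → M G v Cs) As <_) (sym (*-identityʳ _))
              (linarith 5 (λ s t k c n → s :≤ t :⇒ t :≤ 4 :* (20 :* k) :+ 4 :* (20 :* k) :⇒ 1000 :* k :≤ n :⇒ n :≤ 3 :* c :⇒ con 1 :≤ k :⇒ goal (s :< c))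
                (Σ# (λ v → M G v Cs) As) (Σ# (λ v → N G v As) As) k (length Cs) n (Σ#-mono _ _ As λ v _ → M≤N v) edges k-small Cs-large 0<k)
            use : (∃ λ z → ∃ λ ds → Cs ↭ z ∷ ds × M G z As ≤ 0) → Solution As Cs b L k
            use (z , ds , π , none) = record
              { z = z ; zt = [] ; ds = ds ; Av = As ; ms = [] ; As-count = λ f → refl
              ; Cs-count = λ f → trans (#-↭ π f) (cong (_+ # f ds) (sym (+-identityʳ (if f z then 1 else 0))))
              ; ms-adj = λ _ () ; covered = cover ; few-zt = z≤n ; few-ms = z≤n
              ; enough = ≤-trans (≤-reflexive (cong (_+ 3) (+-identityʳ (2 * n)))) (≤-trans surplus (≤-reflexive (sym (+-identityʳ (5 * b))))) }
              where
              cover : Covered G (z ∷ []) As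
              cover v m with adj G z v in eq
              ... | true  = z , here refl , trans (Graph.sym G v z) eq
              ... | false = ⊥-elim (<⇒≱ (#-∈ (λ u → not (adj G z u)) As m (cong not eq)) none)

          -- A second inner vertex costs 2. Either b pays for it, or two disjoint edges inside `As`
          -- do; failing both, `As` has so few edges that z alone suffices.
          surplus-solution : Solution As Cs b L k
          surplus-solution with 2 * n + 5 ≤? 5 * b
          ... | yes en = pair-solution [] As (λ f → refl) (λ _ ()) z≤n (≤-trans en (≤-reflexive (sym (+-identityʳ (5 * b)))))
          ... | no tight with matching-or-independent G 2 As
          ...   | inj₁ (ms , Av , len , eq , ok) = pair-solution ms Av eq ok
                  (≤-trans (≤-reflexive len) (linarith 1 (λ k → con 1 :≤ k :⇒ goal (con 2 :≤ 5 :* k)) k 0<k))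
                  (linarith 3 (λ n b j → j :≡ con 2 :⇒ 2 :* n :+ con 3 :≤ 5 :* b :⇒ goal (2 :* n :+ con 5 :≤ 5 :* b :+ j)) n b (length ms) len surplus)
          ...   | inj₂ (W , Av , len , eq , ind) = single-solution
                  (linarith 2 (λ n b → 5 :* b :< 2 :* n :+ con 5 :⇒ goal (5 :* b :≤ 2 :* n :+ con 4)) n b (≰⇒> tight)) W Av len eq ind

        -- In the balance 5k disjoint edges are worth the k vertices missing from the target. If
        -- they are lacking, a true deficit of b is contradictory, and otherwise a cheaper cover
        -- exists.
        solution-positive : Solution As Cs b L k
        solution-positive with 2 * n + 3 ≤? 5 * b
        ... | yes surplus = surplus-solution surplus
        ... | no  deficit with matching-or-independent G (5 * k) As
        ...   | inj₁ (ms , Av , len , eq , ok) = cover-solution ms Av eq ok (≤-reflexive len)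
                (linarith 6 (λ n l t b k j → j :≡ 5 :* k :⇒ t :≤ b :+ k :⇒ 2 :* n :+ 2 :* l :+ con 3 :≤ 5 :* t :⇒ goal (2 :* n :+ 2 :* l :+ con 3 :≤ 5 :* b :+ j))
                  n L target b k (length ms) len reached T-lower)
        ...   | inj₂ (W , Av , len , eq , ind) = ⊥-elim (independent-impossible (≰⇒> deficit) W Av len eq ind)

      solution : Solution As Cs b L k
      solution = decide (0 <? k)
        where
        decide : Dec (0 < k) → Solution As Cs b L k
        decide (yes 0<k) = solution-positive 0<k
        decide (no  k≯0) = cover-solution [] As (λ f → refl) (λ _ ()) z≤n
          (linarith 5 (λ n l t b k → k :< con 1 :⇒ t :≤ b :+ k :⇒ 2 :* n :+ 2 :* l :+ con 3 :≤ 5 :* t :⇒ goal (2 :* n :+ 2 :* l :+ con 3 :≤ 5 :* b :+ con 0))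
            n L target b k (≰⇒> k≯0) reached T-lower)

  -- Moving vertices of large degree to the smaller side.

  module _ {n : ℕ} (G : Graph n) where

    #-leaves : (Fin n → Bool) → List (Claw n) → ℕ
    #-leaves f sp = # f (map leaf₁ sp) + (# f (map leaf₂ sp) + # f (map leaf₃ sp))

    ClawAt : Fin n → List (Fin n) → Set
    ClawAt h Av = ∃ λ a → ∃ λ b → ∃ λ c → ∃ λ Av′ → IsClaw G (claw h a b c) ×
      (∀ f → # f Av ≡ (if f a then 1 else 0) + ((if f b then 1 else 0) + (if f c then 1 else 0)) + # f Av′)

    N-pulled : ∀ {h m} a xs ys → xs ↭ a ∷ ys → adj G h a ≡ true → suc m ≤ N G h xs → m ≤ N G h ys
    N-pulled {h} a xs ys π ha le = ≤-pred (≤-trans le (≤-reflexive (trans (#-↭ π (adj G h)) (cong (λ b → (if b then 1 else 0) + N G h ys) ha))))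

    pull-claw : ∀ h Av → 3 ≤ N G h Av → ClawAt h Av
    pull-claw h Av 3≤ with #-pull (adj G h) Av (≤-trans (s≤s z≤n) 3≤)
    ... | a , Av₁ , π₁ , ha with #-pull (adj G h) Av₁ (≤-trans (s≤s z≤n) (N-pulled a Av Av₁ π₁ ha 3≤))
    ...   | b , Av₂ , π₂ , hb with #-pull (adj G h) Av₂ (N-pulled b Av₁ Av₂ π₂ hb (N-pulled a Av Av₁ π₁ ha 3≤))
    ...     | c , Av₃ , π₃ , hc = a , b , c , Av₃ , (ha , hb , hc) , λ f →
      linarith 7 (λ x y z r ia ib ic → x :≡ ia :+ y :⇒ y :≡ ib :+ z :⇒ z :≡ ic :+ r :⇒ goal (x :≡ ia :+ (ib :+ ic) :+ r))
        (# f Av) (# f Av₁) (# f Av₂) (# f Av₃) (if f a then 1 else 0) (if f b then 1 else 0) (if f c then 1 else 0) (#-↭ π₁ f) (#-↭ π₂ f) (#-↭ π₃ f)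

    #-leaves-≤ : ∀ f sp → #-leaves f sp ≤ 3 * length sp
    #-leaves-≤ f sp = linarith 4 (λ a b c s → a :≤ s :⇒ b :≤ s :⇒ c :≤ s :⇒ goal (a :+ (b :+ c) :≤ 3 :* s))
      (# f (map leaf₁ sp)) (# f (map leaf₂ sp)) (# f (map leaf₃ sp)) (length sp) (bound leaf₁) (bound leaf₂) (bound leaf₃)
      where
      bound : ∀ (g : Claw n → Fin n) → # f (map g sp) ≤ length sp
      bound g = ≤-trans (#-≤-length f (map g sp)) (≤-reflexive (length-map g sp))

    -- The centres of `sp` have changed sides, so the balance counts them in B; `rest` is what
    -- remains of `As` and contains their private neighbours.
    record Reduced (As Cs : List (Fin n)) (b L k : ℕ) : Set where
      field
        z             : Fin n
        zt ds Av rest : List (Fin n)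
        ms            : List (Fin n × Fin n)
        sp            : List (Claw n)
        As-count      : ∀ f → # f As ≡ # f (map center sp) + # f rest
        rest-count    : ∀ f → # f rest ≡ #-leaves f sp + (# f (map proj₁ ms) + # f (map proj₂ ms) + # f Av)
        Cs-count      : ∀ f → # f Cs ≡ # f (z ∷ []) + (# f zt + # f ds)
        ms-adj        : ∀ q → q ∈ ms → adj G (proj₁ q) (proj₂ q) ≡ true
        sp-adj        : ∀ q → q ∈ sp → IsClaw G q
        covered       : Covered G (z ∷ zt) rest
        few-zt        : length zt ≤ L
        few-ms        : length ms ≤ 5 * k
        few-sp        : length sp ≤ k
        enough        : 2 * n + 2 * length zt + 3 ≤ 5 * (b + length sp) + length ms

    module _ (L target : ℕ) (Cs : List (Fin n))
      (degree     : ∀ v → 2 * n + 3 ≤ 5 * N G v (allFin n))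
      (Cs-large   : n ≤ 3 * length Cs)
      (2≤L        : 2 ≤ L)
      (n<2^L      : n < 2 ^ L)
      (n-large    : Dominated 1000000 (L * L) n)
      (T-upper    : 5 * target ≤ 2 * n + 2 * L + 7)
      (T-lower    : 2 * n + 2 * L + 3 ≤ 5 * target)
      where

      from-solution : ∀ {As b k} → Solution G As Cs b L k → Reduced As Cs b L k
      from-solution {As} {b} s = record
        { z = z ; zt = zt ; ds = ds ; Av = Av ; rest = As ; ms = ms ; sp = []
        ; As-count = λ f → refl ; rest-count = As-count ; Cs-count = Cs-count ; ms-adj = ms-adj ; sp-adj = λ _ ()
        ; covered = covered ; few-zt = few-zt ; few-ms = few-ms ; few-sp = z≤n
        ; enough = ≤-trans enough (≤-reflexive (cong (λ b → 5 * b + length ms) (sym (+-identityʳ b)))) }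
        where open Solution s

      -- A vertex h with at least 20 k neighbours in As changes sides. Its claw is chosen only after the remaining
      -- reduction, which uses up fewer than 20 k vertices.
      reduce : ∀ k As Bs → (∀ f → # f As + # f Bs ≡ # f (allFin n)) → (∀ f → # f Cs ≤ # f Bs) → (∀ v → v ∈ As → 20 * M G v Cs ≤ n) →
        n + 2 * k ≤ 2 * length As → target ≤ length Bs + k → (0 < k → length Bs + k ≤ target) → Dominated 1000 k n → Reduced As Cs (length Bs) L k
      reduce zero As Bs complete Cs⊆Bs sparse As-large reached minimal k-small =
        from-solution (Endgame.solution G record
          { L = L ; k = 0 ; target = target ; As = As ; Bs = Bs ; Cs = Cs ; complete = complete ; Cs⊆Bs = Cs⊆Bs ; degree = degree ; sparse = sparse
          ; Cs-large = Cs-large ; As-large = ≤-trans (≤-reflexive (sym (+-identityʳ n))) As-large ; 2≤L = 2≤L ; n<2^L = n<2^L ; n-large′ = n-large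
          ; T-upper = T-upper ; T-lower = T-lower ; reached = reached ; k-minimal = minimal ; k-small′ = k-small ; no-hub = λ () })
      reduce (suc k) As Bs complete Cs⊆Bs sparse As-large reached minimal k-small with pull (λ v → 20 * suc k ≤ᵇ N G v As) As
      ... | inj₂ none = from-solution (Endgame.solution G record
          { L = L ; k = suc k ; target = target ; As = As ; Bs = Bs ; Cs = Cs ; complete = complete ; Cs⊆Bs = Cs⊆Bs ; degree = degree ; sparse = sparse
          ; Cs-large = Cs-large ; As-large = ≤-trans (m≤m+n n _) As-large ; 2≤L = 2≤L ; n<2^L = n<2^L ; n-large′ = n-large
          ; T-upper = T-upper ; T-lower = T-lower ; reached = reached ; k-minimal = minimal ; k-small′ = k-small
          ; no-hub = λ _ v m → ≰⇒> λ le → subst T (none v m) (≤⇒≤ᵇ le) })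
      ... | inj₁ (h , As′ , π , hub) = extend (reduce k As′ (h ∷ Bs)
          (λ f → trans (linarith 4 (λ a a′ i b → a :≡ i :+ a′ :⇒ goal (a′ :+ (i :+ b) :≡ a :+ b)) (# f As) (# f As′) (if f h then 1 else 0) (# f Bs) (#-↭ π f)) (complete f))
          (λ f → ≤-trans (Cs⊆Bs f) (m≤n+m (# f Bs) (if f h then 1 else 0)))
          (λ v m → sparse v (∈-resp-↭ (↭-sym π) (there m)))
          -- The summand 2 k of the size bound pays for the vertices still to be moved.
          (linarith 4 (λ n k a a′ → n :+ 2 :* (con 1 :+ k) :≤ 2 :* a :⇒ a :≡ con 1 :+ a′ :⇒ goal (n :+ 2 :* k :≤ 2 :* a′)) n k (length As) (length As′) As-large (↭-length π))
          (≤-trans reached (≤-reflexive (+-suc (length Bs) k)))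
          (λ _ → ≤-trans (≤-reflexive (sym (+-suc (length Bs) k))) (minimal z<s))
          (dominated (≤-trans (*-monoʳ-≤ 1000 (n≤1+n k)) (dominates k-small))))
        where
        hub-degree : 20 * suc k ≤ N G h As′
        hub-degree = ≤-trans (≤ᵇ⇒≤ _ _ (subst T (sym hub) tt))
          (≤-reflexive (trans (#-↭ π (adj G h)) (cong (λ b → (if b then 1 else 0) + N G h As′) (Graph.irrefl G h))))
        extend : Reduced As′ Cs (suc (length Bs)) L k → Reduced As Cs (length Bs) L (suc k)
        extend r = add (pull-claw h Av enough-neighbours)
          where
          open Reduced r
          -- The inner reduction uses at most k centres, 3k leaves of claws and 10k matched
          -- vertices, and 20 (k + 1) - 14 k ≥ 3.
          enough-neighbours : 3 ≤ N G h Av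
          enough-neighbours = linarith 10 (λ k a c r l x y v s j → 20 :* (con 1 :+ k) :≤ a :⇒ a :≡ c :+ r :⇒ r :≡ l :+ (x :+ y :+ v) :⇒ c :≤ s :⇒ l :≤ 3 :* s :⇒
              x :≤ j :⇒ y :≤ j :⇒ s :≤ k :⇒ j :≤ 5 :* k :⇒ goal (con 3 :≤ v))
            k (N G h As′) (N G h (map center sp)) (N G h rest) (#-leaves (adj G h) sp) (N G h (map proj₁ ms)) (N G h (map proj₂ ms)) (N G h Av) (length sp) (length ms)
            hub-degree (As-count (adj G h)) (rest-count (adj G h))
            (≤-trans (#-≤-length (adj G h) (map center sp)) (≤-reflexive (length-map center sp))) (#-leaves-≤ (adj G h) sp)
            (≤-trans (#-≤-length (adj G h) (map proj₁ ms)) (≤-reflexive (length-map proj₁ ms)))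
            (≤-trans (#-≤-length (adj G h) (map proj₂ ms)) (≤-reflexive (length-map proj₂ ms))) few-sp few-ms
          add : ClawAt h Av → Reduced As Cs (length Bs) L (suc k)
          add (a , b , c , Av′ , is-claw , eq) = record
            { z = z ; zt = zt ; ds = ds ; Av = Av′ ; rest = rest ; ms = ms ; sp = claw h a b c ∷ sp
            ; As-count = λ f → trans (#-↭ π f) (trans (cong ((if f h then 1 else 0) +_) (As-count f)) (sym (+-assoc (if f h then 1 else 0) _ _)))
            ; rest-count = λ f → trans (rest-count f) (linarith 10 (λ p q r ia ib ic x y v v′ → v :≡ ia :+ (ib :+ ic) :+ v′ :⇒
                  goal (p :+ (q :+ r) :+ (x :+ y :+ v) :≡ ia :+ p :+ (ib :+ q :+ (ic :+ r)) :+ (x :+ y :+ v′)))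
                (# f (map leaf₁ sp)) (# f (map leaf₂ sp)) (# f (map leaf₃ sp)) (if f a then 1 else 0) (if f b then 1 else 0) (if f c then 1 else 0)
                (# f (map proj₁ ms)) (# f (map proj₂ ms)) (# f Av) (# f Av′) (eq f))
            ; Cs-count = Cs-count ; ms-adj = ms-adj
            ; sp-adj = λ { _ (here refl) → is-claw ; q (there m) → sp-adj q m }
            ; covered = covered ; few-zt = few-zt ; few-ms = ≤-trans few-ms (*-monoʳ-≤ 5 (n≤1+n k)) ; few-sp = s≤s few-sp
            ; enough = ≤-trans enough (≤-reflexive (cong (λ b → 5 * b + length ms) (sym (+-suc (length Bs) (length sp))))) }

  -- Disjoint claws and links with prescribed centres.

  module _ {n : ℕ} (G : Graph n) where

    ClawsAt : List (Fin n) → List (Fin n) → (Claw n → Set) → Set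
    ClawsAt ys Av P = ∃ λ qs → ∃ λ Av′ → map center qs ≡ ys × (∀ q → q ∈ qs → P q) × (∀ f → # f Av ≡ #-leaves G f qs + # f Av′)

    pull-claws : ∀ ys Av → (∀ y → y ∈ ys → 3 * length ys ≤ N G y Av) → ClawsAt ys Av (IsClaw G)
    pull-claws []       Av _ = [] , Av , refl , (λ _ ()) , λ f → refl
    pull-claws (y ∷ ys) Av many = extend (pull-claw G y Av (≤-trans (*-monoʳ-≤ 3 (s≤s z≤n)) (many y (here refl))))
      where
      remaining : ∀ a b c Av₁ → (∀ f → # f Av ≡ (if f a then 1 else 0) + ((if f b then 1 else 0) + (if f c then 1 else 0)) + # f Av₁) →
        ∀ w → w ∈ ys → 3 * length ys ≤ N G w Av₁
      remaining a b c Av₁ eq w m =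
        linarith 6 (λ s x i j k r → 3 :* (con 1 :+ s) :≤ x :⇒ x :≡ i :+ (j :+ k) :+ r :⇒ i :≤ con 1 :⇒ j :≤ con 1 :⇒ k :≤ con 1 :⇒ goal (3 :* s :≤ r))
          (length ys) (N G w Av) (if adj G w a then 1 else 0) (if adj G w b then 1 else 0) (if adj G w c then 1 else 0) (N G w Av₁)
          (many w (there m)) (eq (adj G w)) (indicator≤1 (adj G w a)) (indicator≤1 (adj G w b)) (indicator≤1 (adj G w c))
      extend : ClawAt G y Av → ClawsAt (y ∷ ys) Av (IsClaw G)
      extend (a , b , c , Av₁ , is-claw , eq) =
        let (qs , Av′ , e , ok , eq′) = pull-claws ys Av₁ (remaining a b c Av₁ eq)
        in claw y a b c ∷ qs , Av′ , cong (y ∷_) e , (λ { _ (here refl) → is-claw ; q (there m) → ok q m })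
         , λ f → linarith 9 (λ x y i j k p q r v → x :≡ i :+ (j :+ k) :+ y :⇒ y :≡ p :+ (q :+ r) :+ v :⇒ goal (x :≡ i :+ p :+ (j :+ q :+ (k :+ r)) :+ v))
             (# f Av) (# f Av₁) (if f a then 1 else 0) (if f b then 1 else 0) (if f c then 1 else 0)
             (# f (map leaf₁ qs)) (# f (map leaf₂ qs)) (# f (map leaf₃ qs)) (# f Av′) (eq f) (eq′ f)

    -- Greedy: `leaf₁` has to be a common neighbour of z and w, which exists because their misses
    -- together do not exhaust the list; each link uses up three vertices, whence the factor 3.
    pull-links : ∀ z ws Av → (∀ w → w ∈ ws → M G z Av + M G w Av + 3 * length ws ≤ length Av) → ClawsAt ws Av (IsLink G z)
    pull-links z []       Av _ = [] , Av , refl , (λ _ ()) , λ f → refl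
    pull-links z (w ∷ ws) Av many with #-pull both Av common
      where
      both : Fin n → Bool
      both v = adj G z v ∧ adj G w v
      common : 0 < # both Av
      common = linarith 6 (λ p q a b l s → a :+ b :+ 3 :* (con 1 :+ s) :≤ l :⇒ p :+ q :≡ l :⇒ q :≤ a :+ b :⇒ goal (con 0 :< p))
        (# both Av) (# (not ∘ both) Av) (M G z Av) (M G w Av) (length Av) (length ws) (many w (here refl)) (#-not both Av)
        (≤-trans (#-mono _ _ Av λ v _ → not-∧ (adj G z v) (adj G w v)) (#-∨ (λ v → not (adj G z v)) (λ v → not (adj G w v)) Av))
    ... | y , Av₁ , π , yy with #-pull (adj G w) Av₁ (proj₁ two)
      where
      two : 0 < N G w Av₁ × 2 ≤ N G w Av₁
      two = ≤-trans (s≤s z≤n) two′ , two′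
        where
        two′ : 2 ≤ N G w Av₁
        two′ = linarith 7 (λ m a b l s x i → a :+ b :+ 3 :* (con 1 :+ s) :≤ l :⇒ x :+ b :≡ l :⇒ x :≡ i :+ m :⇒ i :≤ con 1 :⇒ goal (con 2 :≤ m))
          (N G w Av₁) (M G z Av) (M G w Av) (length Av) (length ws) (N G w Av) (if adj G w y then 1 else 0) (many w (here refl)) (N+M G w Av) (#-↭ π (adj G w)) (indicator≤1 (adj G w y))
    ...   | u , Av₂ , π₂ , wu with #-pull (adj G w) Av₂ one
      where
      one : 0 < N G w Av₂
      one = linarith 9 (λ m₂ m a b l s x i j → a :+ b :+ 3 :* (con 1 :+ s) :≤ l :⇒ x :+ b :≡ l :⇒ x :≡ i :+ m :⇒ m :≡ j :+ m₂ :⇒ i :≤ con 1 :⇒ j :≤ con 1 :⇒ goal (con 1 :≤ m₂))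
        (N G w Av₂) (N G w Av₁) (M G z Av) (M G w Av) (length Av) (length ws) (N G w Av) (if adj G w y then 1 else 0) (if adj G w u then 1 else 0)
        (many w (here refl)) (N+M G w Av) (#-↭ π (adj G w)) (#-↭ π₂ (adj G w)) (indicator≤1 (adj G w y)) (indicator≤1 (adj G w u))
    ...     | u′ , Av₃ , π₃ , wu′ with pull-links z ws Av₃ (λ v m →
          linarith 7 (λ a b c d l r s → a :+ b :+ 3 :* (con 1 :+ s) :≤ l :⇒ c :≤ a :⇒ d :≤ b :⇒ l :≡ con 3 :+ r :⇒ goal (c :+ d :+ 3 :* s :≤ r))
            (M G z Av) (M G v Av) (M G z Av₃) (M G v Av₃) (length Av) (length Av₃) (length ws) (many v (there m)) (shrink _) (shrink _)
            (trans (↭-length π) (cong suc (trans (↭-length π₂) (cong suc (↭-length π₃))))))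
      where
      shrink : ∀ f → # f Av₃ ≤ # f Av
      shrink f = linarith 7 (λ x y z r i j k → x :≡ i :+ y :⇒ y :≡ j :+ z :⇒ z :≡ k :+ r :⇒ goal (r :≤ x))
        (# f Av) (# f Av₁) (# f Av₂) (# f Av₃) (if f y then 1 else 0) (if f u then 1 else 0) (if f u′ then 1 else 0) (#-↭ π f) (#-↭ π₂ f) (#-↭ π₃ f)
    ...       | qs , Av′ , e , ok , eq′ = claw w y u u′ ∷ qs , Av′ , cong (w ∷_) e
      , (λ { _ (here refl) → trans (Graph.sym G y z) (proj₁ (∧-true yy)) , proj₂ (∧-true yy) , trans (Graph.sym G u w) wu , trans (Graph.sym G u′ w) wu′
           ; q (there m) → ok q m })
      , λ f → linarith 11 (λ x x₁ x₂ y i j k p q r v → x :≡ i :+ x₁ :⇒ x₁ :≡ j :+ x₂ :⇒ x₂ :≡ k :+ y :⇒ y :≡ p :+ (q :+ r) :+ v :⇒ goal (x :≡ i :+ p :+ (j :+ q :+ (k :+ r)) :+ v))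
          (# f Av) (# f Av₁) (# f Av₂) (# f Av₃) (if f y then 1 else 0) (if f u then 1 else 0) (if f u′ then 1 else 0)
          (# f (map leaf₁ qs)) (# f (map leaf₂ qs)) (# f (map leaf₃ qs)) (# f Av′) (#-↭ π f) (#-↭ π₂ f) (#-↭ π₃ f) (eq′ f)

  -- Balancing the cycle against the tree.

  record Pieces (n : ℕ) : Set where
    field
      z     : Fin n
      qs sp : List (Claw n)
      ms    : List (Fin n × Fin n)
      ds R  : List (Fin n)

  module Assemble {n : ℕ} (G : Graph n) (pieces : Pieces n) where

    open Pieces pieces

    #-outer′ : (Fin n → Bool) → ℕ
    #-outer′ f = #-leaves G f qs + (#-leaves G f sp + (# f (map proj₁ ms) + # f (map proj₂ ms) + # f R))

    record Fits : Set where
      field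
        complete : ∀ f → # f (allFin n) ≡ # f (z ∷ []) + (# f (map center qs) + (# f (map center sp) + (# f ds + #-outer′ f)))
        qs-link  : ∀ q → q ∈ qs → IsLink G z q
        sp-claw  : ∀ q → q ∈ sp → IsClaw G q
        ms-adj   : ∀ q → q ∈ ms → adj G (proj₁ q) (proj₂ q) ≡ true
        covered  : ∀ v → 0 < #-outer′ (v ==_) → ∃ λ y → y ∈ z ∷ map center qs × adj G v y ≡ true
        sparse₁  : ∀ v → 0 < #-outer′ (v ==_) → 20 * M G v ds ≤ n
        sparse₂  : ∀ d → d ∈ ds → 40 * #-outer′ (λ u → not (adj G d u)) ≤ n
        sparse-z : 40 * M G z R ≤ n
        enough   : 2 * n + 2 * length qs + 3 ≤ 5 * (1 + length qs + length sp + length ds) + length ms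
        B-upper  : 100 * (1 + length qs + length sp + length ds) ≤ 42 * n
        ds-lower : 38 * n ≤ 100 * length ds
        qs-small : 100 * length qs ≤ n
        sp-small : 100 * length sp ≤ n
        ms-small : 100 * length ms ≤ n
        n-big    : 1000 ≤ n

    module _ (fits : Fits) where

      open Fits fits

      private
        σ j μ δ ρ used : ℕ
        σ = length sp
        j = length ms
        μ = length qs
        δ = length ds
        ρ = length R
        used = σ + j + 2 * μ

        total : n ≡ 1 + 4 * μ + 4 * σ + 2 * j + δ + ρ
        total = trans (sym (trans (#-true (allFin n)) (length-tabulate id))) (trans (complete (λ _ → true)) sizes)
          where
          len : ∀ {A : Set} (g : A → Fin n) xs → # (λ _ → true) (map g xs) ≡ length xs
          len g xs = trans (#-true (map g xs)) (length-map g xs)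
          leaves : ∀ xs → #-leaves G (λ _ → true) xs ≡ length xs + (length xs + length xs)
          leaves xs = cong₂ _+_ (len leaf₁ xs) (cong₂ _+_ (len leaf₂ xs) (len leaf₃ xs))
          sizes : # (λ _ → true) (z ∷ []) + (# (λ _ → true) (map center qs) + (# (λ _ → true) (map center sp) + (# (λ _ → true) ds + #-outer′ (λ _ → true)))) ≡ 1 + 4 * μ + 4 * σ + 2 * j + δ + ρ
          sizes = trans (cong suc (cong₂ _+_ (len center qs) (cong₂ _+_ (len center sp) (cong₂ _+_ (#-true ds) (cong₂ _+_ (leaves qs) (cong₂ _+_ (leaves sp)
              (cong₂ _+_ (cong₂ _+_ (len proj₁ ms) (len proj₂ ms)) (#-true R))))))))
            (linarith 5 (λ m s j d r → goal (con 1 :+ (m :+ (s :+ (d :+ (m :+ (m :+ m) :+ (s :+ (s :+ s) :+ (j :+ j :+ r)))))) :≡ con 1 :+ 4 :* m :+ 4 :* s :+ 2 :* j :+ d :+ r)) μ σ j δ ρ)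

        used≤δ : used ≤ δ
        used≤δ = linarith 5 (λ m s j d n → 38 :* n :≤ 100 :* d :⇒ 100 :* m :≤ n :⇒ 100 :* s :≤ n :⇒ 100 :* j :≤ n :⇒ goal (s :+ j :+ 2 :* m :≤ d)) μ σ j δ n ds-lower qs-small sp-small ms-small

        -- Claws, edges and links already supply `used` segments of the cycle; r₁ single vertices of
        -- R bring their number up to that of the gaps. The other vertices of R become inner
        -- vertices.
        r₁ : ℕ
        r₁ = δ ∸ used

        r₁-eq : r₁ + used ≡ δ
        r₁-eq = m∸n+n≡m used≤δ

        r₁≤ρ : r₁ ≤ ρ
        r₁≤ρ = linarith 7 (λ m s j d n r t → t :+ (s :+ j :+ 2 :* m) :≡ d :⇒ n :≡ con 1 :+ 4 :* m :+ 4 :* s :+ 2 :* j :+ d :+ r :⇒ 100 :* (con 1 :+ m :+ s :+ d) :≤ 42 :* n :⇒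
          100 :* m :≤ n :⇒ 100 :* s :≤ n :⇒ 100 :* j :≤ n :⇒ goal (t :≤ r)) μ σ j δ n ρ r₁ r₁-eq total B-upper qs-small sp-small ms-small

      R₁ F : List (Fin n)
      R₁ = take r₁ R
      F  = drop r₁ R

      length-R₁ : length R₁ ≡ r₁
      length-R₁ = trans (length-take r₁ R) (m≤n⇒m⊓n≡m r₁≤ρ)

      length-F : r₁ + length F ≡ ρ
      length-F = trans (cong (_+ length F) (sym length-R₁)) (trans (sym (length-++ R₁)) (cong length (take++drop≡id r₁ R)))

      #-R : ∀ f → # f R ≡ # f R₁ + # f F
      #-R f = trans (cong (# f) (sym (take++drop≡id r₁ R))) (#-++ f R₁ F)

      private
        need : ℕ
        need = σ + j + μ + 2 * length F

        -- The source of the balance inequality: with |F| expressed through n by `total`, two leaves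
        -- for every vertex of `F` are available exactly when `enough` holds.
        need≤δ : need ≤ δ
        need≤δ = linarith 8 (λ m s j d n r t f → t :+ (s :+ j :+ 2 :* m) :≡ d :⇒ n :≡ con 1 :+ 4 :* m :+ 4 :* s :+ 2 :* j :+ d :+ r :⇒ t :+ f :≡ r :⇒
            2 :* n :+ 2 :* m :+ con 3 :≤ 5 :* (con 1 :+ m :+ s :+ d) :+ j :⇒ goal (s :+ j :+ m :+ 2 :* f :≤ d))
          μ σ j δ n ρ r₁ (length F) r₁-eq total length-F enough

      spare : ℕ
      spare = δ ∸ need

      spare-eq : spare + need ≡ δ
      spare-eq = m∸n+n≡m need≤δ

      -- The other side of the balance: three leaves per vertex of `F` use up all of `ds` as long as
      -- B stays below about 3n/7, which `B-upper` guarantees with 42/100 against 0.428.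
      spare≤F : spare ≤ length F
      spare≤F = linarith 9 (λ m s j d n r t f u → t :+ (s :+ j :+ 2 :* m) :≡ d :⇒ n :≡ con 1 :+ 4 :* m :+ 4 :* s :+ 2 :* j :+ d :+ r :⇒ t :+ f :≡ r :⇒
            u :+ (s :+ j :+ m :+ 2 :* f) :≡ d :⇒ 100 :* (con 1 :+ m :+ s :+ d) :≤ 42 :* n :⇒ 100 :* m :≤ n :⇒ 100 :* s :≤ n :⇒ 100 :* j :≤ n :⇒ con 1000 :≤ n :⇒ goal (u :≤ f))
          μ σ j δ n ρ r₁ (length F) spare r₁-eq total length-F spare-eq B-upper qs-small sp-small ms-small n-big

      plan : Plan n
      plan = record { z = z ; zt = qs ; sp = sp ; ms = ms ; ds = ds ; R₁ = R₁ ; F = F ; s = spare }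

      outer groups : List (List (Fin n))
      outer  = Construct.outer G plan
      groups = Construct.groups G plan

      #-outer≡ : ∀ f → # f (concat outer) ≡ #-outer′ f
      #-outer≡ f = trans (#-concat f outer) (linarith 11 (λ ya u u′ p q o x y r f t → t :≡ r :+ f :⇒ goal (
          ya :+ (u :+ (u′ :+ (p :+ (q :+ (o :+ (x :+ (y :+ (r :+ (f :+ con 0))))))))) :≡ ya :+ (u :+ u′) :+ (p :+ (q :+ o) :+ (x :+ y :+ t))))
        (# f (map leaf₁ qs)) (# f (map leaf₂ qs)) (# f (map leaf₃ qs)) (# f (map leaf₁ sp)) (# f (map leaf₂ sp)) (# f (map leaf₃ sp))
        (# f (map proj₁ ms)) (# f (map proj₂ ms)) (# f R₁) (# f F) (# f R) (#-R f))

      outer-positive : ∀ {v} → v ∈ concat outer → 0 < #-outer′ (v ==_)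
      outer-positive {v} m = subst (0 <_) (#-outer≡ (v ==_)) (∈⇒#== (concat outer) m)

      valid : Construct.Valid G plan
      valid = record
        { complete = equinumerous λ f → trans (complete f) (sym (trans (#-concat f groups)
            (cong (λ k → # f (z ∷ []) + (# f (map center qs) + (# f (map center sp) + (# f ds + k)))) (trans (sym (#-concat f outer)) (#-outer≡ f)))))
        ; zt-adj   = qs-link
        ; sp-adj   = sp-claw
        ; ms-adj   = ms-adj
        ; covered  = λ v m → covered v (outer-positive m)
        ; sparse₁  = λ v m → sparse₁ v (outer-positive m)
        ; sparse₂  = λ d m → subst (λ k → 40 * k ≤ n) (sym (#-outer≡ _)) (sparse₂ d m)
        ; large    = linarith 2 (λ n d → 38 :* n :≤ 100 :* d :⇒ goal (n :≤ 3 :* d)) n δ ds-lower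
        ; nonempty = linarith 2 (λ n d → 38 :* n :≤ 100 :* d :⇒ con 1000 :≤ n :⇒ goal (con 3 :≤ d)) n δ ds-lower n-big
        ; root-big = linarith 8 (λ m s j d n r a b → n :≡ con 1 :+ 4 :* m :+ 4 :* s :+ 2 :* j :+ d :+ r :⇒ 100 :* (con 1 :+ m :+ s :+ d) :≤ 42 :* n :⇒
              100 :* m :≤ n :⇒ 100 :* s :≤ n :⇒ 100 :* j :≤ n :⇒ con 1000 :≤ n :⇒ 40 :* b :≤ n :⇒ a :+ b :≡ r :⇒ goal (con 3 :≤ a))
            μ σ j δ n ρ (N G z (R₁ ++ F)) (M G z R) total B-upper qs-small sp-small ms-small n-big sparse-z
            (trans (cong (λ xs → N G z xs + M G z R) (take++drop≡id r₁ R)) (N+M G z R))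
        ; cycle-count = trans (cong (λ k → k + σ + j + 2 * μ) length-R₁)
            (trans (linarith 4 (λ r s j m → goal (r :+ s :+ j :+ 2 :* m :≡ r :+ (s :+ j :+ 2 :* m))) r₁ σ j μ) r₁-eq)
        ; tree-count = spare-eq
        ; s-small  = spare≤F }

      halin : HasSpanningGenHalin G
      halin = Construct.spanning-generalized-Halin G plan valid

  -- Choosing the private neighbours.

  module _ {n : ℕ} (G : Graph n) where

    record Prepared : Set where
      field
        L k         : ℕ
        As Bs Cs Ms : List (Fin n)
        complete    : ∀ f → # f As + # f Bs ≡ # f (allFin n)
        Bs-count    : ∀ f → # f Bs ≡ # f Cs + # f Ms
        sparse-A    : ∀ v → v ∈ As → 20 * M G v Cs ≤ n
        sparse-C    : ∀ d → d ∈ Cs → 40 * M G d As ≤ n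
        claws-M     : ∀ y → y ∈ Ms → n ≤ 40 * N G y As
        b-lower     : 39 * n ≤ 100 * length Bs
        b-upper     : 100 * length Bs ≤ 41 * n
        k-small     : Dominated 100000 k (15 * n)
        Ms-small    : Dominated 100000 (length Ms) (160 * n)
        L-small     : Dominated 100000 L n
        n-big       : 1000 ≤ n
        reduced     : Reduced G As Cs (length Bs) L k

    module Finish (prepared : Prepared) where

      open Prepared prepared
      open Reduced reduced renaming (Av to Av₀; sp to sp₀)

      ∈-count : ∀ {xs ys : List (Fin n)} → (∀ f → # f xs ≤ # f ys) → ∀ {v} → v ∈ xs → v ∈ ys
      ∈-count {xs} {ys} h {v} m = #==⇒∈ ys (≤-trans (∈⇒#== xs m) (h (v ==_)))

      #-true-map : ∀ {A : Set} (g : A → Fin n) xs → # (λ _ → true) (map g xs) ≡ length xs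
      #-true-map g xs = trans (#-true (map g xs)) (length-map g xs)

      length-leaves : ∀ qs → #-leaves G (λ _ → true) qs ≡ 3 * length qs
      length-leaves qs rewrite #-true-map leaf₁ qs | #-true-map leaf₂ qs | #-true-map leaf₃ qs =
        linarith 1 (λ q → goal (q :+ (q :+ q) :≡ 3 :* q)) (length qs)

      Av₀≤rest : ∀ f → # f Av₀ ≤ # f rest
      Av₀≤rest f = ≤-trans (≤-trans (m≤n+m (# f Av₀) _) (m≤n+m _ (#-leaves G f sp₀))) (≤-reflexive (sym (rest-count f)))

      rest≤As : ∀ f → # f rest ≤ # f As
      rest≤As f = ≤-trans (m≤n+m _ _) (≤-reflexive (sym (As-count f)))

      -- The loss consists of k centres, 3k leaves of claws and twice 5k matched vertices.
      Av₀-loss : ∀ f → # f As ≤ # f Av₀ + 14 * k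
      Av₀-loss f = linarith 9 (λ a c r l x y v s k′ → a :≡ c :+ r :⇒ r :≡ l :+ (x :+ y :+ v) :⇒ c :≤ s :⇒ l :≤ 3 :* s :⇒ x :≤ 5 :* k′ :⇒ y :≤ 5 :* k′ :⇒ s :≤ k′ :⇒ goal (a :≤ v :+ 14 :* k′))
        (# f As) (# f (map center sp₀)) (# f rest) (#-leaves G f sp₀) (# f (map proj₁ ms)) (# f (map proj₂ ms)) (# f Av₀) (length sp₀) k
        (As-count f) (rest-count f) (≤-trans (#-≤-length f (map center sp₀)) (≤-reflexive (length-map center sp₀))) (#-leaves-≤ G f sp₀)
        (≤-trans (≤-trans (#-≤-length f (map proj₁ ms)) (≤-reflexive (length-map proj₁ ms))) few-ms)
        (≤-trans (≤-trans (#-≤-length f (map proj₂ ms)) (≤-reflexive (length-map proj₂ ms))) few-ms) few-sp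

      length-sum : length As + length Bs ≡ n
      length-sum = trans (sym (cong₂ _+_ (#-true As) (#-true Bs))) (trans (complete _) (trans (#-true (allFin n)) (length-tabulate id)))

      Ms-claws : ClawsAt G Ms Av₀ (IsClaw G)
      -- Of at least 0.025 n neighbours in `As`, 14 k ≤ 0.0021 n may be lost, and 3 |Ms| ≤ 0.0048 n
      -- are needed.
      Ms-claws = pull-claws G Ms Av₀ λ y m → linarith 5 (λ n k s a v → n :≤ 40 :* a :⇒ a :≤ v :+ 14 :* k :⇒ 100000 :* k :≤ 15 :* n :⇒ 100000 :* s :≤ 160 :* n :⇒ goal (3 :* s :≤ v))
        n k (length Ms) (N G y As) (N G y Av₀) (claws-M y m) (Av₀-loss (adj G y)) (dominates k-small) (dominates Ms-small)

      module _ (qs : List (Claw n)) (Av₁ : List (Fin n)) (qs-Ms : map center qs ≡ Ms) (qs-claw : ∀ q → q ∈ qs → IsClaw G q)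
        (Av₀-count : ∀ f → # f Av₀ ≡ #-leaves G f qs + # f Av₁) where

        Av₁≤rest : ∀ f → # f Av₁ ≤ # f rest
        Av₁≤rest f = ≤-trans (≤-trans (m≤n+m (# f Av₁) _) (≤-reflexive (sym (Av₀-count f)))) (Av₀≤rest f)

        length-qs : length qs ≡ length Ms
        length-qs = trans (sym (length-map center qs)) (cong length qs-Ms)

        z-zt∈Cs : ∀ {v} → v ∈ z ∷ zt → v ∈ Cs
        z-zt∈Cs {v} m = #==⇒∈ Cs (≤-trans (positive m) (≤-trans (m≤m+n _ (# (v ==_) ds))
          (≤-reflexive (trans (+-assoc (# (v ==_) (z ∷ [])) _ _) (sym (Cs-count (v ==_)))))))
          where
          positive : v ∈ z ∷ zt → 0 < # (v ==_) (z ∷ []) + # (v ==_) zt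
          positive m = ≤-trans (∈⇒#== (z ∷ zt) m) (≤-reflexive (#-++ (v ==_) (z ∷ []) zt))

        M-small : ∀ {v} → v ∈ z ∷ zt → ∀ xs → (∀ f → # f xs ≤ # f rest) → 40 * M G v xs ≤ n
        M-small m xs h = ≤-trans (*-monoʳ-≤ 40 (≤-trans (h _) (rest≤As _))) (sparse-C _ (z-zt∈Cs m))

        Av₁-large : length As ≤ length Av₁ + 14 * k + 3 * length Ms
        Av₁-large = linarith 6 (λ a v₀ l v₁ k s → a :≤ v₀ :+ 14 :* k :⇒ v₀ :≡ l :+ v₁ :⇒ l :≤ 3 :* s :⇒ goal (a :≤ v₁ :+ 14 :* k :+ 3 :* s))
          (length As) (length Av₀) (#-leaves G (λ _ → true) qs) (length Av₁) k (length Ms)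
          (subst₂ (λ a b → a ≤ b + 14 * k) (#-true As) (#-true Av₀) (Av₀-loss (λ _ → true)))
          (trans (sym (#-true Av₀)) (trans (Av₀-count _) (cong (#-leaves G (λ _ → true) qs +_) (#-true Av₁))))
          (≤-reflexive (trans (length-leaves qs) (cong (3 *_) length-qs)))

        zt-links : ClawsAt G zt Av₁ (IsLink G z)
        zt-links = pull-links G z zt Av₁ λ w m →
          linarith 10 (λ n a b v k s t l p q → a :+ b :≡ n :⇒ 100 :* b :≤ 41 :* n :⇒ a :≤ v :+ 14 :* k :+ 3 :* s :⇒ t :≤ l :⇒ 100000 :* k :≤ 15 :* n :⇒
              100000 :* s :≤ 160 :* n :⇒ 100000 :* l :≤ n :⇒ 40 :* p :≤ n :⇒ 40 :* q :≤ n :⇒ goal (p :+ q :+ 3 :* t :≤ v))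
            n (length As) (length Bs) (length Av₁) k (length Ms) (length zt) L (M G z Av₁) (M G w Av₁)
            length-sum b-upper Av₁-large few-zt (dominates k-small) (dominates Ms-small) (dominates L-small)
            (M-small (here refl) Av₁ Av₁≤rest) (M-small (there m) Av₁ Av₁≤rest)

        module _ (ls : List (Claw n)) (R : List (Fin n)) (ls-zt : map center ls ≡ zt) (ls-link : ∀ q → q ∈ ls → IsLink G z q)
          (Av₁-count : ∀ f → # f Av₁ ≡ #-leaves G f ls + # f R) where

          -- Vertices moved from A and weakly connected vertices of B are handled alike: on the
          -- cycle between two private neighbours, and in the tree below the third.
          sp : List (Claw n)
          sp = sp₀ ++ qs

          pieces : Pieces n
          pieces = record { z = z ; qs = ls ; sp = sp ; ms = ms ; ds = ds ; R = R }

          length-ls : length ls ≡ length zt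
          length-ls = trans (sym (length-map center ls)) (cong length ls-zt)

          length-sp : length sp ≡ length sp₀ + length Ms
          length-sp = trans (length-++ sp₀) (cong (length sp₀ +_) length-qs)

          #-map-++ : ∀ f (g : Claw n → Fin n) → # f (map g sp) ≡ # f (map g sp₀) + # f (map g qs)
          #-map-++ f g = trans (cong (# f) (map-++ g sp₀ qs)) (#-++ f (map g sp₀) (map g qs))

          leaves-sp : ∀ f → #-leaves G f sp ≡ #-leaves G f sp₀ + #-leaves G f qs
          leaves-sp f rewrite #-map-++ f leaf₁ | #-map-++ f leaf₂ | #-map-++ f leaf₃ =
            linarith 6 (λ a b c d e g → goal (a :+ b :+ (c :+ d :+ (e :+ g)) :≡ a :+ (c :+ e) :+ (b :+ (d :+ g))))
              (# f (map leaf₁ sp₀)) (# f (map leaf₁ qs)) (# f (map leaf₂ sp₀)) (# f (map leaf₂ qs)) (# f (map leaf₃ sp₀)) (# f (map leaf₃ qs))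

          outer-rest : ∀ f → # f rest ≡ Assemble.#-outer′ G pieces f
          outer-rest f rewrite leaves-sp f = linarith 9 (λ r l₀ x y v₀ lq v₁ ll w → r :≡ l₀ :+ (x :+ y :+ v₀) :⇒ v₀ :≡ lq :+ v₁ :⇒ v₁ :≡ ll :+ w :⇒
              goal (r :≡ ll :+ (l₀ :+ lq :+ (x :+ y :+ w))))
            (# f rest) (#-leaves G f sp₀) (# f (map proj₁ ms)) (# f (map proj₂ ms)) (# f Av₀) (#-leaves G f qs) (# f Av₁) (#-leaves G f ls) (# f R)
            (rest-count f) (Av₀-count f) (Av₁-count f)

          complete′ : ∀ f → # f (allFin n) ≡ # f (z ∷ []) + (# f (map center ls) + (# f (map center sp) + (# f ds + Assemble.#-outer′ G pieces f)))
          complete′ f rewrite sym (outer-rest f) | #-map-++ f center | ls-zt | qs-Ms =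
            linarith 10 (λ t a b c₀ r c m z w d → a :+ b :≡ t :⇒ a :≡ c₀ :+ r :⇒ b :≡ c :+ m :⇒ c :≡ z :+ (w :+ d) :⇒ goal (t :≡ z :+ (w :+ (c₀ :+ m :+ (d :+ r)))))
              (# f (allFin n)) (# f As) (# f Bs) (# f (map center sp₀)) (# f rest) (# f Cs) (# f Ms) (# f (z ∷ [])) (# f zt) (# f ds)
              (complete f) (As-count f) (Bs-count f) (Cs-count f)

          rest-member : ∀ {v} → 0 < Assemble.#-outer′ G pieces (v ==_) → v ∈ rest
          rest-member {v} pos = #==⇒∈ rest (subst (0 <_) (sym (outer-rest (v ==_))) pos)

          length-Bs : length Bs ≡ 1 + length zt + length ds + length Ms
          length-Bs = trans (sym (#-true Bs)) (trans (Bs-count _) (cong₂ _+_ (trans (Cs-count _) (cong suc (cong₂ _+_ (#-true zt) (#-true ds)))) (#-true Ms)))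

          ds≤Cs : ∀ f → # f ds ≤ # f Cs
          ds≤Cs f = ≤-trans (≤-trans (m≤n+m (# f ds) (# f zt)) (m≤n+m _ (# f (z ∷ [])))) (≤-reflexive (sym (Cs-count f)))

          finish-with-links : HasSpanningGenHalin G
          finish-with-links = Assemble.halin G pieces record
            { complete = complete′
            ; qs-link = ls-link
            ; sp-claw = λ q m → sp-claw q (∈-++⁻ sp₀ m)
            ; ms-adj = ms-adj
            ; covered = (λ v pos → cover v (rest-member pos))
            ; sparse₁ = (λ v pos → ≤-trans (*-monoʳ-≤ 20 (ds≤Cs _)) (sparse-A v (∈-count rest≤As (rest-member pos))))
            ; sparse₂ = (λ d m → ≤-trans (*-monoʳ-≤ 40 (≤-trans (≤-reflexive (sym (outer-rest _))) (rest≤As _))) (sparse-C d (∈-count ds≤Cs m)))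
            ; sparse-z = (M-small (here refl) R λ f → ≤-trans (≤-trans (m≤n+m (# f R) _) (≤-reflexive (sym (Av₁-count f)))) (Av₁≤rest f))
            ; enough = (linarith 9 (λ n t l s s₀ m b d j → l :≡ t :⇒ s :≡ s₀ :+ m :⇒ b :≡ con 1 :+ t :+ d :+ m :⇒ 2 :* n :+ 2 :* t :+ con 3 :≤ 5 :* (b :+ s₀) :+ j :⇒
                goal (2 :* n :+ 2 :* l :+ con 3 :≤ 5 :* (con 1 :+ l :+ s :+ d) :+ j))
              n (length zt) (length ls) (length sp) (length sp₀) (length Ms) (length Bs) (length ds) (length ms) length-ls length-sp length-Bs enough)
            ; B-upper = (linarith 9 (λ n t l s s₀ m b d k → l :≡ t :⇒ s :≡ s₀ :+ m :⇒ b :≡ con 1 :+ t :+ d :+ m :⇒ 100 :* b :≤ 41 :* n :⇒ s₀ :≤ k :⇒ 100000 :* k :≤ 15 :* n :⇒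
                goal (100 :* (con 1 :+ l :+ s :+ d) :≤ 42 :* n))
              n (length zt) (length ls) (length sp) (length sp₀) (length Ms) (length Bs) (length ds) k length-ls length-sp length-Bs b-upper few-sp (dominates k-small))
            ; ds-lower = (linarith 6 (λ n t m b d l → b :≡ con 1 :+ t :+ d :+ m :⇒ 39 :* n :≤ 100 :* b :⇒ t :≤ l :⇒ 100000 :* l :≤ n :⇒ 100000 :* m :≤ 160 :* n :⇒ con 1000 :≤ n :⇒ goal (38 :* n :≤ 100 :* d))
              n (length zt) (length Ms) (length Bs) (length ds) L length-Bs b-lower few-zt (dominates L-small) (dominates Ms-small) n-big)
            ; qs-small = (linarith 4 (λ n t l m → m :≡ t :⇒ t :≤ l :⇒ 100000 :* l :≤ n :⇒ goal (100 :* m :≤ n)) n (length zt) L (length ls) length-ls few-zt (dominates L-small))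
            ; sp-small = (linarith 5 (λ n s s₀ m k → s :≡ s₀ :+ m :⇒ s₀ :≤ k :⇒ 100000 :* k :≤ 15 :* n :⇒ 100000 :* m :≤ 160 :* n :⇒ goal (100 :* s :≤ n))
              n (length sp) (length sp₀) (length Ms) k length-sp few-sp (dominates k-small) (dominates Ms-small))
            ; ms-small = (linarith 3 (λ n j k → j :≤ 5 :* k :⇒ 100000 :* k :≤ 15 :* n :⇒ goal (100 :* j :≤ n)) n (length ms) k few-ms (dominates k-small))
            ; n-big = n-big }
            where
            sp-claw : ∀ q → q ∈ sp₀ ⊎ q ∈ qs → IsClaw G q
            sp-claw q (inj₁ m) = sp-adj q m
            sp-claw q (inj₂ m) = qs-claw q m
            cover : ∀ v → v ∈ rest → ∃ λ y → y ∈ z ∷ map center ls × adj G v y ≡ true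
            cover v m = subst (λ ws → ∃ λ y → y ∈ z ∷ ws × adj G v y ≡ true) (sym ls-zt) (covered v m)

        finish-with-claws : HasSpanningGenHalin G
        finish-with-claws = let (ls , R , e , ok , eq) = zt-links in finish-with-links ls R e ok eq

      finish : HasSpanningGenHalin G
      finish = let (qs , Av₁ , e , ok , eq) = Ms-claws in finish-with-claws qs Av₁ e ok eq

  -- Cleaning the partition

  record Scaled (c x d y : ℕ) : Set where
    constructor scaled
    field scales : c * x ≤ d * y
  open Scaled public

  -- Here 299995/500000 = 3/5 - 1/100000 and 199990/500000 = 2/5 - 2/100000, the bounds of the
  -- theorem for α = β = 1/100000.
  module Clean {n : ℕ} (G : Graph n) (V₁ : VSet n) (L : ℕ)
    (degree   : ∀ v → 2 * n + 3 ≤ 5 * N G v (allFin n))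
    (A-large  : Scaled 299995 n 500000 (length (filterᵇ V₁ (allFin n))))
    (B-degree : ∀ v → V₁ v ≡ true → Scaled 199990 n 500000 (N G v (filterᵇ (not ∘ V₁) (allFin n))))
    (2≤L      : 2 ≤ L)
    (n<2^L    : n < 2 ^ L)
    (n-large  : Dominated 1000000 (L * L) n)
    where

    Part₁ Part₂ Bad As Bs Cs Ms : List (Fin n)
    Part₁ = filterᵇ V₁ (allFin n)
    Part₂ = filterᵇ (not ∘ V₁) (allFin n)

    -- With fewer than n/40 neighbours in V₁, nearly all of the at least 2n/5 neighbours lie in the
    -- other part, so such a vertex behaves like one of V₁.
    bad : Fin n → Bool
    bad w = 40 * N G w Part₁ <ᵇ n

    Bad = filterᵇ bad Part₂
    Bs  = filterᵇ (not ∘ bad) Part₂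
    As  = Part₁ ++ Bad

    core : Fin n → Bool
    core y = 40 * M G y As ≤ᵇ n

    Cs = filterᵇ core Bs
    Ms = filterᵇ (not ∘ core) Bs

    A-size : Scaled 299995 n 500000 (length Part₁)
    A-size = A-large

    A-degree : ∀ v → v ∈ Part₁ → Scaled 199990 n 500000 (N G v Part₂)
    A-degree v m = B-degree v (proj₂ (∈-filterᵇ⁻ V₁ (allFin n) m))

    B-count : ∀ f → # f Bad + # f Bs ≡ # f Part₂
    B-count f = #-split f bad Part₂

    complete : ∀ f → # f As + # f Bs ≡ # f (allFin n)
    complete f = trans (linarith 5 (λ s a d b t → s :≡ a :+ d :⇒ d :+ b :≡ t :⇒ goal (s :+ b :≡ a :+ t))
      (# f As) (# f Part₁) (# f Bad) (# f Bs) (# f Part₂) (#-++ f Part₁ Bad) (B-count f)) (#-split f V₁ (allFin n))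

    Bs-count : ∀ f → # f Bs ≡ # f Cs + # f Ms
    Bs-count f = sym (#-split f core Bs)

    counts-length : ∀ (xs ys zs : List (Fin n)) → (∀ f → # f xs + # f ys ≡ # f zs) → length xs + length ys ≡ length zs
    counts-length xs ys zs h = trans (sym (cong₂ _+_ (#-true xs) (#-true ys))) (trans (h _) (#-true zs))

    length-AB : length Part₁ + length Part₂ ≡ n
    length-AB = trans (counts-length Part₁ Part₂ (allFin n) (λ f → #-split f V₁ (allFin n))) (length-tabulate id)

    length-B : length Bad + length Bs ≡ length Part₂
    length-B = counts-length Bad Bs Part₂ B-count

    length-As : length As ≡ length Part₁ + length Bad
    length-As = length-++ Part₁

    L-small : 100000 * L ≤ n
    L-small = linarith 3 (λ n l s → 1000000 :* s :≤ n :⇒ 2 :* l :≤ s :⇒ goal (100000 :* l :≤ n)) n L (L * L) (dominates n-large) (*-monoˡ-≤ L 2≤L)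

    n-big : 200000 ≤ n
    n-big = linarith 2 (λ n l → 100000 :* l :≤ n :⇒ con 2 :≤ l :⇒ goal (con 200000 :≤ n)) n L L-small 2≤L

    -- V₁ is so large that the other part has at most (2/5 + 1/100000) n vertices, and v sees (2/5 -
    -- 2/100000) n of them.
    A-misses : ∀ v → v ∈ Part₁ → 100000 * M G v Part₂ ≤ 3 * n
    A-misses v m = linarith 5 (λ n a b p q → 299995 :* n :≤ 500000 :* a :⇒ 199990 :* n :≤ 500000 :* p :⇒ a :+ b :≡ n :⇒ p :+ q :≡ b :⇒ goal (100000 :* q :≤ 3 :* n))
      n (length Part₁) (length Part₂) (N G v Part₂) (M G v Part₂) (scales A-size) (scales (A-degree v m)) length-AB (N+M G v Part₂)

    bad-degree : ∀ w → w ∈ Bad → 40 * N G w Part₁ < n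
    bad-degree w m = <ᵇ⇒< _ _ (subst T (sym (proj₂ (∈-filterᵇ⁻ bad Part₂ m))) tt)

    Σ-A : ∀ xs → (∀ f → # f xs ≤ # f Part₂) → 100000 * Σ# (λ v → M G v xs) Part₁ ≤ 3 * (n * n)
    Σ-A xs h = begin
      100000 * Σ# (λ v → M G v xs) Part₁ ≤⟨ Σ#-upper 100000 (3 * n) (λ v → M G v xs) Part₁ (λ v m → ≤-trans (*-monoʳ-≤ 100000 {M G v xs} {M G v Part₂} (h _)) (A-misses v m)) ⟩
      length Part₁ * (3 * n)             ≤⟨ *-monoˡ-≤ (3 * n) (≤-trans (m≤m+n (length Part₁) (length Part₂)) (≤-reflexive length-AB)) ⟩
      n * (3 * n)                    ≡⟨ regroup 3 n ⟩
      3 * (n * n)                    ∎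
      where
      open ≤-Reasoning
      regroup : ∀ c n → n * (c * n) ≡ c * (n * n)
      regroup = solve-∀

    -- Each bad vertex misses at least a quarter of V, while V₁ misses few vertices of Part₂ in total.
    Bad-small-product : 100000 * (length Bad * n) ≤ 12 * (n * n)
    Bad-small-product = linarith 3 (λ x s z → x :≤ 4 :* s :⇒ 100000 :* s :≤ 3 :* z :⇒ goal (100000 :* x :≤ 12 :* z))
      (length Bad * n) (Σ# (λ v → M G v Bad) Part₁) (n * n)
      (≤-trans (Σ#-lower 4 n (λ w → M G w Part₁) Bad λ w m →
          linarith 4 (λ n a p q → 299995 :* n :≤ 500000 :* a :⇒ 40 :* p :< n :⇒ p :+ q :≡ a :⇒ goal (n :≤ 4 :* q))
            n (length Part₁) (N G w Part₁) (M G w Part₁) (scales A-size) (bad-degree w m) (N+M G w Part₁))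
        (≤-reflexive (cong (4 *_) (Σ-M-swap G Bad Part₁))))
      (Σ-A Bad λ f → ≤-trans (m≤m+n _ _) (≤-reflexive (B-count f)))

    cancel-n : ∀ c d x → c * (x * n) ≤ d * (n * n) → c * x ≤ d * n
    cancel-n c d x h = *-cancelʳ-≤ (c * x) (d * n) n {{>-nonZero (≤-trans (s≤s z≤n) n-big)}}
      (≤-trans (≤-reflexive (*-assoc c x n)) (≤-trans h (≤-reflexive (sym (*-assoc d n n)))))

    Bad-small : 100000 * length Bad ≤ 12 * n
    Bad-small = cancel-n 100000 12 (length Bad) Bad-small-product

    Bs≤B : ∀ f → # f Bs ≤ # f Part₂
    Bs≤B f = ≤-trans (m≤n+m _ (# f Bad)) (≤-reflexive (B-count f))

    -- Of its 2n/5 neighbours, v has fewer than n/40 in V₁ and hardly any in the small list `Bad`;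
    -- the others lie in `Bs`, whose size is at most about 2n/5.
    sparse-Bad : ∀ v → v ∈ Bad → 20 * M G v Bs ≤ n
    sparse-Bad v m = linarith 11 (λ n a b p d q c s x y t → 299995 :* n :≤ 500000 :* a :⇒ a :+ b :≡ n :⇒ 2 :* n :+ con 3 :≤ 5 :* t :⇒ p :+ c :≡ t :⇒ d :+ q :≡ c :⇒
        40 :* p :< n :⇒ d :≤ x :⇒ 100000 :* x :≤ 12 :* n :⇒ q :+ y :≡ s :⇒ x :+ s :≡ b :⇒ goal (20 :* y :≤ n))
      n (length Part₁) (length Part₂) (N G v Part₁) (N G v Bad) (N G v Bs) (N G v Part₂) (length Bs) (length Bad) (M G v Bs) (N G v (allFin n))
      (scales A-size) length-AB (degree v) (#-split (adj G v) V₁ (allFin n)) (B-count (adj G v)) (bad-degree v m) (#-≤-length (adj G v) Bad) Bad-small (N+M G v Bs) length-B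

    sparse-As : ∀ v → v ∈ As → 20 * M G v Bs ≤ n
    sparse-As v m = by-cases (∈-++⁻ Part₁ m)
      where
      by-cases : v ∈ Part₁ ⊎ v ∈ Bad → 20 * M G v Bs ≤ n
      by-cases (inj₂ k) = sparse-Bad v k
      by-cases (inj₁ k) = ≤-trans (*-monoʳ-≤ 20 {M G v Bs} {M G v Part₂} (Bs≤B _)) (linarith 2 (λ n t → 100000 :* t :≤ 3 :* n :⇒ goal (20 :* t :≤ n)) n (M G v Part₂) (A-misses v k))

    not-true : ∀ {b} → not b ≡ true → b ≡ false
    not-true {false} _ = refl

    claws-Bs : ∀ y → y ∈ Bs → n ≤ 40 * N G y As
    claws-Bs y m = ≤-trans (≮⇒≥ λ lt → subst T (not-true (proj₂ (∈-filterᵇ⁻ (not ∘ bad) Part₂ m))) (<⇒<ᵇ lt))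
      (*-monoʳ-≤ 40 (≤-trans (m≤m+n (N G y Part₁) (N G y Bad)) (≤-reflexive (sym (#-++ (adj G y) Part₁ Bad)))))

    sparse-Cs : ∀ d → d ∈ Cs → 40 * M G d As ≤ n
    sparse-Cs d m = ≤ᵇ⇒≤ _ _ (subst T (sym (proj₂ (∈-filterᵇ⁻ core Bs m))) tt)

    -- Each vertex of `Ms` misses more than n/40 of `As`. In units of n²/100000, V₁ contributes at
    -- most 3 to these misses and `Bad` at most 12/20, and 40 · 3.6 = 144 ≤ 160.
    Ms-small : 100000 * length Ms ≤ 160 * n
    Ms-small = cancel-n 100000 160 (length Ms) (linarith 6 (λ x s s₁ s₂ z b → x :≤ 40 :* s :⇒ s :≡ s₁ :+ s₂ :⇒ 100000 :* s₁ :≤ 3 :* z :⇒ 20 :* s₂ :≤ b :⇒ 100000 :* b :≤ 12 :* z :⇒ goal (100000 :* x :≤ 160 :* z))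
        (length Ms * n) (Σ# (λ v → M G v Ms) As) (Σ# (λ v → M G v Ms) Part₁) (Σ# (λ v → M G v Ms) Bad) (n * n) (length Bad * n)
        (≤-trans (Σ#-lower 40 n (λ y → M G y As) Ms λ y m → <⇒≤ (≰⇒> λ le → subst T (not-true (proj₂ (∈-filterᵇ⁻ (not ∘ core) Bs m))) (≤⇒≤ᵇ le)))
          (≤-reflexive (cong (40 *_) (Σ-M-swap G Ms As))))
        (Σ#-++ (λ v → M G v Ms) Part₁ Bad)
        (Σ-A Ms λ f → ≤-trans (Ms≤Bs f) (Bs≤B f))
        (Σ#-upper 20 n (λ v → M G v Ms) Bad λ v m → ≤-trans (*-monoʳ-≤ 20 {M G v Ms} {M G v Bs} (Ms≤Bs _)) (sparse-Bad v m))
        Bad-small-product)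
      where
      Ms≤Bs : ∀ f → # f Ms ≤ # f Bs
      Ms≤Bs f = ≤-trans (m≤n+m _ (# f Cs)) (≤-reflexive (sym (Bs-count f)))

    Cs≤Bs : ∀ f → # f Cs ≤ # f Bs
    Cs≤Bs f = ≤-trans (m≤m+n _ (# f Ms)) (≤-reflexive (sym (Bs-count f)))

    A-member : ∃ λ v → v ∈ Part₁
    A-member = nonempty Part₁ (linarith 2 (λ n a → 299995 :* n :≤ 500000 :* a :⇒ con 200000 :≤ n :⇒ goal (con 1 :≤ a)) n (length Part₁) (scales A-size) n-big)
      where
      nonempty : ∀ (xs : List (Fin n)) → 0 < length xs → ∃ λ v → v ∈ xs
      nonempty (x ∷ _) _ = x , here refl

    B-lower : 199990 * n ≤ 500000 * length Part₂
    B-lower = ≤-trans (scales (A-degree v (proj₂ A-member))) (*-monoʳ-≤ 500000 {N G v Part₂} {length Part₂} (#-≤-length (adj G v) Part₂))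
      where v = proj₁ A-member

    -- The division rounds up: `target` is the least t with 2n + 2L + 3 ≤ 5t. By truncated
    -- subtraction k is 0 when `Bs` already has that size.
    target k : ℕ
    target = (2 * n + 2 * L + 7) / 5
    k = target ∸ length Bs

    target-division : 2 * n + 2 * L + 7 ≡ (2 * n + 2 * L + 7) % 5 + 5 * target
    target-division = trans (m≡m%n+[m/n]*n (2 * n + 2 * L + 7) 5) (cong ((2 * n + 2 * L + 7) % 5 +_) (*-comm target 5))

    target-upper : 5 * target ≤ 2 * n + 2 * L + 7
    target-upper = ≤-trans (m≤n+m (5 * target) ((2 * n + 2 * L + 7) % 5)) (≤-reflexive (sym target-division))

    target-lower : 2 * n + 2 * L + 3 ≤ 5 * target
    target-lower = linarith 4 (λ n l r t → 2 :* n :+ 2 :* l :+ con 7 :≡ r :+ 5 :* t :⇒ r :< con 5 :⇒ goal (2 :* n :+ 2 :* l :+ con 3 :≤ 5 :* t))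
      n L ((2 * n + 2 * L + 7) % 5) target target-division (m%n<n (2 * n + 2 * L + 7) 5)

    k-minimal : 0 < k → length Bs + k ≤ target
    k-minimal pos = ≤-reflexive (m+[n∸m]≡n {length Bs} {target} (<⇒≤ (m∸n≢0⇒n<m {target} {length Bs} λ e → <-irrefl (sym e) pos)))

    -- In units of n/100000, `Part₂` falls short of 2n/5 by at most 2 and `Bad` takes away at most
    -- 12; the last unit absorbs the terms with L.
    k-small : 100000 * k ≤ 15 * n
    k-small = by-cases (0 <? k)
      where
      by-cases : Dec (0 < k) → 100000 * k ≤ 15 * n
      by-cases (yes pos) = linarith 7 (λ n l s t k x b → 199990 :* n :≤ 500000 :* b :⇒ x :+ s :≡ b :⇒ 100000 :* x :≤ 12 :* n :⇒ s :+ k :≤ t :⇒ 5 :* t :≤ 2 :* n :+ 2 :* l :+ con 7 :⇒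
          con 2 :≤ l :⇒ 1000000 :* l :≤ n :⇒ goal (100000 :* k :≤ 15 :* n))
        n L (length Bs) target k (length Bad) (length Part₂) B-lower length-B Bad-small (k-minimal pos) target-upper 2≤L
        (linarith 3 (λ n l s → 1000000 :* s :≤ n :⇒ 2 :* l :≤ s :⇒ goal (1000000 :* l :≤ n)) n L (L * L) (dominates n-large) (*-monoˡ-≤ L 2≤L))
      by-cases (no  k≯0) = subst (λ k → 100000 * k ≤ 15 * n) (sym (n≤0⇒n≡0 (≮⇒≥ k≯0))) (≤-trans (≤-reflexive (*-zeroʳ 100000)) z≤n)

    length-Bs : length Bs ≡ length Cs + length Ms
    length-Bs = sym (counts-length Cs Ms Bs λ f → sym (Bs-count f))

    Bs-lower : 39 * n ≤ 100 * length Bs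
    Bs-lower = linarith 4 (λ n b x s → 199990 :* n :≤ 500000 :* b :⇒ x :+ s :≡ b :⇒ 100000 :* x :≤ 12 :* n :⇒ goal (39 :* n :≤ 100 :* s))
      n (length Part₂) (length Bad) (length Bs) B-lower length-B Bad-small

    Bs-upper : 100 * length Bs ≤ 41 * n
    Bs-upper = linarith 5 (λ n a b x s → 299995 :* n :≤ 500000 :* a :⇒ a :+ b :≡ n :⇒ x :+ s :≡ b :⇒ goal (100 :* s :≤ 41 :* n))
      n (length Part₁) (length Part₂) (length Bad) (length Bs) (scales A-size) length-AB length-B

    clean : HasSpanningGenHalin G
    clean = Finish.finish G record
      { L = L ; k = k ; As = As ; Bs = Bs ; Cs = Cs ; Ms = Ms ; complete = complete ; Bs-count = Bs-count
      ; sparse-A = sparse ; sparse-C = sparse-Cs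
      ; claws-M = λ y m → claws-Bs y (proj₁ (∈-filterᵇ⁻ (not ∘ core) Bs m))
      ; b-lower = Bs-lower ; b-upper = Bs-upper ; k-small = dominated k-small ; Ms-small = dominated Ms-small ; L-small = dominated L-small
      ; n-big = ≤-trans (≤ᵇ⇒≤ 1000 200000 tt) n-big
      ; reduced = reduce G L target Cs degree
          (linarith 4 (λ n s c m → 39 :* n :≤ 100 :* s :⇒ s :≡ c :+ m :⇒ 100000 :* m :≤ 160 :* n :⇒ goal (n :≤ 3 :* c)) n (length Bs) (length Cs) (length Ms) Bs-lower length-Bs Ms-small)
          2≤L n<2^L n-large target-upper target-lower k As Bs complete Cs≤Bs sparse
          (linarith 5 (λ n k s a x → 299995 :* n :≤ 500000 :* a :⇒ s :≡ a :+ x :⇒ 100000 :* k :≤ 15 :* n :⇒ goal (n :+ 2 :* k :≤ 2 :* s))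
            n k (length As) (length Part₁) (length Bad) (scales A-size) length-As k-small)
          (m≤n+m∸n target (length Bs)) k-minimal
          (dominated (linarith 2 (λ n k → 100000 :* k :≤ 15 :* n :⇒ goal (1000 :* k :≤ n)) n k k-small)) }
      where
      sparse : ∀ v → v ∈ As → 20 * M G v Cs ≤ n
      sparse v m = ≤-trans (*-monoʳ-≤ 20 {M G v Cs} {M G v Bs} (Cs≤Bs _)) (sparse-As v m)

  -- The size of n and rational inequalities

  2^-window : ∀ n → ∃ λ l → 2 ^ l ≤ suc n × suc n < 2 ^ suc l
  2^-window zero = 0 , s≤s z≤n , s≤s (s≤s z≤n)
  2^-window (suc n) with 2^-window n
  ... | l , lower , upper with suc (suc n) <? 2 ^ suc l
  ...   | yes lt = l , ≤-trans lower (n≤1+n _) , lt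
  ...   | no  ge = suc l , ≮⇒≥ ge , ≤-trans (s≤s upper) (m<m*2 (2 ^ suc l) (≤-trans (s≤s z≤n) upper))
    where
    m<m*2 : ∀ m → 0 < m → m < 2 * m
    m<m*2 m pos = linarith 1 (λ m → con 1 :≤ m :⇒ goal (m :< 2 :* m)) m pos

  -- From y = 3 on, (y + 1)² ≤ 2 y², so powers of two stay ahead of the squares once they are.
  square≤2^ : ∀ c k x i → 3 ≤ x → c * (x * x) ≤ 2 ^ k → c * ((i + x) * (i + x)) ≤ 2 ^ (i + k)
  square≤2^ c k x zero    3≤x h = h
  square≤2^ c k x (suc i) 3≤x h = ≤-trans (≤-trans (*-monoʳ-≤ c (double (i + x) (≤-trans 3≤x (m≤n+m x i)))) (≤-reflexive (comm c ((i + x) * (i + x)))))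
    (*-monoʳ-≤ 2 (square≤2^ c k x i 3≤x h))
    where
    comm : ∀ c y → c * (2 * y) ≡ 2 * (c * y)
    comm = solve-∀
    expand : ∀ y → suc y * suc y ≡ y * y + 2 * y + 1
    expand = solve-∀
    double : ∀ y → 3 ≤ y → suc y * suc y ≤ 2 * (y * y)
    double y 3≤y = linarith 3 (λ y s t → t :≡ s :+ 2 :* y :+ con 1 :⇒ 3 :* y :≤ s :⇒ con 3 :≤ y :⇒ goal (t :≤ 2 :* s)) y (y * y) (suc y * suc y)
      (expand y) (*-monoˡ-≤ y 3≤y) 3≤y

  exponent-bound : ∀ k n l → 2 ^ k ≤ n → n < 2 ^ suc l → k ≤ l
  exponent-bound k n l lower upper = ≮⇒≥ λ l<k → <⇒≱ upper (≤-trans (^-monoʳ-≤ 2 l<k) lower)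

  binary-length : ∀ c k n → 1 ≤ k → 3 ≤ suc k → c * (suc k * suc k) ≤ 2 ^ k → 2 ^ k ≤ n → ∃ λ L → 2 ≤ L × n < 2 ^ L × Dominated c (L * L) n
  binary-length c k zero    _   _   _    h = ⊥-elim (<⇒≱ (m^n>0 2 k) h)
  binary-length c k (suc n) 1≤k 3≤k base h = build (2^-window n)
    where
    build : (∃ λ l → 2 ^ l ≤ suc n × suc n < 2 ^ suc l) → ∃ λ L → 2 ≤ L × suc n < 2 ^ L × Dominated c (L * L) (suc n)
    build (l , lower , upper) = suc l , s≤s (≤-trans 1≤k k≤l) , upper
      , dominated (≤-trans (subst₂ (λ a b → c * (a * a) ≤ 2 ^ b) (trans (+-suc (l ∸ k) k) (cong suc (m∸n+n≡m k≤l))) (m∸n+n≡m k≤l)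
          (square≤2^ c k (suc k) (l ∸ k) 3≤k base)) lower)
      where
      k≤l : k ≤ l
      k≤l = exponent-bound k (suc n) l h upper

  -- Chosen so that 1000000 · 41² ≤ 2^40, the start of the induction that bounds 1000000 L² by n.
  threshold : ℕ
  threshold = 2 ^ 40

  binary-length-40 : ∀ n → threshold ≤ n → ∃ λ L → 2 ≤ L × n < 2 ^ L × Dominated 1000000 (L * L) n
  binary-length-40 n = binary-length 1000000 40 n (≤ᵇ⇒≤ 1 40 tt) (≤ᵇ⇒≤ 3 41 tt) (≤ᵇ⇒≤ (1000000 * (41 * 41)) (2 ^ 40) tt)

  module Fractions where

    open import Data.Integer as ℤ using (+_)
    import Data.Integer.Properties as ℤ
    open import Data.Rational as ℚ using (ℚ)
    import Data.Rational.Properties as ℚ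
    open import Data.Rational.Unnormalised as ℚᵘ using (ℚᵘ; mkℚᵘ)
    import Data.Rational.Unnormalised.Properties as ℚᵘ

    -- Rationals in lowest terms do not compute for variable numerators. Unnormalised ones do, and
    -- there an inequality is one between cross products.
    ≃-fraction : ∀ p q → ℚ.toℚᵘ (+ p ℚ./ suc q) ℚᵘ.≃ mkℚᵘ (+ p) q
    ≃-fraction p q = ℚ.toℚᵘ-fromℚᵘ (mkℚᵘ (+ p) q)

    ≃-product : ∀ p q n → ℚ.toℚᵘ ((+ p ℚ./ suc q) ℚ.* ℕtoℚ n) ℚᵘ.≃ mkℚᵘ (+ p) q ℚᵘ.* mkℚᵘ (+ n) 0
    ≃-product p q n = ℚᵘ.≃-trans (ℚ.toℚᵘ-homo-* (+ p ℚ./ suc q) (ℕtoℚ n)) (ℚᵘ.*-cong (≃-fraction p q) (≃-fraction n 0))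

    fraction-≤ : ∀ m q d → (+ m) ℚ./ suc q ℚ.≤ ℕtoℚ d → m ≤ suc q * d
    fraction-≤ m q d h = subst₂ _≤_ (*-identityʳ m) (*-comm d (suc q)) (ℤ.drop‿+≤+ (subst₂ ℤ._≤_ (sym (ℤ.pos-* m 1)) (sym (ℤ.pos-* d (suc q)))
      (ℚᵘ.drop-*≤* (ℚᵘ.≤-respˡ-≃ (≃-fraction m q) (ℚᵘ.≤-respʳ-≃ (≃-fraction d 0) (ℚ.toℚᵘ-mono-≤ h))))))

    multiple-≤ : ∀ p q n a → (+ p ℚ./ suc q) ℚ.* ℕtoℚ n ℚ.≤ ℕtoℚ a → p * n ≤ suc q * a
    multiple-≤ p q n a h = subst₂ _≤_ (*-identityʳ (p * n)) (trans (cong (λ q → a * suc q) (*-identityʳ q)) (*-comm a (suc q)))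
      (ℤ.drop‿+≤+ (subst₂ ℤ._≤_ (trans (cong (ℤ._* (+ 1)) (sym (ℤ.pos-* p n))) (sym (ℤ.pos-* (p * n) 1))) (sym (ℤ.pos-* a (suc (q * 1))))
        (ℚᵘ.drop-*≤* (ℚᵘ.≤-respˡ-≃ (≃-product p q n) (ℚᵘ.≤-respʳ-≃ (≃-fraction a 0) (ℚ.toℚᵘ-mono-≤ h))))))

    fraction-≤-sum : ∀ m q d p r n → (+ m) ℚ./ suc q ℚ.≤ ℕtoℚ d ℚ.+ (+ p ℚ./ suc r) ℚ.* ℕtoℚ n → suc r * m ≤ suc q * (suc r * d + p * n)
    fraction-≤-sum m q d p r n h = subst₂ _≤_ lhs rhs (ℤ.drop‿+≤+ (subst₂ ℤ._≤_ (sym (ℤ.pos-* m (1 * suc (r * 1)))) numerator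
        (ℚᵘ.drop-*≤* (ℚᵘ.≤-respˡ-≃ (≃-fraction m q) (ℚᵘ.≤-respʳ-≃ sum≃ (ℚ.toℚᵘ-mono-≤ h))))))
      where
      sum≃ : ℚ.toℚᵘ (ℕtoℚ d ℚ.+ (+ p ℚ./ suc r) ℚ.* ℕtoℚ n) ℚᵘ.≃ mkℚᵘ (+ d) 0 ℚᵘ.+ mkℚᵘ (+ p) r ℚᵘ.* mkℚᵘ (+ n) 0
      sum≃ = ℚᵘ.≃-trans (ℚ.toℚᵘ-homo-+ (ℕtoℚ d) ((+ p ℚ./ suc r) ℚ.* ℕtoℚ n)) (ℚᵘ.+-cong (≃-fraction d 0) (≃-product p r n))
      numerator : (+ d ℤ.* + suc (r * 1) ℤ.+ (+ p ℤ.* + n) ℤ.* + 1) ℤ.* + suc q ≡ + ((d * suc (r * 1) + p * n * 1) * suc q)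
      numerator = trans (cong (ℤ._* + suc q) (trans (cong₂ ℤ._+_ (sym (ℤ.pos-* d (suc (r * 1)))) (trans (cong (ℤ._* + 1) (sym (ℤ.pos-* p n))) (sym (ℤ.pos-* (p * n) 1))))
        (sym (ℤ.pos-+ (d * suc (r * 1)) (p * n * 1))))) (sym (ℤ.pos-* (d * suc (r * 1) + p * n * 1) (suc q)))
      lhs : m * (1 * suc (r * 1)) ≡ suc r * m
      lhs = trans (cong (m *_) (trans (*-identityˡ _) (cong suc (*-identityʳ r)))) (*-comm m (suc r))
      rhs : (d * suc (r * 1) + p * n * 1) * suc q ≡ suc q * (suc r * d + p * n)
      rhs = trans (*-comm _ (suc q)) (cong (suc q *_) (cong₂ _+_ (trans (cong (λ r → d * suc r) (*-identityʳ r)) (*-comm d (suc r))) (*-identityʳ (p * n))))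

    nonNeg : ∀ n → ℚ.NonNegative (ℕtoℚ n)
    nonNeg n = ℚ.normalize-nonNeg n 1

    part-size : ∀ α n a → α ℚ.≤ (+ 1) ℚ./ 100000 → ((+ 3) ℚ./ 5 ℚ.- α) ℚ.* ℕtoℚ n ℚ.< ℕtoℚ a → Scaled 299995 n 500000 a
    part-size α n a α≤ h = scaled (linarith 2 (λ n a → 59999 :* n :≤ 100000 :* a :⇒ goal (299995 :* n :≤ 500000 :* a)) n a (multiple-≤ 59999 99999 n a
      (ℚ.≤-trans (ℚ.*-monoʳ-≤-nonNeg (ℕtoℚ n) {{nonNeg n}} (ℚ.+-monoʳ-≤ ((+ 3) ℚ./ 5) (ℚ.neg-antimono-≤ α≤))) (ℚ.<⇒≤ h))))

    part-degree : ∀ β n d → β ℚ.≤ (+ 1) ℚ./ 100000 → (+ (2 * n + 3)) ℚ./ 5 ℚ.- (+ 2) ℚ./ 1 ℚ.* β ℚ.* ℕtoℚ n ℚ.≤ ℕtoℚ d →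
      Scaled 199990 n 500000 d
    -- The subtracted term 2 β n is first moved to the right and bounded by n/50000, so that no
    -- negative numbers occur among the integers.
    part-degree β n d β≤ h = scaled (linarith 2 (λ n d → 50000 :* (2 :* n :+ con 3) :≤ 5 :* (50000 :* d :+ 1 :* n) :⇒ goal (199990 :* n :≤ 500000 :* d)) n d
      (fraction-≤-sum (2 * n + 3) 4 d 1 49999 n
      (ℚ.≤-trans (ℚ.≤-reflexive restore) (ℚ.≤-trans (ℚ.+-monoˡ-≤ y h)
        (ℚ.+-monoʳ-≤ (ℕtoℚ d) (ℚ.*-monoʳ-≤-nonNeg (ℕtoℚ n) {{nonNeg n}} twice-β))))))
      where
      x y : ℚ
      x = (+ (2 * n + 3)) ℚ./ 5
      y = (+ 2) ℚ./ 1 ℚ.* β ℚ.* ℕtoℚ n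
      twice : (+ 2) ℚ./ 1 ℚ.* ((+ 1) ℚ./ 100000) ≡ (+ 1) ℚ./ 50000
      twice = refl
      twice-β : (+ 2) ℚ./ 1 ℚ.* β ℚ.≤ (+ 1) ℚ./ 50000
      twice-β = ℚ.≤-trans (ℚ.*-monoˡ-≤-nonNeg ((+ 2) ℚ./ 1) {{nonNeg 2}} β≤) (ℚ.≤-reflexive twice)
      restore : x ≡ (x ℚ.- y) ℚ.+ y
      restore = trans (sym (ℚ.+-identityʳ x)) (trans (cong (x ℚ.+_) (sym (ℚ.+-inverseˡ y))) (sym (ℚ.+-assoc x (ℚ.- y) y)))

  module _ where

    open Fractions using (fraction-≤; part-size; part-degree)
    open import Data.Integer using (+_)
    open import Data.Rational as ℚ using (ℚ)

    spanning-Halin-of-dense-partition : ∀ α β → α ℚ.≤ (+ 1) ℚ./ 100000 → β ℚ.≤ (+ 1) ℚ./ 100000 →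
      ∀ n → threshold ≤ n → ∀ (G : Graph n) → (∀ v → (+ (2 * n + 3)) ℚ./ 5 ℚ.≤ ℕtoℚ (deg G v)) → ∀ (V₁ : VSet n) →
      ((+ 3) ℚ./ 5 ℚ.- α) ℚ.* ℕtoℚ n ℚ.< ℕtoℚ (card V₁) →
      (∀ v → V₁ v ≡ true → (+ (2 * n + 3)) ℚ./ 5 ℚ.- (+ 2) ℚ./ 1 ℚ.* β ℚ.* ℕtoℚ n ℚ.≤ ℕtoℚ (degIn G v (compl V₁))) →
      HasSpanningGenHalin G
    spanning-Halin-of-dense-partition α β α≤ β≤ n n₀≤n G degree V₁ size degree₂ = conclude (binary-length-40 n n₀≤n)
      where
      deg-N : ∀ v → deg G v ≡ N G v (allFin n)
      deg-N v = #-cong _ _ (allFin n) λ u → if-true (adj G v u)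
        where
        if-true : ∀ b → (if b then true else false) ≡ b
        if-true true  = refl
        if-true false = refl
      degree′ : ∀ v → 2 * n + 3 ≤ 5 * N G v (allFin n)
      degree′ v = subst (λ d → 2 * n + 3 ≤ 5 * d) (deg-N v) (fraction-≤ (2 * n + 3) 4 (deg G v) (degree v))
      A-large : Scaled 299995 n 500000 (length (filterᵇ V₁ (allFin n)))
      A-large = subst (Scaled 299995 n 500000) (sym (length-filterᵇ V₁ (allFin n))) (part-size α n (card V₁) α≤ size)
      B-degree : ∀ v → V₁ v ≡ true → Scaled 199990 n 500000 (N G v (filterᵇ (not ∘ V₁) (allFin n)))
      B-degree v v∈ = subst (Scaled 199990 n 500000) (sym (#-filter (adj G v) (not ∘ V₁) (allFin n))) (part-degree β n (degIn G v (compl V₁)) β≤ (degree₂ v v∈))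
      conclude : (∃ λ L → 2 ≤ L × n < 2 ^ L × Dominated 1000000 (L * L) n) → HasSpanningGenHalin G
      conclude (L , 2≤L , n<2^L , n-large) = Clean.clean G V₁ L degree′ A-large B-degree 2≤L n<2^L n-large

open import Defs
open import Data.Nat using (ℕ)
import Data.Nat as ℕ
open import Data.Integer using (+_)
open import Data.Rational using (ℚ; _/_; _<_; _≤_; _*_; _-_; _+_; 0ℚ; 1ℚ)
open import Data.Fin using (Fin)
open import Data.Bool using (true)
open import Data.Product using (Σ; _×_)
open import Relation.Binary.PropositionalEquality using (_≡_)
open import Data.Product using (_,_)
import Data.Integer as ℤ
import Data.Rational as ℚ
open Development using (spanning-Halin-of-dense-partition; threshold)

theorem4p3 : Σ ℚ λ α₀ → 0ℚ < α₀ ×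
    (∀ (α : ℚ) → 0ℚ < α → α ≤ α₀ →
    Σ ℚ λ β₀ → 0ℚ < β₀ ×
    (∀ (β : ℚ) → 0ℚ < β → β ≤ β₀ →
    Σ ℕ λ n₀ →
    ∀ (n : ℕ) → n₀ ℕ.≤ n →
    ∀ (G : Graph n) → ThreeConnected G →
    (∀ (v : Fin n) → (+ (2 ℕ.* n ℕ.+ 3)) / 5 ≤ ℕtoℚ (deg G v)) →
    ∀ (V₁ : VSet n) →
    ((+ 3) / 5 - α) * ℕtoℚ n < ℕtoℚ (card V₁) →
    1ℚ - (+ 3) / 1 * α ≤ density G V₁ (compl V₁) →
    (∀ (v : Fin n) → V₁ v ≡ true →
    (+ (2 ℕ.* n ℕ.+ 3)) / 5 - (+ 2) / 1 * β * ℕtoℚ n ≤ ℕtoℚ (degIn G v (compl V₁))) →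
    HasSpanningGenHalin G))
-- The estimates in `Clean` are made for α and β at their largest value 1/100000, so this serves for
-- both bounds, and 2^40 for n₀.
theorem4p3 = (+ 1) / 100000 , ℚ.*<* (ℤ.+<+ (ℕ.s≤s ℕ.z≤n)) , λ α _ α≤ →
  (+ 1) / 100000 , ℚ.*<* (ℤ.+<+ (ℕ.s≤s ℕ.z≤n)) , λ β _ β≤ →
  threshold , λ n n₀≤n G _ degree V₁ size _ degree₂ →
  spanning-Halin-of-dense-partition α β α≤ β≤ n n₀≤n G degree V₁ size degree₂
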